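{- Let $\Gamma=\{n_1,\dots,n_s\}$ be a finite set of pairwise coprime positive integers greater than $1$, and let $k\ge2$. Then both $H_k$ and $H_{\le k}$ are totally m-primitive, apart from the only exception of the case $\Gamma=\{2\}$ and $k=3$, in which case $$H_{\le 3}=\{1,2\}\cdot\{2^\beta,\,2^\beta+1:\ \beta\ge0\}.$$
   Context: $\mathbb{N}$ denotes the positive integers. $\{\Gamma\}$ denotes the multiplicative semigroup generated by $\Gamma$, with $1\in\{\Gamma\}$ (i.e. all products $n_1^{e_1}\cdots n_s^{e_s}$ with $e_i\ge0$). Put $H_1=\{\Gamma\}$, for $k\ge2$ put $H_k=\{u_1+\dots+u_k:\ u_i\in\{\Gamma\},\ \gcd(u_i,u_j)=1 \text{ for } 1\le i<j\le k\}$, and $H_{\le k}=\bigcup_{\ell=1}^k H_\ell$. $\mathcal{B}\cdot\mathcal{C}=\{bc:b\in\mathcal{B},c\in\mathcal{C}\}$. An infinite set $\mathcal{A}\subset\mathbb{N}$ is m-reducible if $\mathcal{A}=\mathcal{B}\cdot\mathcal{C}$ for some $\mathcal{B},\mathcal{C}\subset\mathbb{N}$ with $|\mathcal{B}|\ge2$, $|\mathcal{C}|\ge2$; otherwise it is m-primitive. Two sets satisfy $\mathcal{A}\sim\mathcal{A}'$ if there is $K$ with $\mathcal{A}\cap[K,+\infty)=\mathcal{A}'\cap[K,+\infty)$. An infinite set $\mathcal{A}\subset\mathbb{N}$ is totally m-primitive if every $\mathcal{A}'\subset\mathbb{N}$ with $\mathcal{A}'\sim\mathcal{A}$ is m-primitive.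 -}

module Defs where

open import Level using (0ℓ)
open import Data.Nat using (ℕ; zero; suc; _+_; _*_; _^_; _≤_; _<_)
open import Data.Nat.Coprimality using (Coprime)
open import Data.List using (List)
open import Data.List.Membership.Propositional using (_∈_)
open import Data.Vec using (Vec; lookup; sum)
open import Data.Fin using (Fin)
open import Data.Product using (Σ; ∃; _×_; _,_)
open import Data.Sum using (_⊎_)
open import Data.Empty using (⊥)
open import Relation.Nullary using (¬_)
open import Relation.Unary using (Pred)
open import Relation.Binary.PropositionalEquality using (_≡_; _≢_)
open import Function.Bundles using (_⇔_)

SetN : Set₁
SetN = Pred ℕ 0ℓ

Positive : SetN → Set
Positive A = ∀ a → A a → 1 ≤ a

_≐_ : SetN → SetN → Set
A ≐ B = ∀ a → A a ⇔ B a

data SG (Γ : List ℕ) : ℕ → Set where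
  sg-one : SG Γ 1
  sg-mul : ∀ {n u} → n ∈ Γ → SG Γ u → SG Γ (n * u)

SumK : List ℕ → ℕ → SetN
SumK Γ k a = Σ (Vec ℕ k) λ u →
  (∀ i → SG Γ (lookup u i)) ×
  (∀ i j → i ≢ j → Coprime (lookup u i) (lookup u j)) ×
  sum u ≡ a

-- H_k  (H_0 is not used; taken empty)
H : List ℕ → ℕ → SetN
H Γ zero a = ⊥
H Γ (suc zero) a = SG Γ a
H Γ (suc (suc k)) a = SumK Γ (suc (suc k)) a

Hle : List ℕ → ℕ → SetN
Hle Γ k a = Σ ℕ λ l → 1 ≤ l × l ≤ k × H Γ l a

_·_ : SetN → SetN → SetN
(B · C) a = Σ ℕ λ b → Σ ℕ λ c → B b × C c × a ≡ b * c

Infinite : SetN → Set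
Infinite A = ∀ m → Σ ℕ λ a → m ≤ a × A a

AtLeastTwo : SetN → Set
AtLeastTwo B = Σ ℕ λ b₁ → Σ ℕ λ b₂ → b₁ ≢ b₂ × B b₁ × B b₂

MReducible : SetN → Set₁
MReducible A = Σ SetN λ B → Σ SetN λ C →
  Positive B × Positive C × AtLeastTwo B × AtLeastTwo C × A ≐ (B · C)

MPrimitive : SetN → Set₁
MPrimitive A = ¬ MReducible A

_∼_ : SetN → SetN → Set
A ∼ A' = Σ ℕ λ K → ∀ a → K ≤ a → (A a ⇔ A' a)

TotallyMPrimitive : SetN → Set₁
TotallyMPrimitive A = Infinite A ×
  (∀ (A' : SetN) → Positive A' → A' ∼ A → MPrimitive A')

OneTwo : SetN
OneTwo b = b ≡ 1 ⊎ b ≡ 2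

PowOrPowPlusOne : SetN
PowOrPowPlusOne c = Σ ℕ λ β → c ≡ 2 ^ β ⊎ c ≡ 2 ^ β + 1

{-# OPTIONS --safe #-}
-- Every element of H_l is a sum of l pairwise coprime products of the generators n_i, hence is
-- given by a map T sending each i to the summand containing n_i, and a vector y of exponents.
-- Suppose a set equal to A = H_k or H_{≤k} from some point on is B · C, with both factors nontrivial.
--
-- Both B and C infinite: for exponent vectors z in a box, write n^z + κ = b c and let c, say, be
-- the larger factor. Since the product of the n_i^(z_i) is highly divisible, c determines z. Take many
-- b_t in B: each b_t c is in A. By pigeonhole over (z, t), some b_t c and b_t′ c have exponent vectors
-- close to each other, while the summands of the first are well separated in size. Then
-- b_t′ Σ V_j = b_t Σ V′_j forces b_t′ V_j = b_t V′_j for every nontrivial summand, so b_t = b_t′.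
--
-- B bounded, at least two generators: write n_0^(x_0) + ∏_{i>0} n_i^(x_i) + m = b c, with x in a box and
-- n_0^(x_0) dominating, and take b′ ≠ b in B. In b′ (n_0^(x_0) + ...) = b Σ V_j one compares modulo large
-- powers of the n_i; two exponents in the same short interval that are congruent in this sense agree,
-- so the vectors x that occur have fewer codes than the box has points.
--
-- B bounded, one generator: n^x and n^y can be compared with the constants separately, and the
-- resulting divisibility relations leave only n = 2, k = 3.

module Submission where

open import Defs
open import Data.Nat hiding (compare; equal)
open import Data.Nat.Properties
open import Data.Nat.DivMod
open import Data.Nat.Divisibility
open import Data.Nat.Coprimality as Coprimality using (Coprime; coprime-divisor; 1-coprimeTo)
open import Data.Nat.Tactic.RingSolver using (solve-∀)
open import Algebra.Properties.CommutativeMonoid.Sum *-1-commutativeMonoid using () renaming (sum to ∏; sum-cong-≗ to ∏-cong; sum-remove to ∏-remove; ∑-distrib-+ to ∏-distrib-*)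
open import Data.Fin as Fin using (Fin; zero; suc; toℕ; fromℕ<; punchIn; punchOut; combine; remQuot; finToFun; funToFin; join)
open import Data.Fin.Properties as Finₚ using (any?; toℕ<n; toℕ-injective; fromℕ<-injective; combine-injective; combine-remQuot; finToFun-funToFin; funToFin-finToFin; splitAt-join; punchIn-punchOut)
open import Data.List using (List; []; _∷_; length)
import Data.List as List
open import Data.List.Membership.Propositional using (_∈_)
open import Data.List.Membership.Propositional.Properties using (∈-lookup)
open import Data.List.Relation.Unary.All as All using (All; []; _∷_)
open import Data.List.Relation.Unary.AllPairs using (AllPairs; []; _∷_)
open import Data.List.Relation.Unary.Any using (here; there; index)
open import Data.Vec using (Vec; []; _∷_; lookup; replicate; sum)
open import Data.Vec.Properties using (lookup-replicate)
open import Data.Product using (Σ; ∃; ∃₂; _×_; _,_; proj₁; proj₂)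
open import Data.Sum using (_⊎_; inj₁; inj₂)
open import Data.Sum.Properties using (inj₁-injective; inj₂-injective)
open import Data.Empty using (⊥; ⊥-elim)
open import Data.Unit using (⊤; tt)
open import Function using (_∘_; id)
open import Function.Bundles using (mk⇔; Equivalence)
open import Relation.Nullary using (¬_; Dec; yes; no; contradiction)
open import Relation.Nullary.Decidable using (_×-dec_; _⊎-dec_; ¬?)
open import Relation.Binary.Definitions using (tri<; tri≈; tri>)
open import Relation.Binary.PropositionalEquality

-- The equation `b′ Σ V_j = b Σ V′_j` is an S-unit equation. No finiteness theorem for such
-- equations is invoked; counting takes its place, so everything depends on codes that are shorter
-- than the data they determine. When both factors are infinite, the obstacle is the order of
-- choices. A bound on the chosen multipliers is known only after their number `M` is fixed, so `M`
-- may depend on the generators and on `k` alone. For this reason the side of the box, the length of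
-- a cell and the threshold for "well separated" are all proportional to one parameter `E`, chosen
-- last, while the ratios between them, which decide the count, are fixed beforehand. The constants
-- come from padding: `m` summands equal to 1 bring a sum of two coprime terms to `2 + m` terms. For
-- `H_k` this forces `m = k - 2`. For `H_{≤k}` the value `m = 0` is taken, because there a multiple
-- may be a single product of generators, and this is excluded by a coprimality argument that works
-- for the constant 1. Logarithms never occur: sizes are compared as powers of 2, with `n < 2 ^ n`.

-- Codes and the pigeonhole principle

-- An injection, up to Eq, of the elements of X satisfying In into a set with n elements.
record Code (X : Set) (n : ℕ) : Set₁ where
  field
    In      : X → Set
    Eq      : X → X → Set
    enc     : ∀ x → In x → Fin n
    enc-inj : ∀ {x y} p q → enc x p ≡ enc y q → Eq x y

open Code

digit : ∀ n → Code ℕ n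
digit n = record
  { In = _< n ; Eq = _≡_ ; enc = λ _ p → fromℕ< p
  ; enc-inj = λ p q → fromℕ<-injective _ _ p q }

element : ∀ n → Code (Fin n) n
element n = record
  { In = λ _ → ⊤ ; Eq = _≡_ ; enc = λ i _ → i ; enc-inj = λ _ _ → id }

infixr 2 _⊗_
infixr 1 _⊕_

_⊗_ : ∀ {X Y m n} → Code X m → Code Y n → Code (X × Y) (m * n)
c ⊗ d = record
  { In  = λ (x , y) → In c x × In d y
  ; Eq  = λ (x , y) (x′ , y′) → Eq c x x′ × Eq d y y′
  ; enc = λ (x , y) (p , q) → combine (enc c x p) (enc d y q)
  ; enc-inj = λ (p , q) (p′ , q′) e →
      let e₁ , e₂ = combine-injective _ _ _ _ e in enc-inj c p p′ e₁ , enc-inj d q q′ e₂ }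

_⊕_ : ∀ {X Y m n} → Code X m → Code Y n → Code (X ⊎ Y) (m + n)
_⊕_ {X} {Y} {m} {n} c d = record
  { In = in′ ; Eq = eq′ ; enc = λ x p → join m n (enc′ x p)
  ; enc-inj = λ {x} {y} p q e → inj′ x y p q
      (trans (sym (splitAt-join m n _)) (trans (cong (Fin.splitAt m) e) (splitAt-join m n _))) }
  where
  in′ : X ⊎ Y → Set
  in′ (inj₁ x) = In c x
  in′ (inj₂ y) = In d y
  eq′ : X ⊎ Y → X ⊎ Y → Set
  eq′ (inj₁ x) (inj₁ y) = Eq c x y
  eq′ (inj₂ x) (inj₂ y) = Eq d x y
  eq′ (inj₁ _) (inj₂ _) = ⊥
  eq′ (inj₂ _) (inj₁ _) = ⊥
  enc′ : ∀ x → in′ x → Fin m ⊎ Fin n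
  enc′ (inj₁ x) p = inj₁ (enc c x p)
  enc′ (inj₂ y) p = inj₂ (enc d y p)
  inj′ : ∀ x y p q → enc′ x p ≡ enc′ y q → eq′ x y
  inj′ (inj₁ x) (inj₁ y) p q e = enc-inj c p q (inj₁-injective e)
  inj′ (inj₂ x) (inj₂ y) p q e = enc-inj d p q (inj₂-injective e)

-- Exponent vectors are functions, and equality of values does not give propositional equality of
-- functions. Hence `Eq` is pointwise here, and `Code` carries its own relation.
power : ∀ {X n} → Code X n → ∀ s → Code (Fin s → X) (n ^ s)
power c s = record
  { In  = λ f → ∀ i → In c (f i)
  ; Eq  = λ f g → ∀ i → Eq c (f i) (g i)
  ; enc = λ f p → funToFin (λ i → enc c (f i) (p i))
  ; enc-inj = λ {f} {g} p q e i → enc-inj c (p i) (q i)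
      (trans (sym (finToFun-funToFin (λ i → enc c (f i) (p i)) i))
        (trans (cong (λ k → finToFun k i) e) (finToFun-funToFin (λ i → enc c (g i) (q i)) i))) }

code-pigeonhole : ∀ {X m n} (c : Code X m) → m < n → (f : Fin n → X) → (∀ i → In c (f i)) →
  ∃₂ λ i j → i ≢ j × Eq c (f i) (f j)
code-pigeonhole c m<n f p with Finₚ.pigeonhole m<n (λ i → enc c (f i) (p i))
... | i , j , i<j , e = i , j , Finₚ.<⇒≢ i<j , enc-inj c (p i) (p j) e

finToFun-injective : ∀ {m n} (i j : Fin (m ^ n)) → (∀ k → finToFun {m} {n} i k ≡ finToFun j k) → i ≡ j
finToFun-injective {m} {n} i j e =
  trans (sym (funToFin-finToFin {n} {m} i)) (trans (go {n} e) (funToFin-finToFin {n} {m} j))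
  where
  go : ∀ {n} {f g : Fin n → Fin m} → (∀ k → f k ≡ g k) → funToFin f ≡ funToFin g
  go {zero}  e = refl
  go {suc n} e = cong₂ combine (e zero) (go (e ∘ suc))

punch-agree : ∀ {s} {X : Set} (f g : Fin (suc s) → X) i → f i ≡ g i →
  (∀ j → f (punchIn i j) ≡ g (punchIn i j)) → ∀ j → f j ≡ g j
punch-agree f g i e h j with i Finₚ.≟ j
... | yes refl = e
... | no i≢j = subst (λ k → f k ≡ g k) (punchIn-punchOut i≢j) (h (punchOut i≢j))

-- Arithmetic

n<2^n : ∀ n → n < 2 ^ n
n<2^n zero = s≤s z≤n
n<2^n (suc n) = begin-strict
  suc n           <⟨ s≤s (n<2^n n) ⟩
  suc (2 ^ n)     ≤⟨ +-monoˡ-≤ (2 ^ n) (m^n>0 2 n) ⟩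
  2 ^ n + 2 ^ n   ≡⟨ lem (2 ^ n) ⟩
  2 ^ suc n       ∎
  where
  open ≤-Reasoning
  lem : ∀ x → x + x ≡ 2 * x
  lem = solve-∀

coprime-*ʳ : ∀ {m a b} → Coprime m a → Coprime m b → Coprime m (a * b)
coprime-*ʳ c d {k} (k∣m , k∣ab) =
  d (k∣m , coprime-divisor (λ (p , q) → c (∣-trans p k∣m , q)) k∣ab)

coprime-1ʳ : ∀ m → Coprime m 1
coprime-1ʳ m = Coprimality.sym (1-coprimeTo m)

coprime-^ʳ : ∀ {m a} e → Coprime m a → Coprime m (a ^ e)
coprime-^ʳ zero    c = coprime-1ʳ _
coprime-^ʳ (suc e) c = coprime-*ʳ c (coprime-^ʳ e c)

coprime-^ : ∀ {m a} d e → Coprime m a → Coprime (m ^ d) (a ^ e)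
coprime-^ d e c = Coprimality.sym (coprime-^ʳ d (Coprimality.sym (coprime-^ʳ e c)))

^-monoʳ-∣ : ∀ n {a b} → a ≤ b → n ^ a ∣ n ^ b
^-monoʳ-∣ n {a} {b} a≤b = subst (n ^ a ∣_)
  (trans (sym (^-distribˡ-+-* n a (b ∸ a))) (cong (n ^_) (m+[n∸m]≡n a≤b)))
  (m∣m*n (n ^ (b ∸ a)))

^-cancelʳ-< : ∀ {n a b} → 1 < n → n ^ a < n ^ b → a < b
^-cancelʳ-< {n} {a} {b} 1<n p with a <? b
... | yes q = q
... | no q = contradiction p (≤⇒≯ (^-monoʳ-≤ n {{>-nonZero (<⇒≤ 1<n)}} (≮⇒≥ q)))

^-cancelʳ-≤ : ∀ {n a b} → 1 < n → n ^ a ≤ n ^ b → a ≤ b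
^-cancelʳ-≤ {n} {a} {b} 1<n p with a ≤? b
... | yes q = q
... | no q = contradiction p (<⇒≱ (^-monoʳ-< n 1<n (≰⇒> q)))

^-cancelʳ-∣ : ∀ {n a b} → 1 < n → n ^ a ∣ n ^ b → a ≤ b
^-cancelʳ-∣ {n} {a} {b} 1<n d =
  ^-cancelʳ-≤ 1<n (∣⇒≤ {{m^n≢0 n b {{>-nonZero (<⇒≤ 1<n)}}}} d)

2^≤ : ∀ {n} e → 1 < n → 2 ^ e ≤ n ^ e
2^≤ e 1<n = ^-monoˡ-≤ e 1<n

/-close : ∀ {y y′} d .{{_ : NonZero d}} → y / d ≡ y′ / d → y′ < y + d
/-close {y} {y′} d e = begin-strict
  y′                   ≡⟨ m≡m%n+[m/n]*n y′ d ⟩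
  y′ % d + y′ / d * d  <⟨ +-monoˡ-< _ (m%n<n y′ d) ⟩
  d + y′ / d * d       ≡⟨ cong (λ q → d + q * d) (sym e) ⟩
  d + y / d * d        ≤⟨ +-monoʳ-≤ d (m/n*n≤m y d) ⟩
  d + y                ≡⟨ +-comm d y ⟩
  y + d                ∎
  where open ≤-Reasoning

%-close-≤ : ∀ {y y′} d .{{_ : NonZero d}} → y ≤ y′ → y′ < y + d → y′ % d ≡ y % d → y′ ≡ y
%-close-≤ {y} {y′} d y≤y′ q e = go (y′ / d ≤? y / d)
  where
  open ≤-Reasoning
  go : Dec (y′ / d ≤ y / d) → y′ ≡ y
  go (yes r) = begin-equality
    y′                    ≡⟨ m≡m%n+[m/n]*n y′ d ⟩
    y′ % d + y′ / d * d   ≡⟨ cong₂ (λ a b → a + b * d) e (≤-antisym r (/-monoˡ-≤ d y≤y′)) ⟩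
    y % d + y / d * d     ≡⟨ sym (m≡m%n+[m/n]*n y d) ⟩
    y                     ∎
  go (no r) = contradiction q (≤⇒≯ (begin
    y + d                     ≡⟨ cong (_+ d) (m≡m%n+[m/n]*n y d) ⟩
    y % d + y / d * d + d     ≡⟨ lem (y % d) (y / d) d ⟩
    y % d + suc (y / d) * d   ≤⟨ +-monoʳ-≤ (y % d) (*-monoˡ-≤ d (≰⇒> r)) ⟩
    y % d + y′ / d * d        ≡⟨ cong (_+ y′ / d * d) (sym e) ⟩
    y′ % d + y′ / d * d       ≡⟨ sym (m≡m%n+[m/n]*n y′ d) ⟩
    y′                        ∎))
    where
    lem : ∀ a b c → a + b * c + c ≡ a + suc b * c
    lem = solve-∀

%-close : ∀ {y y′} d .{{_ : NonZero d}} → y < y′ + d → y′ < y + d → y % d ≡ y′ % d → y ≡ y′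
%-close {y} {y′} d p q e with ≤-total y y′
... | inj₁ y≤y′ = sym (%-close-≤ d y≤y′ q (sym e))
... | inj₂ y′≤y = %-close-≤ d y′≤y p e

-- m divides b W n^y (n^g - 1) with g = y′ - y below the bucket width d, hence also the
-- smaller positive number b (n^g - 1).
bucket-<-absurd : ∀ {m b W n y y′ A A′} d .{{_ : NonZero d}} →
  Coprime m W → Coprime m n → 0 < b → 1 < n → b * n ^ d ≤ m → m ∣ A → m ∣ A′ →
  A + b * (n ^ y′ * W) ≡ A′ + b * (n ^ y * W) → y < y′ → y′ < y + d → ⊥
bucket-<-absurd {m} {b} {W} {n} {y} {y′} {A} {A′} d mW mn 0<b 1<n bd m∣A m∣A′ e y<y′ y′<y+d =
  contradiction (∣⇒≤ {{>-nonZero pos}} m∣bh) (<⇒≱ small)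
  where
  open ≤-Reasoning
  instance _ = >-nonZero (<⇒≤ 1<n)
  instance _ = >-nonZero 0<b
  g = y′ ∸ y
  g>0 : 0 < g
  g>0 = m<n⇒0<n∸m y<y′
  y′≡ : y + g ≡ y′
  y′≡ = m+[n∸m]≡n (<⇒≤ y<y′)
  h = n ^ g ∸ 1
  1<n^g : 1 < n ^ g
  1<n^g = ^-monoʳ-< n 1<n g>0
  h+1 : h + 1 ≡ n ^ g
  h+1 = m∸n+n≡m (<⇒≤ 1<n^g)
  lem : ∀ A b p h W → A + b * (p * h * W) + b * (p * W) ≡ A + b * (p * (h + 1) * W)
  lem = solve-∀
  A′≡ : A + b * (n ^ y * h * W) ≡ A′
  A′≡ = +-cancelʳ-≡ (b * (n ^ y * W)) _ _ (begin-equality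
    A + b * (n ^ y * h * W) + b * (n ^ y * W) ≡⟨ lem A b (n ^ y) h W ⟩
    A + b * (n ^ y * (h + 1) * W)             ≡⟨ cong (λ z → A + b * (n ^ y * z * W)) h+1 ⟩
    A + b * (n ^ y * n ^ g * W)               ≡⟨ cong (λ z → A + b * (z * W)) (sym (^-distribˡ-+-* n y g)) ⟩
    A + b * (n ^ (y + g) * W)                 ≡⟨ cong (λ z → A + b * (n ^ z * W)) y′≡ ⟩
    A + b * (n ^ y′ * W)                      ≡⟨ e ⟩
    A′ + b * (n ^ y * W)                      ∎)
  lem₂ : ∀ b p h W → b * (p * h * W) ≡ (p * W) * (b * h)
  lem₂ = solve-∀
  m∣bh : m ∣ b * h
  m∣bh = coprime-divisor (coprime-*ʳ (coprime-^ʳ y mn) mW)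
    (subst (m ∣_) (lem₂ b (n ^ y) h W) (∣m+n∣m⇒∣n (subst (m ∣_) (sym A′≡) m∣A′) m∣A))
  pos : 0 < b * h
  pos = *-mono-< {0} {b} {0} 0<b (m<n⇒0<n∸m 1<n^g)
  small : b * h < m
  small = begin-strict
    b * h       <⟨ *-monoʳ-< b (≤-reflexive (trans (+-comm 1 h) h+1)) ⟩
    b * n ^ g   ≤⟨ *-monoʳ-≤ b (^-monoʳ-≤ n (<⇒≤ (+-cancelˡ-< y _ _ (subst (_< y + d) (sym y′≡) y′<y+d)))) ⟩
    b * n ^ d   ≤⟨ bd ⟩
    m           ∎

same-bucket : ∀ {m b W n y y′ A A′} d .{{_ : NonZero d}} →
  Coprime m W → Coprime m n → 0 < b → 1 < n → b * n ^ d ≤ m → m ∣ A → m ∣ A′ →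
  A + b * (n ^ y′ * W) ≡ A′ + b * (n ^ y * W) → y / d ≡ y′ / d → y ≡ y′
same-bucket {y = y} {y′} d mW mn 0<b 1<n bd m∣A m∣A′ e q with <-cmp y y′
... | tri≈ _ y≡y′ _ = y≡y′
... | tri< y<y′ _ _ = ⊥-elim (bucket-<-absurd d mW mn 0<b 1<n bd m∣A m∣A′ e y<y′ (/-close d q))
... | tri> _ _ y′<y = ⊥-elim (bucket-<-absurd d mW mn 0<b 1<n bd m∣A′ m∣A (sym e) y′<y (/-close d (sym q)))

-- Finite products

∏-mono : ∀ {s} {f g : Fin s → ℕ} → (∀ i → f i ≤ g i) → ∏ f ≤ ∏ g
∏-mono {zero}  h = ≤-refl
∏-mono {suc s} h = *-mono-≤ (h zero) (∏-mono (h ∘ suc))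

∏>0 : ∀ {s} {f : Fin s → ℕ} → (∀ i → 0 < f i) → 0 < ∏ f
∏>0 {zero}  h = s≤s z≤n
∏>0 {suc s} {f} h = *-mono-< {0} {f zero} {0} (h zero) (∏>0 (h ∘ suc))

∏-1 : ∀ {s} {f : Fin s → ℕ} → (∀ i → f i ≡ 1) → ∏ f ≡ 1
∏-1 {zero}  h = refl
∏-1 {suc s} h = cong₂ _*_ (h zero) (∏-1 (h ∘ suc))

^-distribʳ-* : ∀ a b e → (a * b) ^ e ≡ a ^ e * b ^ e
^-distribʳ-* a b zero = refl
^-distribʳ-* a b (suc e) = trans (cong (a * b *_) (^-distribʳ-* a b e)) (lem a b (a ^ e) (b ^ e))
  where
  lem : ∀ a b c d → a * b * (c * d) ≡ a * c * (b * d)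
  lem = solve-∀

∏-^ : ∀ {s} (f : Fin s → ℕ) e → ∏ (λ i → f i ^ e) ≡ ∏ f ^ e
∏-^ {zero}  f e = sym (^-zeroˡ e)
∏-^ {suc s} f e = trans (cong (f zero ^ e *_) (∏-^ (f ∘ suc) e))
  (sym (^-distribʳ-* (f zero) (∏ (f ∘ suc)) e))

∏-∣ : ∀ {s} {f g : Fin s → ℕ} → (∀ i → f i ∣ g i) → ∏ f ∣ ∏ g
∏-∣ {zero}  h = ∣-refl
∏-∣ {suc s} h = *-pres-∣ (h zero) (∏-∣ (h ∘ suc))

∣-∏ : ∀ {s} (f : Fin s → ℕ) i → f i ∣ ∏ f
∣-∏ f zero    = m∣m*n _
∣-∏ f (suc i) = ∣n⇒∣m*n (f zero) (∣-∏ (f ∘ suc) i)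

coprime-∏ : ∀ {s m} {f : Fin s → ℕ} → (∀ i → Coprime m (f i)) → Coprime m (∏ f)
coprime-∏ {zero}  h = coprime-1ʳ _
coprime-∏ {suc s} h = coprime-*ʳ (h zero) (coprime-∏ (h ∘ suc))

-- Sums over initial segments

-- The terms are indexed by `ℕ`, not `Fin l`, so that representations whose lengths are only
-- propositionally equal can be compared without transport.
S : ℕ → (ℕ → ℕ) → ℕ
S zero    f = 0
S (suc l) f = S l f + f l

S-cong : ∀ l {f g} → (∀ j → j < l → f j ≡ g j) → S l f ≡ S l g
S-cong zero    h = refl
S-cong (suc l) h = cong₂ _+_ (S-cong l (λ j p → h j (m<n⇒m<1+n p))) (h l ≤-refl)

S-term : ∀ l {f j} → j < l → f j ≤ S l f
S-term (suc l) {f} {j} (s≤s j≤l) with m≤n⇒m<n∨m≡n j≤l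
... | inj₁ j<l  = ≤-trans (S-term l j<l) (m≤m+n _ _)
... | inj₂ refl = m≤n+m _ _

S-1 : ∀ l → S l (λ _ → 1) ≡ l
S-1 zero = refl
S-1 (suc l) = trans (cong (_+ 1) (S-1 l)) (+-comm l 1)

S-* : ∀ l b f → S l (λ j → b * f j) ≡ b * S l f
S-* zero    b f = sym (*-zeroʳ b)
S-* (suc l) b f = trans (cong (_+ b * f l) (S-* l b f)) (sym (*-distribˡ-+ b (S l f) (f l)))

-- Adding crosswise avoids truncated subtraction; `t` is the only index at which the terms may
-- differ.
S-off₁ : ∀ l {f g t} → t < l → (∀ j → j < l → j ≢ t → f j ≡ g j) → S l f + g t ≡ S l g + f t
S-off₁ (suc l) {f} {g} {t} (s≤s t≤l) h with m≤n⇒m<n∨m≡n t≤l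
... | inj₁ t<l = begin-equality
    S l f + f l + g t     ≡⟨ lem (S l f) (f l) (g t) ⟩
    (S l f + g t) + f l   ≡⟨ cong₂ _+_ (S-off₁ l t<l (λ j p → h j (m<n⇒m<1+n p))) (h l ≤-refl (>⇒≢ t<l)) ⟩
    (S l g + f t) + g l   ≡⟨ sym (lem (S l g) (g l) (f t)) ⟩
    S l g + g l + f t     ∎
  where
  open ≤-Reasoning
  lem : ∀ a b c → a + b + c ≡ a + c + b
  lem = solve-∀
... | inj₂ refl = begin-equality
    S l f + f l + g l   ≡⟨ cong (λ z → z + f l + g l) (S-cong l (λ j p → h j (m<n⇒m<1+n p) (<⇒≢ p))) ⟩
    S l g + f l + g l   ≡⟨ lem (S l g) (f l) (g l) ⟩
    S l g + g l + f l   ∎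
  where
  open ≤-Reasoning
  lem : ∀ a b c → a + b + c ≡ a + c + b
  lem = solve-∀

update : ℕ → ℕ → (ℕ → ℕ) → ℕ → ℕ
update t x f j with j ≟ t
... | yes _ = x
... | no _  = f j

update-≡ : ∀ t x f → update t x f t ≡ x
update-≡ t x f with t ≟ t
... | yes _  = refl
... | no t≢t = contradiction refl t≢t

update-≢ : ∀ {t j} x f → j ≢ t → update t x f j ≡ f j
update-≢ {t} {j} x f j≢t with j ≟ t
... | yes j≡t = contradiction j≡t j≢t
... | no _    = refl

S-off₂ : ∀ l {f g t t′} → t < l → t′ < l → t ≢ t′ → (∀ j → j < l → j ≢ t → j ≢ t′ → f j ≡ g j) →
  S l f + (g t + g t′) ≡ S l g + (f t + f t′)
S-off₂ l {f} {g} {t} {t′} t<l t′<l t≢t′ h = begin-equality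
  S l f + (g t + g t′)   ≡⟨ lem (S l f) (g t) (g t′) ⟩
  (S l f + g t) + g t′   ≡⟨ cong (λ z → (S l f + z) + g t′) (sym ut) ⟩
  (S l f + u t) + g t′   ≡⟨ cong (_+ g t′) (S-off₁ l t<l fu) ⟩
  (S l u + f t) + g t′   ≡⟨ lem₂ (S l u) (f t) (g t′) ⟩
  (S l u + g t′) + f t   ≡⟨ cong (_+ f t) (S-off₁ l t′<l ug) ⟩
  (S l g + u t′) + f t   ≡⟨ cong (λ z → (S l g + z) + f t) (update-≢ (g t) f (t≢t′ ∘ sym)) ⟩
  (S l g + f t′) + f t   ≡⟨ lem₃ (S l g) (f t) (f t′) ⟩
  S l g + (f t + f t′)   ∎
  where
  open ≤-Reasoning
  u = update t (g t) f
  ut : u t ≡ g t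
  ut = update-≡ t (g t) f
  fu : ∀ j → j < l → j ≢ t → f j ≡ u j
  fu j _ j≢t = sym (update-≢ (g t) f j≢t)
  ug : ∀ j → j < l → j ≢ t′ → u j ≡ g j
  ug j p j≢t′ with j ≟ t
  ... | yes refl = refl
  ... | no j≢t   = h j p j≢t j≢t′
  lem : ∀ a b c → a + (b + c) ≡ a + b + c
  lem = solve-∀
  lem₂ : ∀ a b c → a + b + c ≡ a + c + b
  lem₂ = solve-∀
  lem₃ : ∀ a b c → a + c + b ≡ a + (b + c)
  lem₃ = solve-∀

∣-∣-+-≤ : ∀ a b c d → ∣ a + b - c + d ∣ ≤ ∣ a - c ∣ + ∣ b - d ∣
∣-∣-+-≤ a b c d = begin
  ∣ a + b - c + d ∣                       ≤⟨ ∣-∣-triangle (a + b) (c + b) (c + d) ⟩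
  ∣ a + b - c + b ∣ + ∣ c + b - c + d ∣   ≡⟨ cong₂ _+_ (trans (cong₂ ∣_-_∣ (+-comm a b) (+-comm c b)) (∣m+n-m+o∣≡∣n-o∣ b a c)) (∣m+n-m+o∣≡∣n-o∣ c b d) ⟩
  ∣ a - c ∣ + ∣ b - d ∣                   ∎
  where open ≤-Reasoning

S-dist : ∀ l {f g Z Y} → (∀ j → j < l → ∣ f j - g j ∣ * Z ≤ Y) → ∣ S l f - S l g ∣ * Z ≤ l * Y
S-dist zero    h = z≤n
S-dist (suc l) {f} {g} {Z} {Y} h = begin
  ∣ S l f + f l - S l g + g l ∣ * Z             ≤⟨ *-monoˡ-≤ Z (∣-∣-+-≤ (S l f) (f l) (S l g) (g l)) ⟩
  (∣ S l f - S l g ∣ + ∣ f l - g l ∣) * Z       ≡⟨ *-distribʳ-+ Z ∣ S l f - S l g ∣ _ ⟩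
  ∣ S l f - S l g ∣ * Z + ∣ f l - g l ∣ * Z     ≤⟨ +-mono-≤ (S-dist l (λ j p → h j (m<n⇒m<1+n p))) (h l ≤-refl) ⟩
  l * Y + Y                                     ≡⟨ +-comm (l * Y) Y ⟩
  suc l * Y                                     ∎
  where open ≤-Reasoning

∣-∣-transfer : ∀ {a b c d} → a + b ≡ c + d → ∣ b - d ∣ ≡ ∣ c - a ∣
∣-∣-transfer {a} {b} {c} {d} e = begin-equality
  ∣ b - d ∣           ≡⟨ sym (∣m+n-m+o∣≡∣n-o∣ a b d) ⟩
  ∣ a + b - a + d ∣   ≡⟨ cong₂ ∣_-_∣ (trans e (+-comm c d)) (+-comm a d) ⟩
  ∣ d + c - d + a ∣   ≡⟨ ∣m+n-m+o∣≡∣n-o∣ d c a ⟩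
  ∣ c - a ∣           ∎
  where open ≤-Reasoning

-- The totals agree, so the deviation at `t` is cancelled by all the others together. The factor `Z`
-- replaces a division: each of the others is at most `Y / Z`.
S-dominant : ∀ l {f g t Z Y} → t < l → S l f ≡ S l g →
  (∀ j → j < l → j ≢ t → ∣ f j - g j ∣ * Z ≤ Y) → ∣ f t - g t ∣ * Z ≤ l * Y
S-dominant l {f} {g} {t} {Z} {Y} t<l e h = begin
  ∣ f t - g t ∣ * Z        ≡⟨ cong (_* Z) (∣-∣-transfer {S l f′} {f t} {S l g} {g t} split) ⟩
  ∣ S l g - S l f′ ∣ * Z   ≤⟨ S-dist l bound ⟩
  l * Y                    ∎
  where
  open ≤-Reasoning
  f′ = update t (g t) f
  split : S l f′ + f t ≡ S l g + g t
  split = trans (S-off₁ l t<l (λ j _ j≢t → update-≢ (g t) f j≢t)) (cong₂ _+_ e (update-≡ t (g t) f))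
  bound : ∀ j → j < l → ∣ g j - f′ j ∣ * Z ≤ Y
  bound j p with j ≟ t
  ... | yes refl = subst (_≤ Y) (sym (cong (_* Z) (∣n-n∣≡0 (g t)))) z≤n
  ... | no j≢t   = subst (_≤ Y) (cong (_* Z) (∣-∣-comm (f j) (g j))) (h j p j≢t)

-- Products of powers of the generators, and the summands of a representation

sel : ℕ → ℕ → ℕ → ℕ
sel t j x with t ≟ j
... | yes _ = x
... | no _  = 1

sel-≡ : ∀ {t j} x → t ≡ j → sel t j x ≡ x
sel-≡ {t} {j} x t≡j with t ≟ j
... | yes _  = refl
... | no t≢j = contradiction t≡j t≢j

sel-≢ : ∀ {t j} x → t ≢ j → sel t j x ≡ 1
sel-≢ {t} {j} x t≢j with t ≟ j
... | yes t≡j = contradiction t≡j t≢j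
... | no _    = refl

sel-elim : ∀ {t j x} (P : ℕ → Set) → (t ≡ j → P x) → P 1 → P (sel t j x)
sel-elim {t} {j} P p q with t ≟ j
... | yes e = p e
... | no _  = q

pw : ∀ {s} → (Fin s → ℕ) → (Fin s → ℕ) → ℕ
pw n x = ∏ (λ i → n i ^ x i)

pwTail : ∀ {s} → (Fin (suc s) → ℕ) → (Fin (suc s) → ℕ) → ℕ
pwTail n x = pw (n ∘ suc) (x ∘ suc)

pw-split : ∀ {s} (n y : Fin s → ℕ) i → Σ ℕ λ r → pw n y ≡ r * n i ^ y i ×
  (∀ {m} → (∀ j → j ≢ i → Coprime m (n j)) → Coprime m r)
pw-split {suc s} n y i = r , trans (∏-remove {i = i} (λ k → n k ^ y k)) (*-comm (n i ^ y i) r) ,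
  λ h → coprime-∏ (λ j → coprime-^ʳ (y (punchIn i j)) (h (punchIn i j) (Finₚ.punchInᵢ≢i i j)))
  where r = pw (n ∘ punchIn i) (y ∘ punchIn i)

-- T assigns to each generator the summand in which it occurs; V n T y j is the j-th summand.
V : ∀ {s} → (Fin s → ℕ) → (Fin s → ℕ) → (Fin s → ℕ) → ℕ → ℕ
V n T y j = ∏ (λ i → sel (T i) j (n i ^ y i))

-- Coprimality of the summands is built in: each generator has a single position `T i`. A position
-- taken by no generator has the value 1.
record Rep {s} (n : Fin s → ℕ) (l a : ℕ) : Set where
  field
    T   : Fin s → ℕ
    y   : Fin s → ℕ
    T<l : ∀ i → T i < l
    eq  : S l (V n T y) ≡ a

module Powers {s} (n : Fin s → ℕ) (1<n : ∀ i → 1 < n i)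
  (cop : ∀ i j → i ≢ j → Coprime (n i) (n j)) where

  instance
    n≢0 : ∀ {i} → NonZero (n i)
    n≢0 {i} = >-nonZero (<⇒≤ (1<n i))

  n^>0 : ∀ i e → 0 < n i ^ e
  n^>0 i e = m^n>0 (n i) e

  pw>0 : ∀ x → 0 < pw n x
  pw>0 x = ∏>0 (λ i → n^>0 i (x i))

  pw-cong : ∀ {x y} → (∀ i → x i ≡ y i) → pw n x ≡ pw n y
  pw-cong e = ∏-cong (λ i → cong (n i ^_) (e i))

  pw-≤ : ∀ {x X} → (∀ i → x i ≤ X) → pw n x ≤ ∏ n ^ X
  pw-≤ {x} {X} h = subst (pw n x ≤_) (∏-^ n X) (∏-mono (λ i → ^-monoʳ-≤ (n i) (h i)))

  pw-∣ : ∀ {x X} → (∀ i → X ≤ x i) → ∏ n ^ X ∣ pw n x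
  pw-∣ {x} {X} h = subst (_∣ pw n x) (∏-^ n X) (∏-∣ (λ i → ^-monoʳ-∣ (n i) (h i)))

  R>0 : 0 < ∏ n
  R>0 = ∏>0 (λ i → <⇒≤ (1<n i))

  n≤R : ∀ i → n i ≤ ∏ n
  n≤R i = ∣⇒≤ {{>-nonZero R>0}} (∣-∏ n i)

  V-cong : ∀ T y y′ j → (∀ i → T i ≡ j → y i ≡ y′ i) → V n T y j ≡ V n T y′ j
  V-cong T y y′ j h = ∏-cong go
    where
    go : ∀ i → sel (T i) j (n i ^ y i) ≡ sel (T i) j (n i ^ y′ i)
    go i with T i ≟ j
    ... | yes e = cong (n i ^_) (h i e)
    ... | no _  = refl

  V-congT : ∀ T T′ y j → (∀ i → T i ≡ T′ i) → V n T y j ≡ V n T′ y j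
  V-congT T T′ y j h = ∏-cong (λ i → cong (λ t → sel t _ _) (h i))

  V-empty : ∀ {T} y {j} → (∀ i → T i ≢ j) → V n T y j ≡ 1
  V-empty y h = ∏-1 (λ i → sel-≢ _ (h i))

  V-full : ∀ {T} y {j} → (∀ i → T i ≡ j) → V n T y j ≡ pw n y
  V-full y h = ∏-cong (λ i → sel-≡ _ (h i))

  V>0 : ∀ T y j → 0 < V n T y j
  V>0 T y j = ∏>0 (λ i → sel-elim (0 <_) (λ _ → n^>0 i (y i)) (s≤s z≤n))

  V-∣ : ∀ {T y j i} e → T i ≡ j → e ≤ y i → n i ^ e ∣ V n T y j
  V-∣ {T} {y} {j} {i} e Ti≡j e≤ = ∣-trans (^-monoʳ-∣ (n i) e≤)
    (subst (_∣ V n T y j) (sel-≡ _ Ti≡j) (∣-∏ (λ i → sel (T i) j (n i ^ y i)) i))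

  V-coprime-n : ∀ {T y j i} e → T i ≢ j → Coprime (n i ^ e) (V n T y j)
  V-coprime-n {T} {y} {j} {i} e Ti≢j = coprime-∏ (λ i′ → sel-elim (Coprime (n i ^ e))
    (λ Ti′≡j → coprime-^ e (y i′) (cop i i′ (λ { refl → Ti≢j Ti′≡j }))) (coprime-1ʳ _))

  V-coprime : ∀ {T x y j j′} → j ≢ j′ → Coprime (V n T x j) (V n T y j′)
  V-coprime {T} {x} {y} {j} {j′} j≢j′ = Coprimality.sym (coprime-∏ (λ i → sel-elim (Coprime _)
    (λ Ti≡j → Coprimality.sym (V-coprime-n {T} {y} (x i) (λ Ti≡j′ → j≢j′ (trans (sym Ti≡j) Ti≡j′)))) (coprime-1ʳ _)))

  V-+ : ∀ T x y j → V n T (λ i → x i + y i) j ≡ V n T x j * V n T y j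
  V-+ T x y j = trans (∏-cong go) (∏-distrib-* (λ i → sel (T i) j (n i ^ x i)) (λ i → sel (T i) j (n i ^ y i)))
    where
    go : ∀ i → sel (T i) j (n i ^ (x i + y i)) ≡ sel (T i) j (n i ^ x i) * sel (T i) j (n i ^ y i)
    go i with T i ≟ j
    ... | yes _ = ^-distribˡ-+-* (n i) (x i) (y i)
    ... | no _  = refl

  V-≤ : ∀ {T y Y j} → (∀ i → y i ≤ Y) → V n T y j ≤ ∏ n ^ Y
  V-≤ {T} {y} {Y} {j} h = subst (V n T y j ≤_) (∏-^ n Y) (∏-mono (λ i →
    sel-elim (_≤ n i ^ Y) (λ _ → ^-monoʳ-≤ (n i) (h i)) (n^>0 i Y)))

  -- Generators may be composite, so instead of prime factorisation the argument uses that the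
  -- cofactor of `n i ^ y i` is coprime to `n i`.
  exponent-≤ : ∀ x y → pw n x ≡ pw n y → ∀ i → x i ≤ y i
  exponent-≤ x y e i with pw-split n y i
  ... | rest , eq , cp = ^-cancelʳ-∣ (1<n i) (coprime-divisor
    (cp (λ j j≢i → Coprimality.sym (coprime-^ʳ (x i) (cop j i j≢i))))
    (subst (n i ^ x i ∣_) (trans e eq) (∣-∏ (λ i → n i ^ x i) i)))

  pw-injective : ∀ x y → pw n x ≡ pw n y → ∀ i → x i ≡ y i
  pw-injective x y e i = ≤-antisym (exponent-≤ x y e i) (exponent-≤ y x (sym e) i)

V-remove : ∀ {s} (n : Fin (suc s) → ℕ) T y i →
  V n T y (T i) ≡ n i ^ y i * V (n ∘ punchIn i) (T ∘ punchIn i) (y ∘ punchIn i) (T i)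
V-remove n T y i = trans (∏-remove {i = i} (λ k → sel (T k) (T i) (n k ^ y k)))
  (cong (_* ∏ (λ k → sel (T (punchIn i k)) (T i) (n (punchIn i k) ^ y (punchIn i k)))) (sel-≡ {T i} (n i ^ y i) refl))

-- When the other exponents agree, the two summands share the cofactor `C` and differ only in the
-- power of `n i`, which at least doubles with each unit of the exponent.
exponent-< : ∀ {s} (n : Fin (suc s) → ℕ) → (∀ i → 1 < n i) → ∀ f T y y′ i →
  (∀ j → y (punchIn i j) ≡ y′ (punchIn i j)) → V n T y (T i) < 2 ^ f * V n T y′ (T i) → y i < y′ i + f
exponent-< n 1<n f T y y′ i e h = ^-cancelʳ-< (1<n i) (*-cancelʳ-< C _ _ (begin-strict
    n i ^ y i * C                 ≡⟨ sym (V-remove n T y i) ⟩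
    V n T y (T i)                 <⟨ h ⟩
    2 ^ f * V n T y′ (T i)        ≡⟨ cong (2 ^ f *_) (trans (V-remove n T y′ i) (cong (n i ^ y′ i *_) C′≡)) ⟩
    2 ^ f * (n i ^ y′ i * C)      ≡⟨ lem (2 ^ f) (n i ^ y′ i) C ⟩
    n i ^ y′ i * 2 ^ f * C        ≤⟨ *-monoˡ-≤ C (*-monoʳ-≤ (n i ^ y′ i) (2^≤ f (1<n i))) ⟩
    n i ^ y′ i * n i ^ f * C      ≡⟨ cong (_* C) (sym (^-distribˡ-+-* (n i) (y′ i) f)) ⟩
    n i ^ (y′ i + f) * C          ∎))
  where
  open ≤-Reasoning
  C = V (n ∘ punchIn i) (T ∘ punchIn i) (y ∘ punchIn i) (T i)
  C′≡ : V (n ∘ punchIn i) (T ∘ punchIn i) (y′ ∘ punchIn i) (T i) ≡ C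
  C′≡ = ∏-cong (λ j → cong (λ v → sel (T (punchIn i j)) (T i) (n (punchIn i j) ^ v)) (sym (e j)))
  lem : ∀ a b c → a * (b * c) ≡ b * a * c
  lem = solve-∀

-- Representations of the elements of H

S-head : ∀ l f → S (suc l) f ≡ f 0 + S l (f ∘ suc)
S-head zero    f = sym (+-identityʳ _)
S-head (suc l) f = trans (cong (_+ f (suc l)) (S-head l f)) (+-assoc (f 0) _ _)

sum≡S : ∀ {l} (u : Vec ℕ l) {f} → (∀ j → lookup u j ≡ f (toℕ j)) → sum u ≡ S l f
sum≡S [] h = refl
sum≡S {suc l} (x ∷ u) {f} h = trans (cong₂ _+_ (h zero) (sum≡S u (h ∘ suc))) (sym (S-head l f))

module _ (Γ : List ℕ) (1<n : ∀ i → 1 < List.lookup Γ i)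
  (cop : ∀ i j → i ≢ j → Coprime (List.lookup Γ i) (List.lookup Γ j)) where

  private
    n = List.lookup Γ
    s = length Γ
  open Powers n 1<n cop

  bump : ∀ {m} → Fin m → (Fin m → ℕ) → Fin m → ℕ
  bump zero    e zero    = suc (e zero)
  bump zero    e (suc j) = e (suc j)
  bump (suc i) e zero    = e zero
  bump (suc i) e (suc j) = bump i (e ∘ suc) j

  pw-bump : ∀ {m} (n : Fin m → ℕ) i e → pw n (bump i e) ≡ n i * pw n e
  pw-bump n zero    e = *-assoc (n zero) _ _
  pw-bump n (suc i) e = trans (cong (n zero ^ e zero *_) (pw-bump (n ∘ suc) i (e ∘ suc)))
    (lem (n zero ^ e zero) (n (suc i)) _)
    where
    lem : ∀ a b c → a * (b * c) ≡ b * (a * c)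
    lem = solve-∀

  ∈-index : ∀ {Γ : List ℕ} {m} (p : m ∈ Γ) → List.lookup Γ (index p) ≡ m
  ∈-index (here refl) = refl
  ∈-index (there p)   = ∈-index p

  SG⇒pw : ∀ {u} → SG Γ u → Σ (Fin s → ℕ) λ e → u ≡ pw n e
  SG⇒pw sg-one = (λ _ → 0) , sym (∏-1 {f = λ i → n i ^ 0} (λ _ → refl))
  SG⇒pw (sg-mul p q) with SG⇒pw q
  ... | e , refl = bump (index p) e , sym (trans (pw-bump n (index p) e) (cong (_* pw n e) (∈-index p)))

  SG-* : ∀ {u v} → SG Γ u → SG Γ v → SG Γ (u * v)
  SG-* {v = v} sg-one q = subst (SG Γ) (sym (+-identityʳ v)) q
  SG-* {v = v} (sg-mul {m} {u} p r) q = subst (SG Γ) (sym (*-assoc m u v)) (sg-mul p (SG-* r q))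

  SG-^ : ∀ i e → SG Γ (n i ^ e)
  SG-^ i zero    = sg-one
  SG-^ i (suc e) = sg-mul (∈-lookup i) (SG-^ i e)

  SG-∏ : ∀ {m} {f : Fin m → ℕ} → (∀ i → SG Γ (f i)) → SG Γ (∏ f)
  SG-∏ {zero}  h = sg-one
  SG-∏ {suc m} h = SG-* (h zero) (SG-∏ (h ∘ suc))

  -- Pairwise coprime summands cannot share a generator, so each generator has positive exponent in
  -- at most one of them; `occ` searches for it.
  SumK⇒Rep : ∀ {l a} → SumK Γ (suc l) a → Rep n (suc l) a
  SumK⇒Rep {l} {a} (u , sg , cp , refl) = record
    { T = T ; y = y ; T<l = T<l ; eq = sym (sum≡S u term) }
    where
    e : Fin (suc l) → Fin s → ℕ
    e j = proj₁ (SG⇒pw (sg j))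
    u≡ : ∀ j → lookup u j ≡ pw n (e j)
    u≡ j = proj₂ (SG⇒pw (sg j))
    occ : ∀ i → Dec (∃ λ j → 0 < e j i)
    occ i = any? (λ j → 0 <? e j i)
    pick : ∀ {i} → Dec (∃ λ j → 0 < e j i) → Fin (suc l)
    pick (yes (j , _)) = j
    -- A generator occurring nowhere is assigned to summand 0, where its exponent is 0.
    pick (no _)        = zero
    T y : Fin s → ℕ
    T i = toℕ (pick (occ i))
    y i = e (pick (occ i)) i
    T<l : ∀ i → T i < suc l
    T<l i = toℕ<n (pick (occ i))
    vanish : ∀ i j (d : Dec (∃ λ j → 0 < e j i)) → toℕ (pick d) ≢ toℕ j → e j i ≡ 0
    vanish i j (no h) _ = n≤0⇒n≡0 (≮⇒≥ (λ p → h (j , p)))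
    vanish i j (yes (j₀ , p₀)) j₀≢j with e j i in eq
    ... | zero = refl
    ... | suc _ = contradiction
        (cp j₀ j (j₀≢j ∘ cong toℕ) (div j₀ p₀ , div j (subst (0 <_) (sym eq) (s≤s z≤n))))
        (>⇒≢ (1<n i))
      where
      div : ∀ j → 0 < e j i → n i ∣ lookup u j
      div j p = subst (n i ∣_) (sym (u≡ j)) (∣-trans
        (subst (_∣ n i ^ e j i) (*-identityʳ (n i)) (^-monoʳ-∣ (n i) p)) (∣-∏ (λ i → n i ^ e j i) i))
    term : ∀ j → lookup u j ≡ V n T y (toℕ j)
    term j = trans (u≡ j) (∏-cong go)
      where
      go : ∀ i → n i ^ e j i ≡ sel (T i) (toℕ j) (n i ^ y i)
      go i with T i ≟ toℕ j
      ... | yes p = cong (λ j → n i ^ e j i) (sym (toℕ-injective p))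
      ... | no p  = cong (n i ^_) (vanish i j (occ i) p)

  H⇒Rep : ∀ {l a} → H Γ l a → Rep n l a
  H⇒Rep {suc zero} h with SG⇒pw h
  ... | e , refl = record { T = λ _ → 0 ; y = e ; T<l = λ _ → s≤s z≤n ; eq = refl }
  H⇒Rep {suc (suc l)} h = SumK⇒Rep h

  -- The number 1 lies in the semigroup and is coprime to everything, itself included, so copies of
  -- it pad the sum to any prescribed length.
  two-term : ∀ {P Q} m → SG Γ P → SG Γ Q → Coprime P Q → H Γ (2 + m) (P + Q + m)
  two-term {P} {Q} m p q cp = P ∷ Q ∷ replicate m 1 , sg , cps ,
    trans (cong (λ z → P + (Q + z)) (ones m)) (sym (+-assoc P Q m))
    where
    ones : ∀ m → sum (replicate m 1) ≡ m
    ones zero = refl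
    ones (suc m) = cong suc (ones m)
    u = P ∷ Q ∷ replicate m 1
    sg : ∀ i → SG Γ (lookup u i)
    sg zero = p
    sg (suc zero) = q
    sg (suc (suc i)) = subst (SG Γ) (sym (lookup-replicate i 1)) sg-one
    1ʳ : ∀ x i → Coprime x (lookup (replicate m 1) i)
    1ʳ x i = subst (Coprime x) (sym (lookup-replicate i 1)) (coprime-1ʳ x)
    cps : ∀ i j → i ≢ j → Coprime (lookup u i) (lookup u j)
    cps i (suc (suc j)) _ = 1ʳ _ j
    cps (suc (suc i)) j _ = Coprimality.sym (1ʳ _ i)
    cps zero zero i≢j = contradiction refl i≢j
    cps zero (suc zero) _ = cp
    cps (suc zero) zero _ = Coprimality.sym cp
    cps (suc zero) (suc zero) i≢j = contradiction refl i≢j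

-- Comparing sums of coprime summands

S-mono-≤ : ∀ l {f g} → (∀ j → j < l → f j ≤ g j) → S l f ≤ S l g
S-mono-≤ zero    h = z≤n
S-mono-≤ (suc l) h = +-mono-≤ (S-mono-≤ l (λ j p → h j (m<n⇒m<1+n p))) (h l ≤-refl)

S-mono-< : ∀ l {f g t} → t < l → (∀ j → j < l → f j ≤ g j) → f t < g t → S l f < S l g
S-mono-< (suc l) {t = t} (s≤s t≤l) h p with m≤n⇒m<n∨m≡n t≤l
... | inj₁ t<l  = +-mono-<-≤ (S-mono-< l t<l (λ j q → h j (m<n⇒m<1+n q)) p) (h l ≤-refl)
... | inj₂ refl = +-mono-≤-< (S-mono-≤ l (λ j q → h j (m<n⇒m<1+n q))) p

dist-multiple : ∀ g a b → g * a ≢ g * b → g ≤ ∣ g * a - g * b ∣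
dist-multiple g a b ne = subst (g ≤_) (*-distribˡ-∣-∣ g a b)
  (m≤m*n g ∣ a - b ∣ {{≢-nonZero (λ e → ne (cong (g *_) (∣m-n∣≡0⇒m≡n e)))}})

dist-≤ : ∀ {a b c} → a ≤ c → b ≤ c → ∣ a - b ∣ ≤ c
dist-≤ {a} {b} p q = ≤-trans (∣m-n∣≤m⊔n a b) (⊔-lub p q)

-- `X / U` and `Y / V` are the same fraction, and both are in lowest terms; hence `X = Y`.
cross-coprime : ∀ {b b′ X Y U V} → 0 < b → 0 < b′ → 0 < X → Coprime X U → Coprime Y V →
  b′ * X ≡ b * Y → b′ * U ≡ b * V → b ≡ b′
cross-coprime {b} {b′} {X} {Y} {U} {V} 0<b 0<b′ 0<X XU YV e e′ =
  sym (*-cancelʳ-≡ b′ b X {{>-nonZero 0<X}} (trans e (cong (b *_) (sym X≡Y))))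
  where
  open ≤-Reasoning
  lem₁ : ∀ a b c d → a * b * (c * d) ≡ (a * c) * (b * d)
  lem₁ = solve-∀
  lem₂ : ∀ a b c d → (b * c) * (a * d) ≡ a * b * (d * c)
  lem₂ = solve-∀
  cross : X * V ≡ U * Y
  cross = *-cancelˡ-≡ _ _ (b′ * b) {{>-nonZero (*-mono-< {0} {b′} {0} 0<b′ 0<b)}} (begin-equality
    b′ * b * (X * V)       ≡⟨ lem₁ b′ b X V ⟩
    (b′ * X) * (b * V)     ≡⟨ cong₂ _*_ e (sym e′) ⟩
    (b * Y) * (b′ * U)     ≡⟨ lem₂ b′ b Y U ⟩
    b′ * b * (U * Y)       ∎)
  X≡Y : X ≡ Y
  X≡Y = ∣-antisym (coprime-divisor XU (subst (X ∣_) cross (m∣m*n V)))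
    (coprime-divisor YV (subst (Y ∣_) (trans (sym cross) (*-comm X V)) (n∣m*n U)))

module Blocks {s} (n : Fin s → ℕ) (1<n : ∀ i → 1 < n i)
  (cop : ∀ i j → i ≢ j → Coprime (n i) (n j)) where

  open Powers n 1<n cop

  private R = ∏ n

  -- The alternative `i ≡ i′` compares the summand with the empty summands, whose value is 1.
  -- Indexing by generators instead of positions singles out an exponent `y i` that the remaining
  -- exponents confine to a short interval.
  Bad : ℕ → (T y : Fin s → ℕ) → Fin s → Fin s → Set
  Bad F T y i i′ = (i ≡ i′ × V n T y (T i) < 2 ^ F) ⊎
    (T i ≢ T i′ × V n T y (T i) < 2 ^ F * V n T y (T i′) × V n T y (T i′) < 2 ^ F * V n T y (T i))

  Bad? : ∀ F T y i i′ → Dec (Bad F T y i i′)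
  Bad? F T y i i′ = (i Finₚ.≟ i′ ×-dec _ <? _) ⊎-dec (¬? (T i ≟ T i′) ×-dec _ <? _ ×-dec _ <? _)

  Good : ℕ → (T y : Fin s → ℕ) → Set
  Good F T y = ∀ i i′ → ¬ Bad F T y i i′

  -- A largest unequal summand would dominate all other differences.
  module EqualBlocks (E F k β b b′ l : ℕ) .{{_ : NonZero E}} (T x y : Fin s → ℕ)
    (T<l : ∀ i → T i < l) (l≤k : l ≤ k) (b≤β : b ≤ β) (b′≤β : b′ ≤ β)
    (cells : ∀ i → x i / E ≡ y i / E) (good : Good F T x)
    (0<F : 0 < F) (hF : k * (β * (R ^ E * R ^ E)) < 2 ^ F)
    (sums : S l (λ j → b′ * V n T x j) ≡ S l (λ j → b * V n T y j)) where

    open ≤-Reasoning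

    -- `G` has the exponents rounded down to multiples of `E`. Since `x` and `y` lie in the same
    -- cells, `G j` divides both `X j` and `Y j`, with cofactors at most `R ^ E`.
    X Y G X̂ Ŷ : ℕ → ℕ
    X = V n T x
    Y = V n T y
    G = V n T (λ i → x i / E * E)
    X̂ = V n T (λ i → x i % E)
    Ŷ = V n T (λ i → y i % E)

    X≡ : ∀ j → X j ≡ G j * X̂ j
    X≡ j = trans (V-cong T x (λ i → x i / E * E + x i % E) j (λ i _ → trans (m≡m%n+[m/n]*n (x i) E) (+-comm (x i % E) _)))
      (V-+ T (λ i → x i / E * E) (λ i → x i % E) j)

    Y≡ : ∀ j → Y j ≡ G j * Ŷ j
    Y≡ j = trans (V-cong T y (λ i → x i / E * E + y i % E) j (λ i _ → trans (m≡m%n+[m/n]*n (y i) E)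
        (trans (+-comm (y i % E) _) (cong (λ q → q * E + y i % E) (sym (cells i))))))
      (V-+ T (λ i → x i / E * E) (λ i → y i % E) j)

    X̂≤ : ∀ j → X̂ j ≤ R ^ E
    X̂≤ j = V-≤ (λ i → <⇒≤ (m%n<n (x i) E))

    Ŷ≤ : ∀ j → Ŷ j ≤ R ^ E
    Ŷ≤ j = V-≤ (λ i → <⇒≤ (m%n<n (y i) E))

    G≤X : ∀ j → G j ≤ X j
    G≤X j = subst (G j ≤_) (sym (X≡ j)) (m≤m*n (G j) (X̂ j) {{>-nonZero (V>0 T (λ i → x i % E) j)}})

    lem : ∀ b g x → b * (g * x) ≡ g * (b * x)
    lem = solve-∀

    p≡ : ∀ j → b′ * X j ≡ G j * (b′ * X̂ j)
    p≡ j = trans (cong (b′ *_) (X≡ j)) (lem b′ (G j) (X̂ j))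

    q≡ : ∀ j → b * Y j ≡ G j * (b * Ŷ j)
    q≡ j = trans (cong (b *_) (Y≡ j)) (lem b (G j) (Ŷ j))

    dist-upper : ∀ j → ∣ b′ * X j - b * Y j ∣ ≤ (β * R ^ E) * X j
    dist-upper j = ≤-trans (dist-≤ {c = G j * (β * R ^ E)}
      (subst (_≤ G j * (β * R ^ E)) (sym (p≡ j)) (*-monoʳ-≤ (G j) (*-mono-≤ b′≤β (X̂≤ j))))
      (subst (_≤ G j * (β * R ^ E)) (sym (q≡ j)) (*-monoʳ-≤ (G j) (*-mono-≤ b≤β (Ŷ≤ j)))))
      (subst (G j * (β * R ^ E) ≤_) (*-comm (X j) (β * R ^ E)) (*-monoˡ-≤ (β * R ^ E) (G≤X j)))

    dist-lower : ∀ j → b′ * X j ≢ b * Y j → G j ≤ ∣ b′ * X j - b * Y j ∣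
    dist-lower j ne = subst (G j ≤_) (sym (cong₂ ∣_-_∣ (p≡ j) (q≡ j)))
      (dist-multiple (G j) (b′ * X̂ j) (b * Ŷ j) (λ e → ne (trans (p≡ j) (trans e (sym (q≡ j))))))

    -- An unequal summand at another position that is not negligible beside `X (T i)`. Under `Good`
    -- this leaves only that it is larger.
    Bigger : Fin s → Fin s → Set
    Bigger i i′ = T i ≢ T i′ × b′ * X (T i′) ≢ b * Y (T i′) × ¬ (2 ^ F * X (T i′) ≤ X (T i))

    Bigger? : ∀ i i′ → Dec (Bigger i i′)
    Bigger? i i′ = ¬? (T i ≟ T i′) ×-dec ¬? (_ ≟ _) ×-dec ¬? (_ ≤? _)

    Bigger⇒< : ∀ i i′ → Bigger i i′ → X (T i) < X (T i′)
    Bigger⇒< i i′ (ne , _ , nle) = <-≤-trans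
        (subst (_< 2 ^ F * X (T i)) (*-identityˡ _) (*-monoˡ-< (X (T i)) {{>-nonZero (V>0 T x (T i))}} 1<2^F))
        (≮⇒≥ (λ lt → good i i′ (inj₂ (ne , ≰⇒> nle , lt))))
      where
      1<2^F : 1 < 2 ^ F
      1<2^F = ^-monoʳ-< 2 (s≤s (s≤s z≤n)) 0<F

    -- The difference at `t = T i` is a nonzero multiple of `G t`, hence at least `X t / R ^ E`. Any
    -- other difference is zero or comes from a summand at most `X t / 2 ^ F`; together these are at
    -- most `k β R ^ E X t / 2 ^ F`, which `hF` makes too small.
    no-bigger : ∀ i → ¬ (∃ λ i′ → Bigger i i′) → b′ * X (T i) ≢ b * Y (T i) → ⊥
    no-bigger i none ne = <⇒≱ hF (*-cancelˡ-≤ (G t) {{>-nonZero (V>0 T (λ i → x i / E * E) t)}} (begin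
      G t * 2 ^ F                               ≤⟨ *-monoˡ-≤ (2 ^ F) (dist-lower t ne) ⟩
      ∣ b′ * X t - b * Y t ∣ * 2 ^ F            ≤⟨ S-dominant l (T<l i) sums small ⟩
      l * ((β * R ^ E) * X t)                   ≤⟨ *-monoˡ-≤ _ l≤k ⟩
      k * ((β * R ^ E) * X t)                   ≡⟨ cong (λ z → k * ((β * R ^ E) * z)) (X≡ t) ⟩
      k * ((β * R ^ E) * (G t * X̂ t))           ≤⟨ *-monoʳ-≤ k (*-monoʳ-≤ (β * R ^ E) (*-monoʳ-≤ (G t) (X̂≤ t))) ⟩
      k * ((β * R ^ E) * (G t * R ^ E))         ≡⟨ lem₂ k β (R ^ E) (G t) ⟩
      G t * (k * (β * (R ^ E * R ^ E)))         ∎))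
      where
      t = T i
      lem₂ : ∀ k β r g → k * (β * r * (g * r)) ≡ g * (k * (β * (r * r)))
      lem₂ = solve-∀
      lem₃ : ∀ a b c → a * b * c ≡ a * (c * b)
      lem₃ = solve-∀
      2^F≤ : 2 ^ F ≤ X t
      2^F≤ = ≮⇒≥ (λ lt → good i i (inj₁ (refl , lt)))
      scale : ∀ j → 2 ^ F * X j ≤ X t → ∣ b′ * X j - b * Y j ∣ * 2 ^ F ≤ (β * R ^ E) * X t
      scale j h = begin
        ∣ b′ * X j - b * Y j ∣ * 2 ^ F   ≤⟨ *-monoˡ-≤ (2 ^ F) (dist-upper j) ⟩
        β * R ^ E * X j * 2 ^ F          ≡⟨ lem₃ (β * R ^ E) (X j) (2 ^ F) ⟩
        β * R ^ E * (2 ^ F * X j)        ≤⟨ *-monoʳ-≤ (β * R ^ E) h ⟩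
        β * R ^ E * X t                  ∎
      small : ∀ j → j < l → j ≢ t → ∣ b′ * X j - b * Y j ∣ * 2 ^ F ≤ (β * R ^ E) * X t
      small j j<l j≢t with any? (λ i′ → T i′ ≟ j)
      -- An empty summand equals 1, and the first alternative of `Bad` is excluded, so
      -- `2 ^ F ≤ X t`.
      ... | no empty = scale j (subst (λ z → 2 ^ F * z ≤ X t)
              (sym (V-empty x (λ i′ e → empty (i′ , e)))) (subst (_≤ X t) (sym (*-identityʳ _)) 2^F≤))
      ... | yes (i′ , refl) with b′ * X j ≟ b * Y j
      ...   | yes e = subst (_≤ β * R ^ E * X t) (sym (cong (_* 2 ^ F) (m≡n⇒∣m-n∣≡0 e))) z≤n
      ...   | no ne′ with 2 ^ F * X j ≤? X t
      ...     | yes h = scale j h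
      ...     | no h  = contradiction (i′ , j≢t ∘ sym , ne′ , h) none

    -- Passing to a bigger unequal summand strictly increases `X`, which cannot exceed the whole
    -- sum; `fuel` bounds the remaining gap.
    equal-by-ascent : ∀ fuel i → S l X < fuel + X (T i) → b′ * X (T i) ≡ b * Y (T i)
    equal-by-ascent zero       i h = contradiction h (≤⇒≯ (S-term l (T<l i)))
    equal-by-ascent (suc fuel) i h with b′ * X (T i) ≟ b * Y (T i)
    ... | yes e = e
    ... | no ne with any? (Bigger? i)
    ...   | no none = ⊥-elim (no-bigger i none ne)
    ...   | yes (i′ , big@(_ , ne′ , _)) = contradiction (equal-by-ascent fuel i′ (begin-strict
              S l X                <⟨ h ⟩
              suc fuel + X (T i)   ≡⟨ sym (+-suc fuel (X (T i))) ⟩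
              fuel + suc (X (T i)) ≤⟨ +-monoʳ-≤ fuel (Bigger⇒< i i′ big) ⟩
              fuel + X (T i′)      ∎)) ne′

    equal-occupied : ∀ i → b′ * X (T i) ≡ b * Y (T i)
    equal-occupied i = equal-by-ascent (suc (S l X)) i (s≤s (m≤m+n _ _))

    -- Occupied positions contribute equally to both sides, while each empty one contributes `c`
    -- against `c′`.
    sums-not-< : ∀ {c c′} → c < c′ → ∀ {t} → t < l → (∀ i → T i ≢ t) → (U W : ℕ → ℕ) →
      (∀ j → (∀ i → T i ≢ j) → U j ≡ 1) → (∀ j → (∀ i → T i ≢ j) → W j ≡ 1) →
      (∀ i → c * U (T i) ≡ c′ * W (T i)) → S l (λ j → c * U j) ≢ S l (λ j → c′ * W j)
    sums-not-< {c} {c′} c<c′ {t} t<l empty U W U1 W1 eq e = <⇒≢ (S-mono-< l t<l le lt) e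
      where
      at : ∀ {j} → (∀ i → T i ≢ j) → c * U j < c′ * W j
      at {j} em = subst₂ _<_ (sym (trans (cong (c *_) (U1 j em)) (*-identityʳ c)))
        (sym (trans (cong (c′ *_) (W1 j em)) (*-identityʳ c′))) c<c′
      lt = at empty
      le : ∀ j → j < l → c * U j ≤ c′ * W j
      le j _ with any? (λ i → T i ≟ j)
      ... | yes (i , refl) = ≤-reflexive (eq i)
      ... | no em = <⇒≤ (at (λ i e → em (i , e)))

    empty-block⇒≡ : ∀ {t} → t < l → (∀ i → T i ≢ t) → b ≡ b′
    empty-block⇒≡ t<l empty with <-cmp b b′
    ... | tri≈ _ e _ = e
    ... | tri< lt _ _ = contradiction (sym sums)
          (sums-not-< lt t<l empty Y X (λ _ → V-empty y) (λ _ → V-empty x) (λ i → sym (equal-occupied i)))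
    ... | tri> _ _ gt = contradiction sums
          (sums-not-< gt t<l empty X Y (λ _ → V-empty x) (λ _ → V-empty y) equal-occupied)

    two-blocks⇒≡ : 0 < b → 0 < b′ → ∀ i i′ → T i ≢ T i′ → b ≡ b′
    two-blocks⇒≡ 0<b 0<b′ i i′ ne = cross-coprime 0<b 0<b′ (V>0 T x (T i))
      (V-coprime {T} {x} {x} ne) (V-coprime {T} {y} {y} ne) (equal-occupied i) (equal-occupied i′)

-- Both factors infinite: coding pairs of a box point and a multiplier

module Pigeon {s′} (n : Fin (suc s′) → ℕ) (1<n : ∀ i → 1 < n i)
  (cop : ∀ i j → i ≢ j → Coprime (n i) (n j)) where

  open Powers n 1<n cop
  open Blocks n 1<n cop
  open ≤-Reasoning

  private
    s = suc s′
    R = ∏ n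

  -- Changing `y i` alone leaves the summand at `T i′` fixed. Both versions of the summand at `T i`
  -- are within a factor `2 ^ F` of it, hence within `2 ^ (F + F)` of each other. In the first
  -- alternative `y i` itself is below `F`.
  bad-< : ∀ F T y y′ i i′ → (∀ j → y (punchIn i j) ≡ y′ (punchIn i j)) →
    Bad F T y i i′ → Bad F T y′ i i′ → y i < y′ i + (F + F)
  bad-< F T y y′ i i′ e (inj₁ (refl , p)) _ = ≤-trans (^-cancelʳ-< {2} {y i} {F} (s≤s (s≤s z≤n)) (begin-strict
      2 ^ y i         ≤⟨ 2^≤ (y i) (1<n i) ⟩
      n i ^ y i       ≤⟨ ∣⇒≤ {{>-nonZero (V>0 T y (T i))}} (V-∣ {T} {y} (y i) refl ≤-refl) ⟩
      V n T y (T i)   <⟨ p ⟩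
      2 ^ F           ∎)) (≤-trans (m≤m+n F F) (m≤n+m (F + F) (y′ i)))
  bad-< F T y y′ i i′ e (inj₂ (ne , _)) (inj₁ (refl , _)) = contradiction refl ne
  bad-< F T y y′ i i′ e (inj₂ (ne , p , _)) (inj₂ (_ , _ , p′)) = exponent-< n 1<n (F + F) T y y′ i e (begin-strict
      V n T y (T i)                       <⟨ p ⟩
      2 ^ F * V n T y (T i′)              ≡⟨ cong (2 ^ F *_) (V-cong T y y′ (T i′) other) ⟩
      2 ^ F * V n T y′ (T i′)             ≤⟨ *-monoʳ-≤ (2 ^ F) (<⇒≤ p′) ⟩
      2 ^ F * (2 ^ F * V n T y′ (T i))    ≡⟨ sym (*-assoc (2 ^ F) (2 ^ F) _) ⟩
      2 ^ F * 2 ^ F * V n T y′ (T i)      ≡⟨ cong (_* V n T y′ (T i)) (sym (^-distribˡ-+-* 2 F F)) ⟩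
      2 ^ (F + F) * V n T y′ (T i)        ∎)
    where
    other : ∀ j → T j ≡ T i′ → y j ≡ y′ j
    other j Tj with i Finₚ.≟ j
    ... | yes refl = contradiction Tj ne
    ... | no i≢j = subst (λ j → y j ≡ y′ j) (punchIn-punchOut i≢j) (e (punchOut i≢j))

  module Points (k M L N F E C β : ℕ) .{{_ : NonZero E}} .{{_ : NonZero (F + F)}}
    (g : Fin 2 → Fin M → ℕ) (g>0 : ∀ σ t → 0 < g σ t) (g≤β : ∀ σ t → g σ t ≤ β)
    (g-inj : ∀ σ t t′ → g σ t ≡ g σ t′ → t ≡ t′)
    (side : Fin (L ^ s) → Fin 2) (c : Fin (L ^ s) → ℕ) (c-inj : ∀ u u′ → c u ≡ c u′ → u ≡ u′)
    (l : Fin (L ^ s) → Fin M → ℕ) (T y : Fin (L ^ s) → Fin M → Fin s → ℕ)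
    (1<l : ∀ u t → 1 < l u t) (l≤k : ∀ u t → l u t ≤ k)
    (T<l : ∀ u t i → T u t i < l u t) (y<N : ∀ u t i → y u t i < N) (N≤CE : N ≤ C * E)
    (eq : ∀ u t → S (l u t) (V n (T u t) (y u t)) ≡ g (side u) t * c u)
    (0<F : 0 < F) (hF : k * (β * (R ^ E * R ^ E)) < 2 ^ F) where

    Kind : Fin (L ^ s) → Fin M → Set
    Kind u t = (∃₂ λ i i′ → Bad F (T u t) (y u t) i i′) ⊎ Good F (T u t) (y u t)

    kind : ∀ u t → Kind u t
    kind u t with any? (λ i → any? (λ i′ → Bad? F (T u t) (y u t) i i′))
    ... | yes b = inj₁ b
    ... | no h  = inj₂ (λ i i′ b → h (i , i′ , b))

    -- A bad pair keeps `t` and forgets `u`: one exponent is stored only as a residue, yet the whole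
    -- vector is recovered, hence `c u`, hence `u`. A good pair keeps `u` and forgets `t`: only
    -- cells are stored, and equal cells force equal multipliers.
    BadX GoodX : Set
    BadX  = Fin 2 × Fin M × ℕ × (Fin s → ℕ) × Fin s × Fin s × ℕ × (Fin s′ → ℕ)
    GoodX = Fin (L ^ s) × ℕ × (Fin s → ℕ) × (Fin s → ℕ)

    badSize goodSize : ℕ
    badSize  = 2 * (M * (suc k * (k ^ s * (s * (s * ((F + F) * N ^ s′))))))
    goodSize = L ^ s * (suc k * (k ^ s * C ^ s))

    badCode : Code BadX badSize
    badCode = element 2 ⊗ element M ⊗ digit (suc k) ⊗ power (digit k) s ⊗ element s ⊗ element s
      ⊗ digit (F + F) ⊗ power (digit N) s′

    goodCode : Code GoodX goodSize
    goodCode = element (L ^ s) ⊗ digit (suc k) ⊗ power (digit k) s ⊗ power (digit C) s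

    allCode : Code (BadX ⊎ GoodX) (badSize + goodSize)
    allCode = badCode ⊕ goodCode

    code : ∀ u t → Kind u t → BadX ⊎ GoodX
    code u t (inj₁ (i , i′ , _)) = inj₁
      (side u , t , l u t , T u t , i , i′ , y u t i % (F + F) , λ j → y u t (punchIn i j))
    code u t (inj₂ _) = inj₂ (u , l u t , T u t , λ i → y u t i / E)

    T<k : ∀ u t i → T u t i < k
    T<k u t i = ≤-trans (T<l u t i) (l≤k u t)

    code-in : ∀ u t (κ : Kind u t) → Code.In allCode (code u t κ)
    code-in u t (inj₁ (i , i′ , _)) =
      tt , tt , s≤s (l≤k u t) , T<k u t , tt , tt , m%n<n _ (F + F) , λ j → y<N u t (punchIn i j)
    code-in u t (inj₂ _) =
      tt , s≤s (l≤k u t) , T<k u t , λ i → m<n*o⇒m/o<n (≤-trans (y<N u t i) N≤CE)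

    module Bads u t u′ (i i′ : Fin s) (b : Bad F (T u t) (y u t) i i′) (b′ : Bad F (T u′ t) (y u′ t) i i′)
      (l≡ : l u t ≡ l u′ t) (T≡ : ∀ j → T u t j ≡ T u′ t j)
      (r≡ : y u t i % (F + F) ≡ y u′ t i % (F + F))
      (y≡ : ∀ j → y u t (punchIn i j) ≡ y u′ t (punchIn i j)) where

      V≡ : ∀ j → V n (T u′ t) (y u′ t) j ≡ V n (T u t) (y u′ t) j
      V≡ j = V-congT (T u′ t) (T u t) (y u′ t) j (λ i → sym (T≡ i))

      b″ : Bad F (T u t) (y u′ t) i i′
      b″ = transport b′
        where
        transport : Bad F (T u′ t) (y u′ t) i i′ → Bad F (T u t) (y u′ t) i i′
        transport (inj₁ (e , p)) =
          inj₁ (e , subst (_< 2 ^ F) (trans (V≡ _) (cong (V n (T u t) (y u′ t)) (sym (T≡ i)))) p)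
        transport (inj₂ (ne , p , q)) = inj₂
          ( (λ e → ne (trans (sym (T≡ i)) (trans e (T≡ i′))))
          , subst₂ (λ v w → v < 2 ^ F * w) (at i) (at i′) p
          , subst₂ (λ v w → v < 2 ^ F * w) (at i′) (at i) q )
          where
          at : ∀ i → V n (T u′ t) (y u′ t) (T u′ t i) ≡ V n (T u t) (y u′ t) (T u t i)
          at i = trans (V≡ _) (cong (V n (T u t) (y u′ t)) (sym (T≡ i)))

      yi≡ : y u t i ≡ y u′ t i
      yi≡ = %-close (F + F) (bad-< F (T u t) (y u t) (y u′ t) i i′ y≡ b b″)
        (bad-< F (T u t) (y u′ t) (y u t) i i′ (λ j → sym (y≡ j)) b″ b) r≡

      all≡ : ∀ j → y u t j ≡ y u′ t j
      all≡ = punch-agree (y u t) (y u′ t) i yi≡ y≡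

      sums≡ : S (l u t) (V n (T u t) (y u t)) ≡ S (l u′ t) (V n (T u′ t) (y u′ t))
      sums≡ = trans (cong (λ l → S l (V n (T u t) (y u t))) l≡)
        (S-cong (l u′ t) (λ j _ → trans (V-cong (T u t) (y u t) (y u′ t) j (λ i _ → all≡ i)) (sym (V≡ j))))

    bad-collide : ∀ u t u′ i i′ → Bad F (T u t) (y u t) i i′ → Bad F (T u′ t) (y u′ t) i i′ →
      side u ≡ side u′ → l u t ≡ l u′ t → (∀ j → T u t j ≡ T u′ t j) →
      y u t i % (F + F) ≡ y u′ t i % (F + F) → (∀ j → y u t (punchIn i j) ≡ y u′ t (punchIn i j)) → u ≡ u′
    bad-collide u t u′ i i′ b b′ σ≡ l≡ T≡ r≡ y≡ = c-inj u u′
      (*-cancelˡ-≡ (c u) (c u′) (g (side u) t) {{>-nonZero (g>0 (side u) t)}} (begin-equality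
        g (side u) t * c u                        ≡⟨ sym (eq u t) ⟩
        S (l u t) (V n (T u t) (y u t))           ≡⟨ Bads.sums≡ u t u′ i i′ b b′ l≡ T≡ r≡ y≡ ⟩
        S (l u′ t) (V n (T u′ t) (y u′ t))        ≡⟨ eq u′ t ⟩
        g (side u′) t * c u′                      ≡⟨ cong (λ σ → g σ t * c u′) (sym σ≡) ⟩
        g (side u) t * c u′                       ∎))

    good-collide : ∀ u t t′ → Good F (T u t) (y u t) →
      l u t ≡ l u t′ → (∀ j → T u t j ≡ T u t′ j) → (∀ j → y u t j / E ≡ y u t′ j / E) → t ≡ t′
    good-collide u t t′ gd l≡ T≡ y≡ = g-inj (side u) t t′ conclude
      where
      b  = g (side u) t
      b′ = g (side u) t′
      lem : ∀ a b c → a * (b * c) ≡ b * (a * c)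
      lem = solve-∀
      sums : S (l u t) (λ j → b′ * V n (T u t) (y u t) j) ≡ S (l u t) (λ j → b * V n (T u t) (y u t′) j)
      sums = begin-equality
        S (l u t) (λ j → b′ * V n (T u t) (y u t) j)   ≡⟨ S-* (l u t) b′ _ ⟩
        b′ * S (l u t) (V n (T u t) (y u t))           ≡⟨ cong (b′ *_) (eq u t) ⟩
        b′ * (b * c u)                                 ≡⟨ lem b′ b (c u) ⟩
        b * (b′ * c u)                                 ≡⟨ cong (b *_) (sym (eq u t′)) ⟩
        b * S (l u t′) (V n (T u t′) (y u t′))         ≡⟨ cong (b *_) (trans (cong (λ l → S l (V n (T u t′) (y u t′))) (sym l≡))
                                                           (S-cong (l u t) (λ j _ → V-congT (T u t′) (T u t) (y u t′) j (λ i → sym (T≡ i))))) ⟩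
        b * S (l u t) (V n (T u t) (y u t′))           ≡⟨ sym (S-* (l u t) b _) ⟩
        S (l u t) (λ j → b * V n (T u t) (y u t′) j)   ∎
      open EqualBlocks E F k β b b′ (l u t) (T u t) (y u t) (y u t′) (T<l u t) (l≤k u t)
        (g≤β (side u) t) (g≤β (side u) t′) y≡ gd 0<F hF sums
      conclude : b ≡ b′
      -- There are at least two positions. Either position 0 or position 1 is empty, or both carry
      -- summands, which are coprime.
      conclude with any? (λ i → T u t i ≟ 0) | any? (λ i → T u t i ≟ 1)
      ... | no h | _ = empty-block⇒≡ (<⇒≤ (1<l u t)) (λ i e → h (i , e))
      ... | yes _ | no h = empty-block⇒≡ (1<l u t) (λ i e → h (i , e))
      ... | yes (i , e) | yes (i′ , e′) = two-blocks⇒≡ (g>0 (side u) t) (g>0 (side u) t′) i i′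
            (λ e″ → contradiction (trans (sym e) (trans e″ e′)) λ ())

    collide : ∀ u t u′ t′ (κ : Kind u t) (κ′ : Kind u′ t′) →
      Code.Eq allCode (code u t κ) (code u′ t′ κ′) → u ≡ u′ × t ≡ t′
    collide u t u′ .t (inj₁ (i , i′ , b)) (inj₁ (.i , .i′ , b′)) (σ≡ , refl , l≡ , T≡ , refl , refl , r≡ , y≡) =
      bad-collide u t u′ i i′ b b′ σ≡ l≡ T≡ r≡ y≡ , refl
    collide u t .u t′ (inj₂ gd) (inj₂ _) (refl , l≡ , T≡ , y≡) = refl , good-collide u t t′ gd l≡ T≡ y≡

    impossible : badSize + goodSize < L ^ s * M → ⊥
    impossible sizes =
      let i , j , i≢j , e = code-pigeonhole allCode sizes
            (λ i → code (u i) (t i) (kind (u i) (t i))) (λ i → code-in (u i) (t i) (kind (u i) (t i)))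
          u≡ , t≡ = collide (u i) (t i) (u j) (t j) (kind (u i) (t i)) (kind (u j) (t j)) e
      in i≢j (trans (sym (combine-remQuot {L ^ s} M i)) (trans (cong₂ combine u≡ t≡) (combine-remQuot {L ^ s} M j)))
      where
      u : Fin (L ^ s * M) → Fin (L ^ s)
      u i = proj₁ (remQuot {L ^ s} M i)
      t : Fin (L ^ s * M) → Fin M
      t i = proj₂ (remQuot {L ^ s} M i)

-- The larger factor determines the box point

record RepIn {s} (n : Fin s → ℕ) (k m a : ℕ) : Set where
  field
    l    : ℕ
    1≤l  : 1 ≤ l
    l≤k  : l ≤ k
    l≡1  : l ≡ 1 → m ≡ 0
    rep  : Rep n l a
  open Rep rep public

-- `side` records which of the two sets contains the larger factor `c`; `g side` lists elements of
-- the other set.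
record LargeFactor {s} (n : Fin s → ℕ) (k m M : ℕ) (g : Fin 2 → Fin M → ℕ) (z : Fin s → ℕ) : Set where
  field
    side : Fin 2
    c d  : ℕ
    d≤c  : d ≤ c
    dc   : d * c ≡ pw n z + suc m
    mult : ∀ t → RepIn n k m (g side t * c)

-- The order of quantifiers matters: the number `M` of multipliers is given before their bound `β`
-- and the threshold `K`.
NoLargeFactors : ∀ {s} → (Fin s → ℕ) → ℕ → ℕ → ℕ → Set
NoLargeFactors n k m M = ∀ β K (g : Fin 2 → Fin M → ℕ) → (∀ σ t → 0 < g σ t) → (∀ σ t → g σ t ≤ β) →
  (∀ σ t t′ → g σ t ≡ g σ t′ → t ≡ t′) → ¬ (∀ z → K ≤ pw n z → LargeFactor n k m M g z)

-- Subtraction gives `(d′ - d) c = p′ - p`, a multiple of `Q`. Multiplying by `d` and using that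
-- `d c` is congruent to `κ` modulo `Q` yields `Q ∣ κ (d′ - d)`, too small to be a positive multiple
-- of `Q`.
cofactor-not-< : ∀ {Q κ p p′ c d d′} → 0 < κ → Q ∣ p → Q ∣ p′ → κ * d′ < Q →
  d * c ≡ p + κ → d′ * c ≡ p′ + κ → ¬ (d < d′)
cofactor-not-< {Q} {κ} {p} {p′} {c} {d} {d′} 0<κ Q∣p Q∣p′ small e e′ lt = <⇒≱ small (begin
  Q        ≤⟨ ∣⇒≤ {{>-nonZero (*-mono-< {0} {κ} {0} 0<κ (m<n⇒0<n∸m lt))}} Q∣κh ⟩
  κ * h    ≤⟨ *-monoʳ-≤ κ (m∸n≤m d′ d) ⟩
  κ * d′   ∎)
  where
  open ≤-Reasoning
  h = d′ ∸ d
  lem₁ : ∀ a b c → a + b + c ≡ b + (a + c)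
  lem₁ = solve-∀
  lem₂ : ∀ h c d → h * c + d * c ≡ (d + h) * c
  lem₂ = solve-∀
  lem₃ : ∀ h c d → d * (h * c) ≡ h * (d * c)
  lem₃ = solve-∀
  lem₄ : ∀ h p k → h * (p + k) ≡ h * p + k * h
  lem₄ = solve-∀
  hc : p + h * c ≡ p′
  hc = +-cancelʳ-≡ κ _ _ (begin-equality
    p + h * c + κ     ≡⟨ lem₁ p (h * c) κ ⟩
    h * c + (p + κ)   ≡⟨ cong (h * c +_) (sym e) ⟩
    h * c + d * c     ≡⟨ lem₂ h c d ⟩
    (d + h) * c       ≡⟨ cong (_* c) (m+[n∸m]≡n (<⇒≤ lt)) ⟩
    d′ * c            ≡⟨ e′ ⟩
    p′ + κ            ∎)
  Q∣κh : Q ∣ κ * h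
  Q∣κh = ∣m+n∣m⇒∣n (subst (Q ∣_) (begin-equality
      d * (h * c)      ≡⟨ lem₃ h c d ⟩
      h * (d * c)      ≡⟨ cong (h *_) e ⟩
      h * (p + κ)      ≡⟨ lem₄ h p κ ⟩
      h * p + κ * h    ∎)
    (∣n⇒∣m*n d (∣m+n∣m⇒∣n (subst (Q ∣_) (sym hc) Q∣p′) Q∣p))) (∣n⇒∣m*n h Q∣p)

cofactor-unique : ∀ {Q κ p p′ c d d′} → 0 < κ → Q ∣ p → Q ∣ p′ → κ * d < Q → κ * d′ < Q →
  d * c ≡ p + κ → d′ * c ≡ p′ + κ → p ≡ p′
cofactor-unique {c = c} 0<κ Q∣p Q∣p′ small small′ e e′ = +-cancelʳ-≡ _ _ _
  (trans (sym e) (trans (cong (_* c) (≤-antisym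
    (≮⇒≥ (cofactor-not-< 0<κ Q∣p′ Q∣p small e′ e))
    (≮⇒≥ (cofactor-not-< 0<κ Q∣p Q∣p′ small′ e e′)))) e′))

-- The smaller factor is at most the square root of the product, so `(κ d)² ≤ κ² (p + κ)`.
small-cofactor : ∀ {Q κ p c d} → d ≤ c → d * c ≡ p + κ → κ * κ * (p + κ) < Q * Q → κ * d < Q
small-cofactor {Q} {κ} {p} {c} {d} d≤c e h with κ * d <? Q
... | yes lt = lt
... | no nlt = contradiction h (≤⇒≯ (begin
    Q * Q              ≤⟨ *-mono-≤ (≮⇒≥ nlt) (≤-trans (≮⇒≥ nlt) (*-monoʳ-≤ κ d≤c)) ⟩
    κ * d * (κ * c)    ≡⟨ lem κ d c ⟩
    κ * κ * (d * c)    ≡⟨ cong (κ * κ *_) e ⟩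
    κ * κ * (p + κ)    ∎))
  where
  open ≤-Reasoning
  lem : ∀ a d c → a * d * (a * c) ≡ a * a * (d * c)
  lem = solve-∀

-- Both factors infinite: choice of the constants

module Unbounded {s′} (n : Fin (suc s′) → ℕ) (1<n : ∀ i → 1 < n i)
  (cop : ∀ i j → i ≢ j → Coprime (n i) (n j)) (k m : ℕ) where

  open Powers n 1<n cop
  open Blocks n 1<n cop
  open ≤-Reasoning

  private
    s = suc s′
    R = ∏ n
    κ = suc m
    instance
      R≢0 : NonZero R
      R≢0 = >-nonZero R>0

  2≤R : 2 ≤ R
  2≤R = ≤-trans (1<n zero) (n≤R zero)

  R^≤ : ∀ e → R ^ e ≤ 2 ^ (R * e)
  R^≤ e = subst (R ^ e ≤_) (^-*-assoc 2 R e) (^-monoˡ-≤ e (<⇒≤ (n<2^n R)))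

  -- `d c = n^z + 1` makes `c` coprime to every generator, while `c` divides a product of
  -- generators. So `c = 1`, which `d ≤ c` forbids. This rules out multiples with a single summand.
  unit-absurd : ∀ {c d} z y → (∀ i → 1 ≤ z i) → d ≤ c → d * c ≡ pw n z + 1 → c ∣ pw n y → ⊥
  unit-absurd {c} {d} z y 1≤z d≤c e c∣ = <⇒≱ (begin-strict
      1              <⟨ s≤s (pw>0 z) ⟩
      suc (pw n z)   ≡⟨ +-comm 1 (pw n z) ⟩
      pw n z + 1     ≡⟨ sym e ⟩
      d * c          ≤⟨ *-monoˡ-≤ c d≤c ⟩
      c * c          ∎) (≤-reflexive (cong₂ _*_ c≡1 c≡1))
    where
    cp : ∀ i → Coprime c (n i)
    cp i {q} (q∣c , q∣n) = ∣1⇒≡1 (∣m+n∣m⇒∣n (subst (q ∣_) e (∣n⇒∣m*n d q∣c))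
      (∣-trans q∣n (∣-trans (subst (_∣ n i ^ z i) (*-identityʳ (n i)) (^-monoʳ-∣ (n i) (1≤z i))) (∣-∏ (λ i → n i ^ z i) i))))
    c≡1 : c ≡ 1
    c≡1 = coprime-∏ {f = λ i → n i ^ y i} (λ i → coprime-^ʳ (y i) (cp i)) (∣-refl , c∣)

  W c₀ D M : ℕ
  W  = 3 * R + 1
  -- D and M are chosen so that the bad codes and the good codes each fill at most half of the box.
  c₀ = 2 * (suc k * (k ^ s * (s * (s * ((3 * R + 3 * R) * W ^ s′)))))
  D  = suc (2 * c₀)
  M  = suc (2 * (suc k * (k ^ s * (W * D) ^ s)))

  module _ (E β K : ℕ) .{{_ : NonZero E}}
    (hF : k * β < 2 ^ E) (hβ : β * suc κ < 2 ^ E) (hκ : κ * κ * suc κ < 2 ^ E) (hK : K ≤ 2 ^ E)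
    (g : Fin 2 → Fin M → ℕ) (g>0 : ∀ σ t → 0 < g σ t) (g≤β : ∀ σ t → g σ t ≤ β)
    (g-inj : ∀ σ t t′ → g σ t ≡ g σ t′ → t ≡ t′)
    (fac : ∀ z → K ≤ pw n z → LargeFactor n k m M g z) where

    -- Box exponents run through `[2L, 3L)`: thus `Q` divides every product, while the products, at
    -- most `R ^ (3L)`, stay well below `Q² = R ^ (4L)`. `N` bounds the exponents of multiples:
    -- `R ^ (3L) ≤ 2 ^ (3RL)`, and one further `L` absorbs the constants. `F` comes from
    -- `k β R ^ (2E) < 2 ^ (3RE)`.
    L F N Q : ℕ
    L = D * E
    F = 3 * R * E
    N = W * L
    Q = R ^ (2 * L)

    E>0 : 0 < E
    E>0 = >-nonZero⁻¹ E

    E≤L : E ≤ L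
    E≤L = m≤n*m E D

    F>0 : 0 < F
    F>0 = *-mono-< {0} {3 * R} {0} (*-mono-< {0} {3} {0} (s≤s z≤n) R>0) E>0

    z : Fin (L ^ s) → Fin s → ℕ
    z u i = 2 * L + toℕ (finToFun {L} {s} u i)

    z-injective : ∀ u u′ → (∀ i → z u i ≡ z u′ i) → u ≡ u′
    z-injective u u′ e = finToFun-injective {L} {s} u u′
      (λ i → toℕ-injective (+-cancelˡ-≡ (2 * L) _ _ (e i)))

    z≤ : ∀ u i → z u i ≤ 3 * L
    z≤ u i = subst (z u i ≤_) (lem L) (+-monoʳ-≤ (2 * L) (<⇒≤ (toℕ<n _)))
      where
      lem : ∀ L → 2 * L + L ≡ 3 * L
      lem = solve-∀

    1≤z : ∀ u i → 1 ≤ z u i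
    1≤z u i = ≤-trans (≤-trans E>0 E≤L) (≤-trans (m≤n*m L 2) (m≤m+n (2 * L) _))

    Q∣pw : ∀ u → Q ∣ pw n (z u)
    Q∣pw u = pw-∣ {z u} {2 * L} (λ i → m≤m+n (2 * L) _)

    2^E≤R^L : 2 ^ E ≤ R ^ L
    2^E≤R^L = ≤-trans (^-monoˡ-≤ E 2≤R) (^-monoʳ-≤ R E≤L)

    K≤pw : ∀ u → K ≤ pw n (z u)
    K≤pw u = begin
      K              ≤⟨ hK ⟩
      2 ^ E          ≤⟨ 2^E≤R^L ⟩
      R ^ L          ≤⟨ ^-monoʳ-≤ R (m≤n*m L 2) ⟩
      R ^ (2 * L)    ≤⟨ ∣⇒≤ {{>-nonZero (pw>0 (z u))}} (Q∣pw u) ⟩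
      pw n (z u)     ∎

    total≤ : ∀ u → pw n (z u) + κ ≤ suc κ * R ^ (3 * L)
    total≤ u = +-mono-≤ (pw-≤ (z≤ u)) (m≤m*n κ (R ^ (3 * L)) {{m^n≢0 R (3 * L)}})

    total-square : ∀ u → κ * κ * (pw n (z u) + κ) < Q * Q
    total-square u = begin-strict
      κ * κ * (pw n (z u) + κ)        ≤⟨ *-monoʳ-≤ (κ * κ) (total≤ u) ⟩
      κ * κ * (suc κ * R ^ (3 * L))   ≡⟨ sym (*-assoc (κ * κ) (suc κ) (R ^ (3 * L))) ⟩
      κ * κ * suc κ * R ^ (3 * L)     <⟨ *-monoˡ-< (R ^ (3 * L)) {{m^n≢0 R (3 * L)}} hκ ⟩
      2 ^ E * R ^ (3 * L)             ≤⟨ *-monoˡ-≤ (R ^ (3 * L)) 2^E≤R^L ⟩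
      R ^ L * R ^ (3 * L)             ≡⟨ sym (^-distribˡ-+-* R L (3 * L)) ⟩
      R ^ (L + 3 * L)                 ≡⟨ cong (R ^_) (lem L) ⟩
      R ^ (2 * L + 2 * L)             ≡⟨ ^-distribˡ-+-* R (2 * L) (2 * L) ⟩
      Q * Q                           ∎
      where
      lem : ∀ L → L + 3 * L ≡ 2 * L + 2 * L
      lem = solve-∀

    same-factor : ∀ u u′ {c d d′} → d ≤ c → d′ ≤ c →
      d * c ≡ pw n (z u) + κ → d′ * c ≡ pw n (z u′) + κ → u ≡ u′
    same-factor u u′ d≤c d′≤c e e′ = z-injective u u′ (pw-injective (z u) (z u′)
      (cofactor-unique (s≤s z≤n) (Q∣pw u) (Q∣pw u′)
        (small-cofactor d≤c e (total-square u)) (small-cofactor d′≤c e′ (total-square u′)) e e′))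

    exponent-bound : ∀ u {σ t c d l} (T y : Fin s → ℕ) → d * c ≡ pw n (z u) + κ →
      (∀ i → T i < l) → S l (V n T y) ≡ g σ t * c → ∀ i → y i < N
    exponent-bound u {σ} {t} {c} {d} {l} T y e T<l eq i = ^-cancelʳ-< {2} (s≤s (s≤s z≤n)) (begin-strict
      2 ^ y i                     ≤⟨ 2^≤ (y i) (1<n i) ⟩
      n i ^ y i                   ≤⟨ ∣⇒≤ {{>-nonZero (V>0 T y (T i))}} (V-∣ {T} {y} (y i) refl ≤-refl) ⟩
      V n T y (T i)               ≤⟨ S-term l (T<l i) ⟩
      S l (V n T y)               ≡⟨ eq ⟩
      g σ t * c                   ≤⟨ *-mono-≤ (g≤β σ t) (m≤n*m c d {{d≢0 d e}}) ⟩
      β * (d * c)                 ≡⟨ cong (β *_) e ⟩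
      β * (pw n (z u) + κ)        ≤⟨ *-monoʳ-≤ β (total≤ u) ⟩
      β * (suc κ * R ^ (3 * L))   ≡⟨ sym (*-assoc β (suc κ) (R ^ (3 * L))) ⟩
      β * suc κ * R ^ (3 * L)     <⟨ *-monoˡ-< (R ^ (3 * L)) {{m^n≢0 R (3 * L)}} hβ ⟩
      2 ^ E * R ^ (3 * L)         ≤⟨ *-mono-≤ (^-monoʳ-≤ 2 E≤L) (R^≤ (3 * L)) ⟩
      2 ^ L * 2 ^ (R * (3 * L))   ≡⟨ sym (^-distribˡ-+-* 2 L (R * (3 * L))) ⟩
      2 ^ (L + R * (3 * L))       ≡⟨ cong (2 ^_) (lem L R) ⟩
      2 ^ N                       ∎)
      where
      lem : ∀ L R → L + R * (3 * L) ≡ (3 * R + 1) * L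
      lem = solve-∀
      d≢0 : ∀ d → d * c ≡ pw n (z u) + κ → NonZero d
      d≢0 zero e = contradiction (trans e (+-suc (pw n (z u)) m)) λ ()
      d≢0 (suc _) _ = _

    blocks-bound : k * (β * (R ^ E * R ^ E)) < 2 ^ F
    blocks-bound = begin-strict
      k * (β * (R ^ E * R ^ E))                   ≡⟨ sym (*-assoc k β (R ^ E * R ^ E)) ⟩
      k * β * (R ^ E * R ^ E)                     <⟨ *-monoˡ-< (R ^ E * R ^ E) {{m*n≢0 (R ^ E) (R ^ E) {{m^n≢0 R E}} {{m^n≢0 R E}}}} hF ⟩
      2 ^ E * (R ^ E * R ^ E)                     ≤⟨ *-mono-≤ (^-monoʳ-≤ 2 (m≤n*m E R)) (*-mono-≤ (R^≤ E) (R^≤ E)) ⟩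
      2 ^ (R * E) * (2 ^ (R * E) * 2 ^ (R * E))   ≡⟨ cong (2 ^ (R * E) *_) (sym (^-distribˡ-+-* 2 (R * E) (R * E))) ⟩
      2 ^ (R * E) * 2 ^ (R * E + R * E)           ≡⟨ sym (^-distribˡ-+-* 2 (R * E) (R * E + R * E)) ⟩
      2 ^ (R * E + (R * E + R * E))               ≡⟨ cong (2 ^_) (lem R E) ⟩
      2 ^ F                                       ∎
      where
      lem : ∀ R E → R * E + (R * E + R * E) ≡ 3 * R * E
      lem = solve-∀

    badSize goodSize : ℕ
    badSize  = 2 * (M * (suc k * (k ^ s * (s * (s * ((F + F) * N ^ s′))))))
    goodSize = L ^ s * (suc k * (k ^ s * (W * D) ^ s))

    -- A residue modulo `F + F = 6RE`, stored instead of an exponent below `N = WDE`, saves a factor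
    -- of order `D`, and `D > 2 c₀`.
    2bad≤ : 2 * badSize ≤ L ^ s * M
    2bad≤ = begin
      2 * badSize                                  ≡⟨ cong (λ p → 2 * (2 * (M * (suc k * (k ^ s * (s * (s * ((F + F) * p)))))))) (^-distribʳ-* W L s′) ⟩
      2 * (2 * (M * (suc k * (k ^ s * (s * (s * ((F + F) * (W ^ s′ * L ^ s′))))))))
                                                   ≡⟨ lem M (suc k) (k ^ s) s R E (W ^ s′) (L ^ s′) ⟩
      2 * c₀ * E * L ^ s′ * M                      ≤⟨ *-monoˡ-≤ M (*-monoˡ-≤ (L ^ s′) (*-monoˡ-≤ E (n≤1+n (2 * c₀)))) ⟩
      L ^ s * M                                    ∎
      where
      lem : ∀ M a b s R E w l → 2 * (2 * (M * (a * (b * (s * (s * ((3 * R * E + 3 * R * E) * (w * l)))))))) ≡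
        2 * (2 * (a * (b * (s * (s * ((3 * R + 3 * R) * w)))))) * E * l * M
      lem = solve-∀

    -- There are `W D` cells per exponent, independently of `E`, so a box point has fewer than
    -- `M / 2` good codes.
    2good< : 2 * goodSize < L ^ s * M
    2good< = subst (_< L ^ s * M) (lem (L ^ s) (suc k * (k ^ s * (W * D) ^ s)))
      (*-monoʳ-< (L ^ s) {{m^n≢0 L s {{>-nonZero (≤-trans E>0 E≤L)}}}} (n<1+n _))
      where
      lem : ∀ a b → a * (2 * b) ≡ 2 * (a * b)
      lem = solve-∀

    sizes : badSize + goodSize < L ^ s * M
    sizes = *-cancelˡ-< 2 _ _ (begin-strict
      2 * (badSize + goodSize)       ≡⟨ *-distribˡ-+ 2 badSize goodSize ⟩
      2 * badSize + 2 * goodSize     <⟨ +-mono-≤-< 2bad≤ 2good< ⟩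
      L ^ s * M + L ^ s * M          ≡⟨ lem (L ^ s * M) ⟩
      2 * (L ^ s * M)                ∎)
      where
      lem : ∀ a → a + a ≡ 2 * a
      lem = solve-∀

    module Fc u = LargeFactor (fac (z u) (K≤pw u))
    module Mu u t = RepIn (Fc.mult u t)

    l≢1 : ∀ {c d l} u σ t (T y : Fin s → ℕ) → d ≤ c → d * c ≡ pw n (z u) + κ → (l ≡ 1 → m ≡ 0) →
      (∀ i → T i < l) → S l (V n T y) ≡ g σ t * c → l ≢ 1
    l≢1 {c} {d} u σ t T y d≤c e m≡0 T<l eq refl = unit-absurd (z u) y (1≤z u) d≤c
      (trans e (cong (λ m → pw n (z u) + suc m) (m≡0 refl)))
      (subst (c ∣_) (trans (sym eq) (V-full y (λ i → n<1⇒n≡0 (T<l i)))) (n∣m*n (g σ t)))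

    contradictory : ⊥
    contradictory = Pigeon.Points.impossible n 1<n cop k M L N F E (W * D) β
      {{it}} {{>-nonZero (≤-trans F>0 (m≤m+n F F))}} g g>0 g≤β g-inj Fc.side Fc.c
      (λ u u′ e → same-factor u u′ (Fc.d≤c u) (subst (Fc.d u′ ≤_) (sym e) (Fc.d≤c u′)) (Fc.dc u)
        (subst (λ c → Fc.d u′ * c ≡ pw n (z u′) + κ) (sym e) (Fc.dc u′)))
      Mu.l Mu.T Mu.y
      (λ u t → ≤∧≢⇒< (Mu.1≤l u t) (λ e → l≢1 u (Fc.side u) t (Mu.T u t) (Mu.y u t) (Fc.d≤c u) (Fc.dc u)
        (Mu.l≡1 u t) (Mu.T<l u t) (Mu.eq u t) (sym e)))
      Mu.l≤k Mu.T<l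
      (λ u t → exponent-bound u {Fc.side u} {t} {Fc.c u} {Fc.d u} (Mu.T u t) (Mu.y u t) (Fc.dc u) (Mu.T<l u t) (Mu.eq u t))
      (≤-reflexive (sym (*-assoc W D E))) Mu.eq F>0 blocks-bound sizes
      where
      it : NonZero E
      it = >-nonZero E>0

  no-large-factors : NoLargeFactors n k m M
  no-large-factors β K g g>0 g≤β g-inj fac =
    contradictory E β K
      (below (≤-trans (m≤m+n (k * β) _) (≤-trans (m≤m+n _ (κ * κ * suc κ)) (m≤m+n _ K))))
      (below (≤-trans (m≤n+m (β * suc κ) (k * β)) (≤-trans (m≤m+n _ (κ * κ * suc κ)) (m≤m+n _ K))))
      (below (≤-trans (m≤n+m (κ * κ * suc κ) _) (m≤m+n _ K)))
      (<⇒≤ (below (m≤n+m K _))) g g>0 g≤β g-inj fac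
    where
    -- Every quantity required to be below `2 ^ E` is one of these summands.
    E = suc (k * β + β * suc κ + κ * κ * suc κ + K)
    below : ∀ {a} → a ≤ k * β + β * suc κ + κ * κ * suc κ + K → a < 2 ^ E
    below {a} p = ≤-trans (s≤s p) (<⇒≤ (n<2^n E))

-- Separating a dominant power from the remaining terms

mod-cancel-≤ : ∀ {m A A′ p q} → m ∣ A → m ∣ A′ → A + p ≡ A′ + q → q < m → q ≤ p
mod-cancel-≤ {m} {A} {A′} {p} {q} m∣A m∣A′ e q<m with q ≤? p
... | yes h = h
... | no h = contradiction (∣⇒≤ {{>-nonZero (m<n⇒0<n∸m (≰⇒> h))}} m∣) (<⇒≱ (≤-trans (s≤s (m∸n≤m q p)) q<m))
  where
  open ≤-Reasoning
  m∣ : m ∣ q ∸ p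
  m∣ = ∣m+n∣m⇒∣n (subst (m ∣_) (+-cancelʳ-≡ p A (A′ + (q ∸ p)) (begin-equality
      A + p                ≡⟨ e ⟩
      A′ + q               ≡⟨ cong (A′ +_) (sym (m∸n+n≡m (<⇒≤ (≰⇒> h)))) ⟩
      A′ + (q ∸ p + p)     ≡⟨ sym (+-assoc A′ (q ∸ p) p) ⟩
      A′ + (q ∸ p) + p     ∎)) m∣A) m∣A′

mod-cancel : ∀ {m A A′ p q} → m ∣ A → m ∣ A′ → A + p ≡ A′ + q → p < m → q < m → p ≡ q
mod-cancel m∣A m∣A′ e p<m q<m =
  ≤-antisym (mod-cancel-≤ m∣A′ m∣A (sym e) p<m) (mod-cancel-≤ m∣A m∣A′ e q<m)

-- The smaller of the two powers divides both products, so distinct products are at least that far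
-- apart.
dist-powers : ∀ n .{{_ : NonZero n}} b b′ x y → b′ * n ^ x ≢ b * n ^ y →
  n ^ x ≤ ∣ b′ * n ^ x - b * n ^ y ∣ ⊎ n ^ y ≤ ∣ b′ * n ^ x - b * n ^ y ∣
dist-powers n b b′ x y ne with ≤-total x y
... | inj₁ x≤y = inj₁ (subst₂ (λ p q → n ^ x ≤ ∣ p - q ∣) (*-comm (n ^ x) b′) q≡
        (dist-multiple (n ^ x) b′ (b * n ^ (y ∸ x)) (λ e → ne (trans (*-comm b′ (n ^ x)) (trans e q≡)))))
  where
  open ≤-Reasoning
  lem : ∀ a b c → a * (b * c) ≡ b * (a * c)
  lem = solve-∀
  q≡ : n ^ x * (b * n ^ (y ∸ x)) ≡ b * n ^ y
  q≡ = trans (lem (n ^ x) b _) (cong (b *_) (trans (sym (^-distribˡ-+-* n x (y ∸ x))) (cong (n ^_) (m+[n∸m]≡n x≤y))))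
... | inj₂ y≤x = inj₂ (subst₂ (λ p q → n ^ y ≤ ∣ p - q ∣) p≡ (*-comm (n ^ y) b)
        (dist-multiple (n ^ y) (b′ * n ^ (x ∸ y)) b (λ e → ne (trans (sym p≡) (trans e (*-comm (n ^ y) b))))))
  where
  lem : ∀ a b c → a * (b * c) ≡ b * (a * c)
  lem = solve-∀
  p≡ : n ^ y * (b′ * n ^ (x ∸ y)) ≡ b′ * n ^ x
  p≡ = trans (lem (n ^ y) b′ _) (cong (b′ *_) (trans (sym (^-distribˡ-+-* n y (x ∸ y))) (cong (n ^_) (m+[n∸m]≡n y≤x))))

module Dominant {β k b b′ X Y U V p q : ℕ} (0<b : 0 < b) (0<b′ : 0 < b′) (b≤β : b ≤ β) (b′≤β : b′ ≤ β)
  (p≤k : p ≤ k) (q≤k : q ≤ k)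
  (GU≤X : 12 * (β * β) * U ≤ X) (GV≤Y : 12 * (β * β) * V ≤ Y) (Gk<X : 12 * (β * β) * k < X)
  (e : b′ * (X + U + p) ≡ b * (Y + V + q)) where

  open ≤-Reasoning

  private
    G = 12 * (β * β)
    instance
      β≢0 : NonZero β
      β≢0 = >-nonZero (≤-trans 0<b b≤β)
    ≤G : ∀ a → a ≤ G * a
    ≤G a = m≤n*m a G {{m*n≢0 12 (β * β) {{_}} {{m*n≢0 β β}}}}

  U≤X : U ≤ X
  U≤X = ≤-trans (≤G U) GU≤X

  V≤Y : V ≤ Y
  V≤Y = ≤-trans (≤G V) GV≤Y

  k≤X : k ≤ X
  k≤X = ≤-trans (≤G k) (<⇒≤ Gk<X)

  X≤ : X ≤ β * (Y + Y + k)
  X≤ = begin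
    X                   ≤⟨ m≤n*m X b′ {{>-nonZero 0<b′}} ⟩
    b′ * X              ≤⟨ *-monoʳ-≤ b′ (≤-trans (m≤m+n X U) (m≤m+n (X + U) p)) ⟩
    b′ * (X + U + p)    ≡⟨ e ⟩
    b * (Y + V + q)     ≤⟨ *-mono-≤ b≤β (+-mono-≤ (+-monoʳ-≤ Y V≤Y) q≤k) ⟩
    β * (Y + Y + k)     ∎

  -- `Gk<X` concerns `X` only. Were `Y` below `k`, then `X ≤ β (Y + Y + k) ≤ 3 β k ≤ G k`.
  k≤Y : k ≤ Y
  k≤Y with k ≤? Y
  ... | yes h = h
  ... | no h = contradiction Gk<X (≤⇒≯ (begin
      X                    ≤⟨ X≤ ⟩
      β * (Y + Y + k)      ≤⟨ *-monoʳ-≤ β (+-monoˡ-≤ k (+-mono-≤ Y≤k Y≤k)) ⟩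
      β * (k + k + k)      ≡⟨ lem β k ⟩
      1 * (3 * β * k)      ≤⟨ *-monoˡ-≤ (3 * β * k) (≤-trans 0<b b≤β) ⟩
      β * (3 * β * k)      ≤⟨ *-monoˡ-≤ (3 * β * k) (m≤n*m β 4) ⟩
      4 * β * (3 * β * k)  ≡⟨ lem₂ β k ⟩
      G * k                ∎))
    where
    Y≤k = <⇒≤ (≰⇒> h)
    lem : ∀ β k → β * (k + k + k) ≡ 1 * (3 * β * k)
    lem = solve-∀
    lem₂ : ∀ β k → 4 * β * (3 * β * k) ≡ 12 * (β * β) * k
    lem₂ = solve-∀

  X≤3βY : X ≤ 3 * β * Y
  X≤3βY = ≤-trans X≤ (≤-trans (*-monoʳ-≤ β (+-monoʳ-≤ (Y + Y) k≤Y)) (≤-reflexive (lem β Y)))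
    where
    lem : ∀ β Y → β * (Y + Y + Y) ≡ 3 * β * Y
    lem = solve-∀

  Y≤3βX : Y ≤ 3 * β * X
  Y≤3βX = begin
    Y                   ≤⟨ m≤n*m Y b {{>-nonZero 0<b}} ⟩
    b * Y               ≤⟨ *-monoʳ-≤ b (≤-trans (m≤m+n Y V) (m≤m+n (Y + V) q)) ⟩
    b * (Y + V + q)     ≡⟨ sym e ⟩
    b′ * (X + U + p)    ≤⟨ *-mono-≤ b′≤β (+-mono-≤ (+-monoʳ-≤ X U≤X) (≤-trans p≤k k≤X)) ⟩
    β * (X + X + X)     ≡⟨ lem β X ⟩
    3 * β * X           ∎
    where
    lem : ∀ β X → β * (X + X + X) ≡ 3 * β * X
    lem = solve-∀

  private
    lem₁ : ∀ β Z → 3 * β * (4 * (β * Z)) ≡ 12 * (β * β) * Z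
    lem₁ = solve-∀
    lem₃ : ∀ X → X + X ≤ 4 * X
    lem₃ X = ≤-trans (m≤m+n (X + X) (X + X)) (≤-reflexive (lem X))
      where
      lem : ∀ X → X + X + (X + X) ≡ 4 * X
      lem = solve-∀

  -- The constant is `12 β² = 3 β · 4 β`: the factor `3 β` pays for passing between `X` and `Y`, and
  -- `4 β` leaves room for a tail and a constant, each multiplied by at most `β`.
  spread : ∀ Z {A A′} → A ≤ 3 * β * A′ → G * Z ≤ A → 4 * (β * Z) ≤ A′
  spread Z {A} {A′} A≤ GZ≤ = *-cancelˡ-≤ (3 * β) {{m*n≢0 3 β}} (begin
    3 * β * (4 * (β * Z))   ≡⟨ lem₁ β Z ⟩
    G * Z                   ≤⟨ GZ≤ ⟩
    A                       ≤⟨ A≤ ⟩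
    3 * β * A′              ∎)

  self : ∀ A → A ≤ 3 * β * A
  self A = m≤n*m A (3 * β) {{m*n≢0 3 β}}

  small : ∀ {a Z r A} → a ≤ β → r ≤ k → 4 * (β * Z) ≤ A → 4 * (β * k) < A → a * (Z + r) < A
  small {a} {Z} {r} {A} a≤β r≤k h h′ = *-cancelˡ-< 4 _ _ (begin-strict
    4 * (a * (Z + r))           ≤⟨ *-monoʳ-≤ 4 (*-mono-≤ a≤β (+-monoʳ-≤ Z r≤k)) ⟩
    4 * (β * (Z + k))           ≡⟨ lem β Z k ⟩
    4 * (β * Z) + 4 * (β * k)   <⟨ +-mono-≤-< h h′ ⟩
    A + A                       ≤⟨ lem₃ A ⟩
    4 * A                       ∎)
    where
    lem : ∀ β Z k → 4 * (β * (Z + k)) ≡ 4 * (β * Z) + 4 * (β * k)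
    lem = solve-∀

  4βk<X : 4 * (β * k) < X
  4βk<X = ≤-<-trans (spread k {G * k} {G * k} (self (G * k)) ≤-refl) Gk<X

  4βk<Y : 4 * (β * k) < Y
  4βk<Y = *-cancelˡ-< (3 * β) _ _ (begin-strict
    3 * β * (4 * (β * k))   ≡⟨ lem₁ β k ⟩
    G * k                   <⟨ Gk<X ⟩
    X                       ≤⟨ X≤3βY ⟩
    3 * β * Y               ∎)

  split : b′ * (U + p) + b′ * X ≡ b * (V + q) + b * Y
  split = trans (lem b′ X U p) (trans e (sym (lem b Y V q)))
    where
    lem : ∀ b X U p → b * (U + p) + b * X ≡ b * (X + U + p)
    lem = solve-∀

  -- The heads differ by as much as the tails do, and each tail is below both `X` and `Y`.
  dist< : ∀ {A} → A ≡ X ⊎ A ≡ Y → ∣ b′ * X - b * Y ∣ < A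
  dist< {A} which = subst (_< A) (sym (∣-∣-transfer {b′ * (U + p)} {b′ * X} {b * (V + q)} {b * Y} split))
    (≤-<-trans (∣m-n∣≤m⊔n (b * (V + q)) (b′ * (U + p))) (⊔-lub-< (v< which) (u< which)))
    where
    ⊔-lub-< : ∀ {a b c} → a < c → b < c → a ⊔ b < c
    ⊔-lub-< p q = ⊔-lub p q
    v< : A ≡ X ⊎ A ≡ Y → b * (V + q) < A
    v< (inj₁ refl) = small b≤β q≤k (spread V Y≤3βX GV≤Y) 4βk<X
    v< (inj₂ refl) = small b≤β q≤k (spread V (self Y) GV≤Y) 4βk<Y
    u< : A ≡ X ⊎ A ≡ Y → b′ * (U + p) < A
    u< (inj₁ refl) = small b′≤β p≤k (spread U (self X) GU≤X) 4βk<X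
    u< (inj₂ refl) = small b′≤β p≤k (spread U X≤3βY GU≤X) 4βk<Y

  tails : b′ * X ≡ b * Y → b′ * U + b′ * p ≡ b * V + b * q
  tails h = trans (sym (*-distribˡ-+ b′ U p)) (trans (+-cancelʳ-≡ (b′ * X) _ _
    (trans split (cong (b * (V + q) +_) (sym h)))) (*-distribˡ-+ b V q))

-- Recovering one exponent modulo a power of another generator

module Pins {s″} (n : Fin (suc (suc s″)) → ℕ) (1<n : ∀ i → 1 < n i)
  (cop : ∀ i j → i ≢ j → Coprime (n i) (n j)) where

  open Powers n 1<n cop
  open ≤-Reasoning

  private
    s′ s : ℕ
    s′ = suc s″
    s = suc s′

  one : Fin s
  one = suc zero

  -- Modulo n i ^ θ the two equations differ only in the power of n p, which the bucket then determines.
  pin : ∀ {l b b′ θ δ X U U′ m} .{{_ : NonZero δ}} T y y′ i p → T i ≢ T p → T i < l → T p < l →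
    (∀ j → j ≢ i → j ≢ p → y j ≡ y′ j) → θ ≤ y i → θ ≤ y′ i → n i ^ θ ∣ U → n i ^ θ ∣ U′ →
    0 < b → b * n p ^ δ ≤ n i ^ θ →
    b′ * (X + U + m) ≡ b * S l (V n T y) → b′ * (X + U′ + m) ≡ b * S l (V n T y′) →
    y p / δ ≡ y′ p / δ → y p ≡ y′ p
  pin {l} {b} {b′} {θ} {δ} {X} {U} {U′} {m} T y y′ i p ne Ti<l Tp<l agree θ≤ θ≤′ d∣U d∣U′ 0<b bd e e′ q =
    same-bucket {W = C} {A = b′ * U + b * V n T y′ (T i)} {A′ = b′ * U′ + b * V n T y (T i)} δ
      cpC (coprime-^ʳ′ (cop i p (λ { refl → ne refl }))) 0<b (1<n p) bd
      (∣m∣n⇒∣m+n (∣n⇒∣m*n b′ d∣U) (∣n⇒∣m*n b (V-∣ {T} {y′} θ refl θ≤′)))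
      (∣m∣n⇒∣m+n (∣n⇒∣m*n b′ d∣U′) (∣n⇒∣m*n b (V-∣ {T} {y} θ refl θ≤)))
      (+-cancelˡ-≡ (b′ * (X + m)) _ _ main) q
    where
    C = V (n ∘ punchIn p) (T ∘ punchIn p) (y ∘ punchIn p) (T p)
    C′ = V (n ∘ punchIn p) (T ∘ punchIn p) (y′ ∘ punchIn p) (T p)
    C′≡C : C′ ≡ C
    C′≡C = ∏-cong go
      where
      go : ∀ j → sel (T (punchIn p j)) (T p) (n (punchIn p j) ^ y′ (punchIn p j)) ≡
        sel (T (punchIn p j)) (T p) (n (punchIn p j) ^ y (punchIn p j))
      go j with T (punchIn p j) ≟ T p
      ... | yes t = cong (n (punchIn p j) ^_) (sym (agree (punchIn p j)
              (λ e → ne (trans (cong T (sym e)) t)) (Finₚ.punchInᵢ≢i p j)))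
      ... | no _ = refl
    Vp : V n T y (T p) ≡ n p ^ y p * C
    Vp = V-remove n T y p
    Vp′ : V n T y′ (T p) ≡ n p ^ y′ p * C
    Vp′ = trans (V-remove n T y′ p) (cong (n p ^ y′ p *_) C′≡C)
    cpC : Coprime (n i ^ θ) C
    cpC (a , c) = V-coprime-n {T} {y} θ ne (a , ∣-trans c (subst (C ∣_) (sym Vp) (n∣m*n (n p ^ y p))))
    coprime-^ʳ′ : ∀ {a} → Coprime (n i) a → Coprime (n i ^ θ) a
    coprime-^ʳ′ c = Coprimality.sym (coprime-^ʳ θ (Coprimality.sym c))
    off : S l (V n T y) + (V n T y′ (T i) + V n T y′ (T p)) ≡ S l (V n T y′) + (V n T y (T i) + V n T y (T p))
    off = S-off₂ l Ti<l Tp<l ne (λ j _ j≢i j≢p → V-cong T y y′ j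
      (λ i′ t → agree i′ (λ e → j≢i (trans (sym t) (cong T e))) (λ e → j≢p (trans (sym t) (cong T e)))))
    lem₁ : ∀ b′ X m U b v w → b′ * (X + m) + (b′ * U + b * v + b * w) ≡ b′ * (X + U + m) + b * (v + w)
    lem₁ = solve-∀
    main : b′ * (X + m) + (b′ * U + b * V n T y′ (T i) + b * (n p ^ y′ p * C)) ≡
           b′ * (X + m) + (b′ * U′ + b * V n T y (T i) + b * (n p ^ y p * C))
    main = begin-equality
      b′ * (X + m) + (b′ * U + b * V n T y′ (T i) + b * (n p ^ y′ p * C))   ≡⟨ lem₁ b′ X m U b (V n T y′ (T i)) _ ⟩
      b′ * (X + U + m) + b * (V n T y′ (T i) + n p ^ y′ p * C)              ≡⟨ cong₂ (λ a w → a + b * (V n T y′ (T i) + w)) e (sym Vp′) ⟩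
      b * S l (V n T y) + b * (V n T y′ (T i) + V n T y′ (T p))             ≡⟨ sym (*-distribˡ-+ b _ _) ⟩
      b * (S l (V n T y) + (V n T y′ (T i) + V n T y′ (T p)))               ≡⟨ cong (b *_) off ⟩
      b * (S l (V n T y′) + (V n T y (T i) + V n T y (T p)))                ≡⟨ *-distribˡ-+ b _ _ ⟩
      b * S l (V n T y′) + b * (V n T y (T i) + V n T y (T p))              ≡⟨ cong₂ (λ a w → a + b * (V n T y (T i) + w)) (sym e′) Vp ⟩
      b′ * (X + U′ + m) + b * (V n T y (T i) + n p ^ y p * C)               ≡⟨ sym (lem₁ b′ X m U′ b (V n T y (T i)) _) ⟩
      b′ * (X + m) + (b′ * U′ + b * V n T y (T i) + b * (n p ^ y p * C))    ∎

  -- With all generators in one summand, that summand vanishes modulo `n one ^ θ` and the rest of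
  -- the right side is constant, so only the power of `n zero` on the left varies.
  pin-single : ∀ {l b b′ θ δ x x′ U m t} .{{_ : NonZero δ}} T y y′ → (∀ i → T i ≡ t) → t < l →
    θ ≤ y one → θ ≤ y′ one → 0 < b′ → b′ * n zero ^ δ ≤ n one ^ θ →
    b′ * (n zero ^ x + U + m) ≡ b * S l (V n T y) → b′ * (n zero ^ x′ + U + m) ≡ b * S l (V n T y′) →
    x / δ ≡ x′ / δ → x ≡ x′
  pin-single {l} {b} {b′} {θ} {δ} {x} {x′} {U} {m} {t} T y y′ Tt t<l θ≤ θ≤′ 0<b′ bd e e′ q =
    same-bucket {W = 1} {A = b * V n T y t} {A′ = b * V n T y′ t} δ
      (coprime-1ʳ _) (Coprimality.sym (coprime-^ʳ θ (cop zero one λ ()))) 0<b′ (1<n zero) bd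
      (∣n⇒∣m*n b (V-∣ {T} {y} θ (Tt one) θ≤)) (∣n⇒∣m*n b (V-∣ {T} {y′} θ (Tt one) θ≤′))
      (+-cancelˡ-≡ (b′ * (U + m)) _ _ main) q
    where
    off : S l (V n T y) + V n T y′ t ≡ S l (V n T y′) + V n T y t
    off = S-off₁ l t<l (λ j _ j≢t → V-cong T y y′ j (λ i Ti≡j → contradiction (trans (sym Ti≡j) (Tt i)) j≢t))
    lem : ∀ b′ X U m b v → b′ * (U + m) + (b * v + b′ * (X * 1)) ≡ b′ * (X + U + m) + b * v
    lem = solve-∀
    main : b′ * (U + m) + (b * V n T y t + b′ * (n zero ^ x′ * 1)) ≡
           b′ * (U + m) + (b * V n T y′ t + b′ * (n zero ^ x * 1))
    main = begin-equality
      b′ * (U + m) + (b * V n T y t + b′ * (n zero ^ x′ * 1))    ≡⟨ lem b′ (n zero ^ x′) U m b _ ⟩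
      b′ * (n zero ^ x′ + U + m) + b * V n T y t                 ≡⟨ cong (_+ b * V n T y t) e′ ⟩
      b * S l (V n T y′) + b * V n T y t                         ≡⟨ sym (*-distribˡ-+ b _ _) ⟩
      b * (S l (V n T y′) + V n T y t)                           ≡⟨ cong (b *_) (sym off) ⟩
      b * (S l (V n T y) + V n T y′ t)                           ≡⟨ *-distribˡ-+ b _ _ ⟩
      b * S l (V n T y) + b * V n T y′ t                         ≡⟨ cong (_+ b * V n T y′ t) (sym e) ⟩
      b′ * (n zero ^ x + U + m) + b * V n T y′ t                 ≡⟨ sym (lem b′ (n zero ^ x) U m b _) ⟩
      b′ * (U + m) + (b * V n T y′ t + b′ * (n zero ^ x * 1))    ∎

  two-block-sum : ∀ {l} T y → (∀ i → T (suc i) ≡ T one) → T one ≢ T zero → T one < l → T zero < l →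
    S l (V n T y) ≡ n zero ^ y zero + V n T y (T one) + (l ∸ 2)
  two-block-sum {l} T y T1 ne T1<l T0<l = +-cancelʳ-≡ 2 _ _ (begin-equality
    S l (V n T y) + (1 + 1)                            ≡⟨ S-off₂ l T1<l T0<l ne (λ j _ j≢1 j≢0 → V-empty y (empty j j≢1 j≢0)) ⟩
    S l (λ _ → 1) + (V n T y (T one) + V n T y (T zero)) ≡⟨ cong₂ (λ a v → a + (V n T y (T one) + v)) (S-1 l) V0 ⟩
    l + (V n T y (T one) + n zero ^ y zero)            ≡⟨ cong (_+ (V n T y (T one) + n zero ^ y zero)) (sym (m∸n+n≡m 2≤l)) ⟩
    l ∸ 2 + 2 + (V n T y (T one) + n zero ^ y zero)    ≡⟨ lem (l ∸ 2) (V n T y (T one)) (n zero ^ y zero) ⟩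
    n zero ^ y zero + V n T y (T one) + (l ∸ 2) + 2    ∎)
    where
    lem : ∀ a b c → a + 2 + (b + c) ≡ c + b + a + 2
    lem = solve-∀
    empty : ∀ j → j ≢ T one → j ≢ T zero → ∀ i → T i ≢ j
    empty j j≢1 j≢0 zero e = j≢0 (sym e)
    empty j j≢1 j≢0 (suc i) e = j≢1 (trans (sym e) (T1 i))
    V0 : V n T y (T zero) ≡ n zero ^ y zero
    V0 = trans (cong₂ _*_ (sel-≡ {T zero} (n zero ^ y zero) refl)
      (∏-1 (λ i → sel-≢ (n (suc i) ^ y (suc i)) (λ e → ne (trans (sym (T1 i)) e))))) (*-identityʳ _)
    distinct : ∀ {a b} → a ≢ b → a < l → b < l → 2 ≤ l
    distinct {zero}  {zero}  a≢b _ _ = contradiction refl a≢b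
    distinct {zero}  {suc _} _ _ p = ≤-trans (s≤s (s≤s z≤n)) p
    distinct {suc _} {_}     _ p _ = ≤-trans (s≤s (s≤s z≤n)) p
    2≤l : 2 ≤ l
    2≤l = distinct ne T1<l T0<l

punch-agree₂ : ∀ {s} {X : Set} (f g : Fin (suc (suc s)) → X) i p →
  (∀ j → f (punchIn i (punchIn p j)) ≡ g (punchIn i (punchIn p j))) →
  ∀ j → j ≢ i → j ≢ punchIn i p → f j ≡ g j
punch-agree₂ f g i p h j j≢i j≢p = subst (λ j → f j ≡ g j) back (h (punchOut p≢))
  where
  i≢j : i ≢ j
  i≢j e = j≢i (sym e)
  p≢ : p ≢ punchOut i≢j
  p≢ e = j≢p (sym (trans (cong (punchIn i) e) (punchIn-punchOut i≢j)))
  back : punchIn i (punchIn p (punchOut p≢)) ≡ j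
  back = trans (cong (punchIn i) (punchIn-punchOut p≢)) (punchIn-punchOut i≢j)

-- Bounded factor, several generators: kinds of representations and their codes

module Pigeon₂ {s″} (n : Fin (suc (suc s″)) → ℕ) (1<n : ∀ i → 1 < n i)
  (cop : ∀ i j → i ≢ j → Coprime (n i) (n j)) where

  open Powers n 1<n cop
  open Pins n 1<n cop
  open ≤-Reasoning

  private
    s′ s : ℕ
    s′ = suc s″
    s = suc s′
    module Rest = Powers (n ∘ suc) (λ i → 1<n (suc i)) (λ i j i≢j → cop (suc i) (suc j) (i≢j ∘ Finₚ.suc-injective))

  -- `n zero ^ x + U ≤ 2 n zero ^ x ≤ n zero ^ (x + 1)`: the tail cannot bridge the gap to the next
  -- power.
  head-not-< : ∀ {x x′ U U′} → U ≤ n zero ^ x → 0 < U′ → n zero ^ x + U ≡ n zero ^ x′ + U′ → ¬ (x < x′)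
  head-not-< {x} {x′} {U} {U′} U≤ 0<U′ e lt = <⇒≢ (begin-strict
      n zero ^ x + U            ≤⟨ +-monoʳ-≤ (n zero ^ x) U≤ ⟩
      n zero ^ x + n zero ^ x   ≡⟨ lem (n zero ^ x) ⟩
      2 * n zero ^ x            ≤⟨ *-monoˡ-≤ (n zero ^ x) (1<n zero) ⟩
      n zero ^ suc x            ≤⟨ ^-monoʳ-≤ (n zero) lt ⟩
      n zero ^ x′               <⟨ m<m+n (n zero ^ x′) 0<U′ ⟩
      n zero ^ x′ + U′          ∎) e
    where
    lem : ∀ a → a + a ≡ 2 * a
    lem = solve-∀

  module Points (k m β L N θ δ B e′ O : ℕ) .{{_ : NonZero δ}} .{{_ : NonZero e′}}
    (ζ : Fin (L ^ s) → Fin s → ℕ) (ζ<L : ∀ u i → ζ u i < L)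
    (ζ-inj : ∀ u u′ → (∀ i → ζ u i ≡ ζ u′ i) → u ≡ u′)
    (x : Fin (L ^ s) → Fin s → ℕ) (x-zero : ∀ u → x u zero ≡ O + ζ u zero)
    (x-suc : ∀ u i → x u (suc i) ≡ θ + ζ u (suc i)) (x0<N : ∀ u → x u zero < N)
    (b b′ l : Fin (L ^ s) → ℕ) (T y : Fin (L ^ s) → Fin s → ℕ)
    (0<b : ∀ u → 0 < b u) (0<b′ : ∀ u → 0 < b′ u) (b≤β : ∀ u → b u ≤ β) (b′≤β : ∀ u → b′ u ≤ β)
    (b≢b′ : ∀ u → b u ≢ b′ u) (l≤k : ∀ u → l u ≤ k) (m≤k : m ≤ k)
    (T<l : ∀ u i → T u i < l u) (y<N : ∀ u i → y u i < N) (N≤Bδ : N ≤ B * δ)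
    (eq : ∀ u → b′ u * (n zero ^ x u zero + pwTail n (x u) + m) ≡ b u * S (l u) (V n (T u) (y u)))
    (GU≤X : ∀ u → 12 * (β * β) * pwTail n (x u) ≤ n zero ^ x u zero)
    (Gk<X : ∀ u → 12 * (β * β) * k < n zero ^ x u zero)
    (hθ : ∀ i p → β * n p ^ δ ≤ n i ^ θ) (hk : ∀ i → β * k < n i ^ θ)
    (he′ : 3 * (β * (β * (12 * (β * β) + 1 + k))) ≤ e′) where

    G : ℕ
    G = 12 * (β * β)

    X U : Fin (L ^ s) → ℕ
    X u = n zero ^ x u zero
    U u = pwTail n (x u)

    V₁ : Fin (L ^ s) → ℕ
    V₁ u = V n (T u) (y u) (T u one)

    High : Fin (L ^ s) → Set
    High u = ∀ i → θ ≤ y u i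

    -- Each kind has its own way of saving: a small exponent in `low`, two exponents that pin each
    -- other in `split`, `x zero` recovered from its bucket in `single`, and in `double` a summand
    -- `V₁` of the same order as `X`. The one arrangement left, where `n zero ^ y zero` is a summand
    -- of its own dominating `V₁`, would give `b = b′`.
    data Kind (u : Fin (L ^ s)) : Set where
      low    : ∀ i → y u i < θ → Kind u
      split  : High u → ∀ i p → i ≢ zero → punchIn i p ≢ zero → T u i ≢ T u (punchIn i p) → Kind u
      single : High u → (∀ i → T u i ≡ T u zero) → Kind u
      double : High u → (∀ i → T u (suc i) ≡ T u one) → T u one ≢ T u zero →
        n zero ^ y u zero < G * V₁ u → Kind u

    U>0 : ∀ u → 0 < U u
    U>0 u = Rest.pw>0 (x u ∘ suc)

    1≤β : ∀ u → 1 ≤ β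
    1≤β u = ≤-trans (0<b u) (b≤β u)

    U≤X : ∀ u → U u ≤ X u
    U≤X u = ≤-trans (m≤n*m (U u) G {{m*n≢0 12 (β * β) {{_}} {{m*n≢0 β β {{β≢0}} {{β≢0}}}}}}) (GU≤X u)
      where
      β≢0 : NonZero β
      β≢0 = >-nonZero (1≤β u)

    k≤X : ∀ u → k ≤ X u
    k≤X u = ≤-trans (m≤n*m k G {{m*n≢0 12 (β * β) {{_}} {{m*n≢0 β β {{β≢0}} {{β≢0}}}}}}) (<⇒≤ (Gk<X u))
      where
      β≢0 : NonZero β
      β≢0 = >-nonZero (1≤β u)

    div-U : ∀ u i → i ≢ zero → n i ^ θ ∣ U u
    div-U u zero ne = contradiction refl ne
    div-U u (suc i) _ = ∣-trans (^-monoʳ-∣ (n (suc i)) (subst (θ ≤_) (sym (x-suc u i)) (m≤m+n θ _)))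
      (∣-∏ (λ i → n (suc i) ^ x u (suc i)) i)

    -- Domination forces `b′ X = b n zero ^ y zero`. What remains is compared modulo `n one ^ θ`,
    -- which matches the constants and leaves `b′ U = b V₁`. Both pairs of terms are coprime, so
    -- `b = b′`.
    not-separated : ∀ u → High u → (∀ i → T u (suc i) ≡ T u one) → T u one ≢ T u zero →
      ¬ (G * V₁ u ≤ n zero ^ y u zero)
    not-separated u high T1 ne sep = b≢b′ u (cross-coprime (0<b u) (0<b′ u) (n^>0 zero (x u zero))
        (coprime-∏ (λ i → coprime-^ (x u zero) (x u (suc i)) (cop zero (suc i) λ ())))
        (V-coprime-n {T u} {y u} (y u zero) (ne ∘ sym)) heads
        (+-cancelʳ-≡ (b′ u * m) _ _ (trans (tails heads) (cong (b u * V₁ u +_) (sym constants)))))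
      where
      open Dominant {β} {k} {b u} {b′ u} {X u} {n zero ^ y u zero} {U u} {V₁ u} {m} {l u ∸ 2}
        (0<b u) (0<b′ u) (b≤β u) (b′≤β u) m≤k (≤-trans (m∸n≤m (l u) 2) (l≤k u)) (GU≤X u) sep (Gk<X u)
        (trans (eq u) (cong (b u *_) (two-block-sum (T u) (y u) T1 ne (T<l u one) (T<l u zero))))
      heads : b′ u * X u ≡ b u * n zero ^ y u zero
      heads with b′ u * X u ≟ b u * n zero ^ y u zero
      ... | yes h = h
      ... | no h with dist-powers (n zero) (b u) (b′ u) (x u zero) (y u zero) h
      ...   | inj₁ p = contradiction (dist< (inj₁ refl)) (≤⇒≯ p)
      ...   | inj₂ p = contradiction (dist< (inj₂ refl)) (≤⇒≯ p)
      constants : b′ u * m ≡ b u * (l u ∸ 2)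
      constants = mod-cancel (∣n⇒∣m*n (b′ u) (div-U u one λ ())) (∣n⇒∣m*n (b u) (V-∣ {T u} {y u} θ refl (high one)))
        (tails heads)
        (≤-<-trans (*-mono-≤ (b′≤β u) m≤k) (hk one))
        (≤-<-trans (*-mono-≤ (b≤β u) (≤-trans (m∸n≤m (l u) 2) (l≤k u))) (hk one))

    kind : ∀ u → Kind u
    kind u with any? (λ i → y u i <? θ)
    ... | yes (i , p) = low i p
    ... | no h with any? (λ i → any? (λ p → ¬? (T u (suc i) ≟ T u (suc p))))
    ...   | yes (i , p , ne) = split (λ i → ≮⇒≥ (λ q → h (i , q))) (suc i) (punchOut i≢p) (λ ())
              (subst (_≢ zero) (sym back) λ ()) (subst (λ p → T u (suc i) ≢ T u p) (sym back) ne)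
      where
      i≢p : suc i ≢ suc p
      i≢p e = ne (cong (T u) e)
      back : punchIn (suc i) (punchOut i≢p) ≡ suc p
      back = punchIn-punchOut i≢p
    ...   | no same = go
      where
      high : High u
      high i = ≮⇒≥ (λ q → h (i , q))
      T1 : ∀ i → T u (suc i) ≡ T u one
      T1 i with T u (suc i) ≟ T u one
      ... | yes e = e
      ... | no ne = contradiction (i , zero , ne) same
      go : Kind u
      go with T u one ≟ T u zero
      ... | yes e = single high (λ { zero → refl ; (suc i) → trans (T1 i) e })
      ... | no ne with G * V₁ u ≤? n zero ^ y u zero
      ...   | yes sep = contradiction sep (not-separated u high T1 ne)
      ...   | no nsep = double high T1 ne (≰⇒> nsep)

    x-inj : ∀ u u′ → x u zero ≡ x u′ zero → (∀ i → x u (suc i) ≡ x u′ (suc i)) → u ≡ u′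
    x-inj u u′ e₀ e = ζ-inj u u′ λ
      { zero → +-cancelˡ-≡ O _ _ (trans (sym (x-zero u)) (trans e₀ (x-zero u′)))
      ; (suc i) → +-cancelˡ-≡ θ _ _ (trans (sym (x-suc u i)) (trans (e i) (x-suc u′ i))) }

    module Same u u′ (b≡ : b u ≡ b u′) (b′≡ : b′ u ≡ b′ u′) (l≡ : l u ≡ l u′)
      (T≡ : ∀ i → T u i ≡ T u′ i) where

      eq′ : b′ u * (X u′ + U u′ + m) ≡ b u * S (l u) (V n (T u) (y u′))
      eq′ = begin-equality
        b′ u * (X u′ + U u′ + m)              ≡⟨ cong (_* (X u′ + U u′ + m)) b′≡ ⟩
        b′ u′ * (X u′ + U u′ + m)             ≡⟨ eq u′ ⟩
        b u′ * S (l u′) (V n (T u′) (y u′))   ≡⟨ cong₂ (λ b l → b * S l (V n (T u′) (y u′))) (sym b≡) (sym l≡) ⟩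
        b u * S (l u) (V n (T u′) (y u′))     ≡⟨ cong (b u *_) (S-cong (l u) (λ j _ → V-congT (T u′) (T u) (y u′) j (λ i → sym (T≡ i)))) ⟩
        b u * S (l u) (V n (T u) (y u′))      ∎

      -- The right side fixes `X + U`. The size of `X` then fixes `x zero`, and unique exponents in
      -- `U` fix the rest.
      same-y : (∀ i → y u i ≡ y u′ i) → u ≡ u′
      same-y y≡ = x-inj u u′ x₀≡ (Rest.pw-injective (x u ∘ suc) (x u′ ∘ suc)
          (+-cancelˡ-≡ (X u) _ _ (trans sum≡ (cong (λ x → n zero ^ x + U u′) (sym x₀≡)))))
        where
        sum≡ : X u + U u ≡ X u′ + U u′
        sum≡ = +-cancelʳ-≡ m _ _ (*-cancelˡ-≡ _ _ (b′ u) {{>-nonZero (0<b′ u)}} (begin-equality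
          b′ u * (X u + U u + m)             ≡⟨ eq u ⟩
          b u * S (l u) (V n (T u) (y u))    ≡⟨ cong (b u *_) (S-cong (l u) (λ j _ → V-cong (T u) (y u) (y u′) j (λ i _ → y≡ i))) ⟩
          b u * S (l u) (V n (T u) (y u′))   ≡⟨ sym eq′ ⟩
          b′ u * (X u′ + U u′ + m)           ∎))
        x₀≡ : x u zero ≡ x u′ zero
        x₀≡ = ≤-antisym (≮⇒≥ (head-not-< (U≤X u′) (U>0 u) (sym sum≡))) (≮⇒≥ (head-not-< (U≤X u) (U>0 u′) sum≡))

      eq″ : x u zero ≡ x u′ zero → b′ u * (X u + U u′ + m) ≡ b u * S (l u) (V n (T u) (y u′))
      eq″ e = trans (cong (λ x → b′ u * (n zero ^ x + U u′ + m)) e) eq′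

      pinned : ∀ i p → i ≢ zero → T u i ≢ T u p → High u → High u′ → x u zero ≡ x u′ zero →
        (∀ j → j ≢ i → j ≢ p → y u j ≡ y u′ j) → y u p / δ ≡ y u′ p / δ → y u p ≡ y u′ p
      pinned i p i≢0 ne high high′ e agree q =
        pin {l u} {b u} {b′ u} {θ} {δ} {X u} {U u} {U u′} {m} (T u) (y u) (y u′) i p ne (T<l u i) (T<l u p) agree (high i) (high′ i)
          (div-U u i i≢0) (div-U u′ i i≢0) (0<b u) (≤-trans (*-monoˡ-≤ (n p ^ δ) (b≤β u)) (hθ i p))
          (eq u) (eq″ e) q

      -- Whatever the value of `y u i ≥ θ`, its summand vanishes modulo `n i ^ θ`, so the other
      -- exponent is pinned without knowing it, and conversely. Both generators differ from `n zero`
      -- because `U` has to vanish too.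
      split-collide : ∀ i p → i ≢ zero → punchIn i p ≢ zero → T u i ≢ T u (punchIn i p) → High u → High u′ →
        x u zero ≡ x u′ zero → y u i / δ ≡ y u′ i / δ → y u (punchIn i p) / δ ≡ y u′ (punchIn i p) / δ →
        (∀ j → y u (punchIn i (punchIn p j)) ≡ y u′ (punchIn i (punchIn p j))) → u ≡ u′
      split-collide i p i≢0 p≢0 ne high high′ e qi qp rest = same-y all
        where
        agree : ∀ j → j ≢ i → j ≢ punchIn i p → y u j ≡ y u′ j
        agree = punch-agree₂ (y u) (y u′) i p rest
        all : ∀ j → y u j ≡ y u′ j
        all j with j Finₚ.≟ i | j Finₚ.≟ punchIn i p
        ... | yes refl | _ = pinned (punchIn i p) i p≢0 (ne ∘ sym) high high′ e (λ j a b → agree j b a) qi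
        ... | no _ | yes refl = pinned i (punchIn i p) i≢0 ne high high′ e agree qp
        ... | no j≢i | no j≢p = agree j j≢i j≢p

      single-collide : High u → High u′ → (∀ i → T u i ≡ T u zero) → x u zero / δ ≡ x u′ zero / δ →
        (∀ i → x u (suc i) ≡ x u′ (suc i)) → u ≡ u′
      single-collide high high′ T0 q e = x-inj u u′ (pin-single {l u} {b u} {b′ u} {θ} {δ} {x u zero} {x u′ zero} {U u} {m} (T u) (y u) (y u′) T0 (T<l u zero)
        (high one) (high′ one) (0<b′ u) (≤-trans (*-monoˡ-≤ (n zero ^ δ) (b′≤β u)) (hθ one zero)) (eq u)
        (trans (cong (λ w → b′ u * (X u′ + w + m)) (Rest.pw-cong e)) eq′) q) e

    V₁-upper : ∀ u → V₁ u ≤ 3 * (β * X u)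
    V₁-upper u = begin
      V₁ u                                ≤⟨ S-term (l u) (T<l u one) ⟩
      S (l u) (V n (T u) (y u))           ≤⟨ m≤n*m _ (b u) {{>-nonZero (0<b u)}} ⟩
      b u * S (l u) (V n (T u) (y u))     ≡⟨ sym (eq u) ⟩
      b′ u * (X u + U u + m)              ≤⟨ *-mono-≤ (b′≤β u) (+-mono-≤ (+-monoʳ-≤ (X u) (U≤X u)) (≤-trans m≤k (k≤X u))) ⟩
      β * (X u + X u + X u)               ≡⟨ lem β (X u) ⟩
      3 * (β * X u)                       ∎
      where
      lem : ∀ β X → β * (X + X + X) ≡ 3 * (β * X)
      lem = solve-∀

    V₁-lower : ∀ u → (∀ i → T u (suc i) ≡ T u one) → T u one ≢ T u zero → n zero ^ y u zero < G * V₁ u →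
      X u ≤ β * (G + 1 + k) * V₁ u
    V₁-lower u T1 ne lt = begin
      X u                                                      ≤⟨ m≤n*m (X u) (b′ u) {{>-nonZero (0<b′ u)}} ⟩
      b′ u * X u                                               ≤⟨ *-monoʳ-≤ (b′ u) (≤-trans (m≤m+n (X u) (U u)) (m≤m+n _ m)) ⟩
      b′ u * (X u + U u + m)                                   ≡⟨ eq u ⟩
      b u * S (l u) (V n (T u) (y u))                          ≡⟨ cong (b u *_) (two-block-sum (T u) (y u) T1 ne (T<l u one) (T<l u zero)) ⟩
      b u * (n zero ^ y u zero + V₁ u + (l u ∸ 2))             ≤⟨ *-mono-≤ (b≤β u) (+-mono-≤ (+-monoˡ-≤ (V₁ u) (<⇒≤ lt))
                                                                   (≤-trans (≤-trans (m∸n≤m (l u) 2) (l≤k u)) (m≤m*n k (V₁ u) {{>-nonZero (V>0 (T u) (y u) (T u one))}}))) ⟩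
      β * (G * V₁ u + V₁ u + k * V₁ u)                         ≡⟨ lem β G k (V₁ u) ⟩
      β * (G + 1 + k) * V₁ u                                   ∎
      where
      lem : ∀ β G k v → β * (G * v + v + k * v) ≡ β * (G + 1 + k) * v
      lem = solve-∀

    -- Equal `x zero` means equal `X`, and both values of `V₁` are comparable to it; `e′` exceeds
    -- the product of the two comparison constants.
    V₁-close : ∀ u u′ → x u zero ≡ x u′ zero → (∀ i → T u′ (suc i) ≡ T u′ one) → T u′ one ≢ T u′ zero →
      n zero ^ y u′ zero < G * V₁ u′ → V₁ u < 2 ^ e′ * V₁ u′
    V₁-close u u′ e T1 ne lt = begin-strict
      V₁ u                                        ≤⟨ V₁-upper u ⟩
      3 * (β * X u)                               ≡⟨ cong (λ x → 3 * (β * n zero ^ x)) e ⟩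
      3 * (β * X u′)                              ≤⟨ *-monoʳ-≤ 3 (*-monoʳ-≤ β (V₁-lower u′ T1 ne lt)) ⟩
      3 * (β * (β * (G + 1 + k) * V₁ u′))         ≡⟨ lem β (G + 1 + k) (V₁ u′) ⟩
      3 * (β * (β * (G + 1 + k))) * V₁ u′         ≤⟨ *-monoˡ-≤ (V₁ u′) he′ ⟩
      e′ * V₁ u′                                  <⟨ *-monoˡ-< (V₁ u′) {{>-nonZero (V>0 (T u′) (y u′) (T u′ one))}} (n<2^n e′) ⟩
      2 ^ e′ * V₁ u′                              ∎
      where
      lem : ∀ β a v → 3 * (β * (β * a * v)) ≡ 3 * (β * (β * a)) * v
      lem = solve-∀

    module Double u u′ (b≡ : b u ≡ b u′) (b′≡ : b′ u ≡ b′ u′) (l≡ : l u ≡ l u′) (T≡ : ∀ i → T u i ≡ T u′ i)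
      (high : High u) (high′ : High u′)
      (T1 : ∀ i → T u (suc i) ≡ T u one) (ne : T u one ≢ T u zero) (lt : n zero ^ y u zero < G * V₁ u)
      (T1′ : ∀ i → T u′ (suc i) ≡ T u′ one) (ne′ : T u′ one ≢ T u′ zero) (lt′ : n zero ^ y u′ zero < G * V₁ u′)
      (x≡ : x u zero ≡ x u′ zero) (r≡ : y u one % e′ ≡ y u′ one % e′) (q≡ : y u zero / δ ≡ y u′ zero / δ)
      (rest : ∀ j → y u (suc (suc j)) ≡ y u′ (suc (suc j))) where

      open Same u u′ b≡ b′≡ l≡ T≡

      -- This exponent must come before `y u one`: modulo `n one ^ θ` the unknown `y u one` does no
      -- harm, whereas the size estimate for `y u one` needs all other exponents.
      y₀≡ : y u zero ≡ y u′ zero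
      y₀≡ = pinned one zero (λ ()) ne high high′ x≡
        (λ { zero _ z≢z → contradiction refl z≢z ; (suc zero) o≢o _ → contradiction refl o≢o ; (suc (suc j)) _ _ → rest j }) q≡

      others : ∀ j → y u (punchIn one j) ≡ y u′ (punchIn one j)
      others zero    = y₀≡
      others (suc j) = rest j

      V₁≡ : V₁ u′ ≡ V n (T u) (y u′) (T u one)
      V₁≡ = trans (V-congT (T u′) (T u) (y u′) (T u′ one) (λ i → sym (T≡ i))) (cong (V n (T u) (y u′)) (sym (T≡ one)))

      y₁≡ : y u one ≡ y u′ one
      y₁≡ = %-close e′
        (exponent-< n 1<n e′ (T u) (y u) (y u′) one others (subst (λ v → V₁ u < 2 ^ e′ * v) V₁≡ (V₁-close u u′ x≡ T1′ ne′ lt′)))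
        (exponent-< n 1<n e′ (T u) (y u′) (y u) one (λ j → sym (others j)) (subst (_< 2 ^ e′ * V₁ u) V₁≡ (V₁-close u′ u (sym x≡) T1 ne lt)))
        r≡

      collide : u ≡ u′
      collide = same-y (λ { zero → y₀≡ ; (suc zero) → y₁≡ ; (suc (suc j)) → rest j })

    TailX AllX : Set
    TailX = (Fin s × ℕ × (Fin s′ → ℕ)) ⊎ (Fin s × Fin s′ × ℕ × ℕ × ℕ × (Fin s″ → ℕ)) ⊎
      (ℕ × (Fin s′ → ℕ)) ⊎ (ℕ × ℕ × ℕ × (Fin s″ → ℕ))
    AllX = ℕ × ℕ × ℕ × (Fin s → ℕ) × TailX

    tailSize size : ℕ
    tailSize = s * (θ * N ^ s′) + (s * (s′ * (L * (B * (B * N ^ s″)))) +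
      (B * L ^ s′ + L * (e′ * (B * N ^ s″))))
    size = suc β * (suc β * (suc k * (k ^ s * tailSize)))

    tailCode : Code TailX tailSize
    tailCode = (element s ⊗ digit θ ⊗ power (digit N) s′) ⊕
      (element s ⊗ element s′ ⊗ digit L ⊗ digit B ⊗ digit B ⊗ power (digit N) s″) ⊕
      (digit B ⊗ power (digit L) s′) ⊕ (digit L ⊗ digit e′ ⊗ digit B ⊗ power (digit N) s″)

    allCode : Code AllX size
    allCode = digit (suc β) ⊗ digit (suc β) ⊗ digit (suc k) ⊗ power (digit k) s ⊗ tailCode

    tail : ∀ {u} → Kind u → TailX
    tail {u} (low i _) = inj₁ (i , y u i , λ j → y u (punchIn i j))
    tail {u} (split _ i p _ _ _) = inj₂ (inj₁
      (i , p , ζ u zero , y u i / δ , y u (punchIn i p) / δ , λ j → y u (punchIn i (punchIn p j))))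
    tail {u} (single _ _) = inj₂ (inj₂ (inj₁ (x u zero / δ , λ j → ζ u (suc j))))
    tail {u} (double _ _ _ _) = inj₂ (inj₂ (inj₂
      (ζ u zero , y u one % e′ , y u zero / δ , λ j → y u (suc (suc j)))))

    code : ∀ u → Kind u → AllX
    code u κ = b u , b′ u , l u , T u , tail κ

    bucket< : ∀ {a} → a < N → a / δ < B
    bucket< p = m<n*o⇒m/o<n (≤-trans p N≤Bδ)

    code-in : ∀ u (κ : Kind u) → Code.In allCode (code u κ)
    code-in u κ = s≤s (b≤β u) , s≤s (b′≤β u) , s≤s (l≤k u) , (λ i → ≤-trans (T<l u i) (l≤k u)) , go κ
      where
      go : (κ : Kind u) → Code.In tailCode (tail κ)
      go (low i p) = tt , p , λ j → y<N u (punchIn i j)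
      go (split _ i p _ _ _) = tt , tt , ζ<L u zero , bucket< (y<N u i) , bucket< (y<N u (punchIn i p)) ,
        λ j → y<N u (punchIn i (punchIn p j))
      go (single _ _) = bucket< (x0<N u) , λ j → ζ<L u (suc j)
      go (double _ _ _ _) = ζ<L u zero , m%n<n (y u one) e′ , bucket< (y<N u zero) , λ j → y<N u (suc (suc j))

    code-collide : ∀ u u′ (κ : Kind u) (κ′ : Kind u′) → Code.Eq allCode (code u κ) (code u′ κ′) → u ≡ u′
    code-collide u u′ (low i _) (low .i _) (b≡ , b′≡ , l≡ , T≡ , refl , y≡ , rest) =
      Same.same-y u u′ b≡ b′≡ l≡ T≡ (punch-agree (y u) (y u′) i y≡ rest)
    code-collide u u′ (split high i p i≢0 p≢0 ne) (split high′ .i .p _ _ _)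
      (b≡ , b′≡ , l≡ , T≡ , refl , refl , ζ≡ , qi , qp , rest) =
      Same.split-collide u u′ b≡ b′≡ l≡ T≡ i p i≢0 p≢0 ne high high′
        (trans (x-zero u) (trans (cong (O +_) ζ≡) (sym (x-zero u′)))) qi qp rest
    code-collide u u′ (single high T0) (single high′ _) (b≡ , b′≡ , l≡ , T≡ , q , ζ≡) =
      Same.single-collide u u′ b≡ b′≡ l≡ T≡ high high′ T0 q
        (λ i → trans (x-suc u i) (trans (cong (θ +_) (ζ≡ i)) (sym (x-suc u′ i))))
    code-collide u u′ (double high T1 ne lt) (double high′ T1′ ne′ lt′)
      (b≡ , b′≡ , l≡ , T≡ , ζ≡ , r≡ , q≡ , rest) =
      Double.collide u u′ b≡ b′≡ l≡ T≡ high high′ T1 ne lt T1′ ne′ lt′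
        (trans (x-zero u) (trans (cong (O +_) ζ≡) (sym (x-zero u′)))) r≡ q≡ rest

    impossible : size < L ^ s → ⊥
    impossible small =
      let u , u′ , u≢u′ , e = code-pigeonhole allCode small (λ u → code u (kind u)) (λ u → code-in u (kind u))
      in u≢u′ (code-collide u u′ (kind u) (kind u′) e)

-- Bounded factor, several generators: choice of the constants

record SmallFactor (k m β a : ℕ) {s} (n : Fin s → ℕ) : Set where
  field
    b b′ c : ℕ
    0<b    : 0 < b
    0<b′   : 0 < b′
    b≤β    : b ≤ β
    b′≤β   : b′ ≤ β
    b≢b′   : b ≢ b′
    bc     : b * c ≡ a
    mult   : RepIn n k m (b′ * c)
  open RepIn mult public

module Bounded {s″} (n : Fin (suc (suc s″)) → ℕ) (1<n : ∀ i → 1 < n i)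
  (cop : ∀ i j → i ≢ j → Coprime (n i) (n j)) (k m β K : ℕ) (m≤k : m ≤ k)
  (fac : ∀ (x : Fin (suc (suc s″)) → ℕ) → K ≤ n zero ^ x zero →
    SmallFactor k m β (n zero ^ x zero + pwTail n x + m) n) where

  open Powers n 1<n cop
  open ≤-Reasoning

  private
    s′ s : ℕ
    s′ = suc s″
    s = suc s′
    R = ∏ n
    module Rest = Powers (n ∘ suc) (λ i → 1<n (suc i)) (λ i j i≢j → cop (suc i) (suc j) (i≢j ∘ Finₚ.suc-injective))
    instance
      R≢0 : NonZero R
      R≢0 = >-nonZero R>0

  W G e′ c₁ : ℕ
  W  = R * (2 * R + 2) + 1
  G  = 12 * (β * β)
  e′ = suc (3 * (β * (β * (G + 1 + k))))
  -- The number of codes is at most c₁ * τ ^ 2 * L ^ s′, where L = τ ^ 3.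
  c₁ = suc β * (suc β * (suc k * (k ^ s *
    (s * (2 * R * W ^ s′) + (s * (s′ * (W * (W * W ^ s″))) + (W + e′ * (W * W ^ s″)))))))

  R^≤ : ∀ e → R ^ e ≤ 2 ^ (R * e)
  R^≤ e = subst (R ^ e ≤_) (^-*-assoc 2 R e) (^-monoˡ-≤ e (<⇒≤ (n<2^n R)))

  module _ (τ : ℕ) (c₁<τ : c₁ < τ) (2R≤τ : 2 * R ≤ τ) (β≤τ : β ≤ τ) (βk≤τ : β * k ≤ τ) (Gk≤τ : G * k ≤ τ)
    (G≤τ : G ≤ τ) (βm≤τ : β * (2 + m) ≤ τ) (K≤τ : K ≤ τ) where

    instance
      τ≢0 : NonZero τ
      τ≢0 = >-nonZero (≤-trans (s≤s z≤n) c₁<τ)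

    -- Buckets of width `τ²` cut the range `W τ³` into `W τ` pieces. A low exponent, or two bucket
    -- numbers together, then have order `τ²` choices against the `τ³` of one box coordinate, so
    -- every kind saves at least a factor of order `τ`. `θ` is chosen so that `β R ^ δ ≤ 2 ^ θ`, and
    -- `O` so that the power of `n zero` exceeds the product of the others by `2 ^ L`.
    δ L θ N B O : ℕ
    δ = τ * τ
    L = τ * δ
    θ = 2 * R * δ
    N = W * L
    B = W * τ
    O = R * (2 * L) + L

    instance
      δ≢0 : NonZero δ
      δ≢0 = m*n≢0 τ τ
      L≢0 : NonZero L
      L≢0 = m*n≢0 τ δ

    τ≤δ : τ ≤ δ
    τ≤δ = m≤m*n τ τ

    τ≤L : τ ≤ L
    τ≤L = m≤m*n τ δ

    below : ∀ {a} → a ≤ τ → a < 2 ^ L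
    below p = ≤-trans (s≤s (≤-trans p τ≤L)) (n<2^n L)

    ζ x : Fin (L ^ s) → Fin s → ℕ
    ζ u i = toℕ (finToFun {L} {s} u i)
    x u zero    = O + ζ u zero
    x u (suc i) = θ + ζ u (suc i)

    ζ<L : ∀ u i → ζ u i < L
    ζ<L u i = toℕ<n (finToFun {L} {s} u i)

    ζ-inj : ∀ u u′ → (∀ i → ζ u i ≡ ζ u′ i) → u ≡ u′
    ζ-inj u u′ e = finToFun-injective {L} {s} u u′ (λ i → toℕ-injective (e i))

    θ≤L : θ ≤ L
    θ≤L = *-monoˡ-≤ δ 2R≤τ

    X U : Fin (L ^ s) → ℕ
    X u = n zero ^ x u zero
    U u = pwTail n (x u)

    U≤ : ∀ u → U u ≤ 2 ^ (R * (2 * L))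
    U≤ u = begin
      U u                       ≤⟨ Rest.pw-≤ (λ i → x≤ i) ⟩
      ∏ (n ∘ suc) ^ (2 * L)     ≤⟨ ^-monoˡ-≤ (2 * L) (m≤n*m (∏ (n ∘ suc)) (n zero)) ⟩
      R ^ (2 * L)               ≤⟨ R^≤ (2 * L) ⟩
      2 ^ (R * (2 * L))         ∎
      where
      lem : ∀ L → L + L ≡ 2 * L
      lem = solve-∀
      x≤ : ∀ i → x u (suc i) ≤ 2 * L
      x≤ i = subst (x u (suc i) ≤_) (lem L) (+-mono-≤ θ≤L (<⇒≤ (ζ<L u (suc i))))

    2^O≤X : ∀ u → 2 ^ O ≤ X u
    2^O≤X u = ≤-trans (^-monoʳ-≤ 2 (m≤m+n O (ζ u zero))) (2^≤ (x u zero) (1<n zero))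

    2^L≤X : ∀ u → 2 ^ L ≤ X u
    2^L≤X u = ≤-trans (^-monoʳ-≤ 2 (m≤n+m L (R * (2 * L)))) (2^O≤X u)

    GU≤X : ∀ u → G * U u ≤ X u
    GU≤X u = begin
      G * U u                       ≤⟨ *-mono-≤ (<⇒≤ (below G≤τ)) (U≤ u) ⟩
      2 ^ L * 2 ^ (R * (2 * L))     ≡⟨ *-comm (2 ^ L) _ ⟩
      2 ^ (R * (2 * L)) * 2 ^ L     ≡⟨ sym (^-distribˡ-+-* 2 (R * (2 * L)) L) ⟩
      2 ^ O                         ≤⟨ 2^O≤X u ⟩
      X u                           ∎

    U≤X : ∀ u → U u ≤ X u
    U≤X u = ≤-trans (U≤ u) (≤-trans (^-monoʳ-≤ 2 (m≤m+n (R * (2 * L)) L)) (2^O≤X u))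

    x₀≤ : ∀ u → x u zero ≤ (2 * R + 2) * L
    x₀≤ u = subst (x u zero ≤_) (lem R L) (+-monoʳ-≤ O (<⇒≤ (ζ<L u zero)))
      where
      lem : ∀ R L → R * (2 * L) + L + L ≡ (2 * R + 2) * L
      lem = solve-∀

    x₀<N : ∀ u → x u zero < N
    x₀<N u = begin-strict
      x u zero                          ≤⟨ x₀≤ u ⟩
      (2 * R + 2) * L                   ≤⟨ *-monoˡ-≤ L (m≤n*m (2 * R + 2) R) ⟩
      R * (2 * R + 2) * L               <⟨ m<m+n _ (>-nonZero⁻¹ L) ⟩
      R * (2 * R + 2) * L + L           ≡⟨ lem (R * (2 * R + 2)) L ⟩
      N                                 ∎
      where
      lem : ∀ a L → a * L + L ≡ (a + 1) * L
      lem = solve-∀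

    β*total< : ∀ u → β * (X u + U u + m) < 2 ^ N
    β*total< u = begin-strict
      β * (X u + U u + m)                           ≤⟨ *-monoʳ-≤ β (+-mono-≤ (+-monoʳ-≤ (X u) (U≤X u)) (m≤m*n m (X u) {{m^n≢0 (n zero) (x u zero)}})) ⟩
      β * (X u + X u + m * X u)                     ≡⟨ lem₁ β m (X u) ⟩
      β * (2 + m) * X u                             <⟨ *-monoˡ-< (X u) {{m^n≢0 (n zero) (x u zero)}} (below βm≤τ) ⟩
      2 ^ L * X u                                   ≤⟨ *-monoʳ-≤ (2 ^ L) X≤ ⟩
      2 ^ L * 2 ^ (R * ((2 * R + 2) * L))           ≡⟨ sym (^-distribˡ-+-* 2 L (R * ((2 * R + 2) * L))) ⟩
      2 ^ (L + R * ((2 * R + 2) * L))               ≡⟨ cong (2 ^_) (lem₂ R L) ⟩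
      2 ^ N                                         ∎
      where
      lem₁ : ∀ β m X → β * (X + X + m * X) ≡ β * (2 + m) * X
      lem₁ = solve-∀
      lem₂ : ∀ R L → L + R * ((2 * R + 2) * L) ≡ (R * (2 * R + 2) + 1) * L
      lem₂ = solve-∀
      X≤ : X u ≤ 2 ^ (R * ((2 * R + 2) * L))
      X≤ = begin
        n zero ^ x u zero                  ≤⟨ ^-monoˡ-≤ (x u zero) (n≤R zero) ⟩
        R ^ x u zero                       ≤⟨ ^-monoʳ-≤ R (x₀≤ u) ⟩
        R ^ ((2 * R + 2) * L)              ≤⟨ R^≤ ((2 * R + 2) * L) ⟩
        2 ^ (R * ((2 * R + 2) * L))        ∎

    2^τ≤n^θ : ∀ i → 2 ^ τ ≤ n i ^ θ
    2^τ≤n^θ i = ≤-trans (^-monoʳ-≤ 2 (≤-trans τ≤δ (m≤n*m δ (2 * R) {{m*n≢0 2 R}}))) (2^≤ θ (1<n i))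

    hθ : ∀ i p → β * n p ^ δ ≤ n i ^ θ
    hθ i p = begin
      β * n p ^ δ                        ≤⟨ *-mono-≤ β≤ (≤-trans (^-monoˡ-≤ δ (n≤R p)) (R^≤ δ)) ⟩
      2 ^ (R * δ) * 2 ^ (R * δ)          ≡⟨ sym (^-distribˡ-+-* 2 (R * δ) (R * δ)) ⟩
      2 ^ (R * δ + R * δ)                ≡⟨ cong (2 ^_) (lem R δ) ⟩
      2 ^ θ                              ≤⟨ 2^≤ θ (1<n i) ⟩
      n i ^ θ                            ∎
      where
      lem : ∀ R δ → R * δ + R * δ ≡ 2 * R * δ
      lem = solve-∀
      β≤ : β ≤ 2 ^ (R * δ)
      β≤ = ≤-trans β≤τ (≤-trans τ≤δ (≤-trans (m≤n*m δ R) (<⇒≤ (n<2^n (R * δ)))))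

    tailSize : ℕ
    tailSize = s * (θ * N ^ s′) + (s * (s′ * (L * (B * (B * N ^ s″)))) +
      (B * L ^ s′ + L * (e′ * (B * N ^ s″))))

    tail≤ : tailSize ≤ (s * (2 * R * W ^ s′) + (s * (s′ * (W * (W * W ^ s″))) + (W + e′ * (W * W ^ s″)))) * (δ * L ^ s′)
    tail≤ = begin
      tailSize  ≡⟨ cong₂ (λ p q → s * (θ * p) + (s * (s′ * (L * (B * (B * q)))) + (B * L ^ s′ + L * (e′ * (B * q)))))
                     (^-distribʳ-* W L s′) (^-distribʳ-* W L s″) ⟩
      s * (θ * (W ^ s′ * L ^ s′)) + (s * (s′ * (L * (B * (B * (W ^ s″ * L ^ s″))))) + (B * L ^ s′ + L * (e′ * (B * (W ^ s″ * L ^ s″)))))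
                ≡⟨ lem s s′ R τ W e′ L (W ^ s″) (L ^ s″) ⟩
      s * (2 * R * W ^ s′) * (δ * L ^ s′) + (s * (s′ * (W * (W * W ^ s″))) * (δ * L ^ s′) +
        (W * (τ * L ^ s′) + e′ * (W * W ^ s″) * (τ * L ^ s′)))
                ≤⟨ +-monoʳ-≤ (s * (2 * R * W ^ s′) * (δ * L ^ s′)) (+-monoʳ-≤ (s * (s′ * (W * (W * W ^ s″))) * (δ * L ^ s′))
                     (+-mono-≤ (*-monoʳ-≤ W (*-monoˡ-≤ (L ^ s′) τ≤δ)) (*-monoʳ-≤ (e′ * (W * W ^ s″)) (*-monoˡ-≤ (L ^ s′) τ≤δ)))) ⟩
      s * (2 * R * W ^ s′) * (δ * L ^ s′) + (s * (s′ * (W * (W * W ^ s″))) * (δ * L ^ s′) +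
        (W * (δ * L ^ s′) + e′ * (W * W ^ s″) * (δ * L ^ s′)))
                ≡⟨ lem₂ (s * (2 * R * W ^ s′)) (s * (s′ * (W * (W * W ^ s″)))) W (e′ * (W * W ^ s″)) (δ * L ^ s′) ⟩
      _         ∎
      where
      lem : ∀ s s′ R τ W e L w l →
        s * (2 * R * (τ * τ) * (W * w * (L * l))) +
          (s * (s′ * (L * (W * τ * (W * τ * (w * l))))) + (W * τ * (L * l) + L * (e * (W * τ * (w * l))))) ≡
        s * (2 * R * (W * w)) * (τ * τ * (L * l)) + (s * (s′ * (W * (W * w))) * (τ * τ * (L * l)) +
          (W * (τ * (L * l)) + e * (W * w) * (τ * (L * l))))
      lem = solve-∀
      lem₂ : ∀ a b c d z → a * z + (b * z + (c * z + d * z)) ≡ (a + (b + (c + d))) * z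
      lem₂ = solve-∀

    size< : suc β * (suc β * (suc k * (k ^ s * tailSize))) < L ^ s
    size< = begin-strict
      suc β * (suc β * (suc k * (k ^ s * tailSize)))   ≤⟨ *-monoʳ-≤ (suc β) (*-monoʳ-≤ (suc β) (*-monoʳ-≤ (suc k) (*-monoʳ-≤ (k ^ s) tail≤))) ⟩
      _                                                ≡⟨ lem (suc β) (suc k) (k ^ s) _ (δ * L ^ s′) ⟩
      c₁ * (δ * L ^ s′)                                <⟨ *-monoˡ-< (δ * L ^ s′) {{m*n≢0 δ (L ^ s′) {{δ≢0}} {{m^n≢0 L s′}}}} c₁<τ ⟩
      τ * (δ * L ^ s′)                                 ≡⟨ sym (*-assoc τ δ (L ^ s′)) ⟩
      L ^ s                                            ∎
      where
      lem : ∀ a b c d z → a * (a * (b * (c * (d * z)))) ≡ a * (a * (b * (c * d))) * z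
      lem = solve-∀

    module Fc u = SmallFactor (fac (x u) (≤-trans (<⇒≤ (below K≤τ)) (2^L≤X u)))

    eq : ∀ u → Fc.b′ u * (X u + U u + m) ≡ Fc.b u * S (Fc.l u) (V n (Fc.T u) (Fc.y u))
    eq u = begin-equality
      Fc.b′ u * (X u + U u + m)                     ≡⟨ cong (Fc.b′ u *_) (sym (Fc.bc u)) ⟩
      Fc.b′ u * (Fc.b u * Fc.c u)                   ≡⟨ lem (Fc.b′ u) (Fc.b u) (Fc.c u) ⟩
      Fc.b u * (Fc.b′ u * Fc.c u)                   ≡⟨ cong (Fc.b u *_) (sym (Fc.eq u)) ⟩
      Fc.b u * S (Fc.l u) (V n (Fc.T u) (Fc.y u))   ∎
      where
      lem : ∀ a b c → a * (b * c) ≡ b * (a * c)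
      lem = solve-∀

    exponent-bound : ∀ u {b b′ l} (T y : Fin s → ℕ) → 0 < b → b′ ≤ β → (∀ i → T i < l) →
      b′ * (X u + U u + m) ≡ b * S l (V n T y) → ∀ i → y i < N
    exponent-bound u {b} {b′} {l} T y 0<b b′≤β T<l e i = ^-cancelʳ-< {2} (s≤s (s≤s z≤n)) (begin-strict
      2 ^ y i                   ≤⟨ 2^≤ (y i) (1<n i) ⟩
      n i ^ y i                 ≤⟨ ∣⇒≤ {{>-nonZero (V>0 T y (T i))}} (V-∣ {T} {y} (y i) refl ≤-refl) ⟩
      V n T y (T i)             ≤⟨ S-term l (T<l i) ⟩
      S l (V n T y)             ≤⟨ m≤n*m _ b {{>-nonZero 0<b}} ⟩
      b * S l (V n T y)         ≡⟨ sym e ⟩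
      b′ * (X u + U u + m)      ≤⟨ *-monoˡ-≤ (X u + U u + m) b′≤β ⟩
      β * (X u + U u + m)       <⟨ β*total< u ⟩
      2 ^ N                     ∎)

    contradictory : ⊥
    contradictory = Pigeon₂.Points.impossible n 1<n cop k m β L N θ δ B e′ O ζ ζ<L ζ-inj x
      (λ _ → refl) (λ _ _ → refl) x₀<N Fc.b Fc.b′ Fc.l Fc.T Fc.y Fc.0<b Fc.0<b′ Fc.b≤β Fc.b′≤β Fc.b≢b′ Fc.l≤k m≤k Fc.T<l
      (λ u → exponent-bound u {Fc.b u} {Fc.b′ u} (Fc.T u) (Fc.y u) (Fc.0<b u) (Fc.b′≤β u) (Fc.T<l u) (eq u))
      (≤-reflexive (sym (*-assoc W τ δ)))
      eq GU≤X (λ u → ≤-trans (below Gk≤τ) (2^L≤X u)) hθ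
      (λ i → ≤-trans (s≤s βk≤τ) (≤-trans (n<2^n τ) (2^τ≤n^θ i))) (n≤1+n _) size<

  no-small-factors : ⊥
  no-small-factors = contradictory τ (m≤m+n (suc c₁) _)
    (in₁ (m≤m+n (2 * R) _))
    (in₁ (in₂ (2 * R) (m≤m+n β _)))
    (in₁ (in₂ (2 * R) (in₂ β (m≤m+n (β * k) _))))
    (in₁ (in₂ (2 * R) (in₂ β (in₂ (β * k) (m≤m+n (G * k) _)))))
    (in₁ (in₂ (2 * R) (in₂ β (in₂ (β * k) (in₂ (G * k) (m≤m+n G _))))))
    (in₁ (in₂ (2 * R) (in₂ β (in₂ (β * k) (in₂ (G * k) (in₂ G (m≤m+n (β * (2 + m)) _)))))))
    (in₁ (in₂ (2 * R) (in₂ β (in₂ (β * k) (in₂ (G * k) (in₂ G (m≤n+m K _)))))))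
    where
    rest τ : ℕ
    rest = 2 * R + (β + (β * k + (G * k + (G + (β * (2 + m) + K)))))
    τ = suc c₁ + rest
    in₂ : ∀ {a b} c → a ≤ b → a ≤ c + b
    in₂ c p = ≤-trans p (m≤n+m _ c)
    in₁ : ∀ {a} → a ≤ rest → a ≤ τ
    in₁ = in₂ (suc c₁)

-- From factorisations of sets to the counting arguments

AllPairs-lookup : ∀ {Γ} → AllPairs Coprime Γ → ∀ i j → i ≢ j → Coprime (List.lookup Γ i) (List.lookup Γ j)
AllPairs-lookup (p ∷ ps) zero    zero    i≢j = contradiction refl i≢j
AllPairs-lookup (p ∷ ps) zero    (suc j) _   = All.lookup p (∈-lookup j)
AllPairs-lookup (p ∷ ps) (suc i) zero    _   = Coprimality.sym (All.lookup p (∈-lookup i))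
AllPairs-lookup (p ∷ ps) (suc i) (suc j) i≢j = AllPairs-lookup ps i j (i≢j ∘ cong suc)

Enumerates : SetN → ℕ → Set
Enumerates B M = Σ (Fin M → ℕ) λ f → (∀ t → B (f t)) × (∀ t t′ → f t ≡ f t′ → t ≡ t′) × Σ ℕ λ β → ∀ t → f t ≤ β

BoundedSet : SetN → Set
BoundedSet B = Σ ℕ λ β → ∀ b → B b → b ≤ β

excluded-middle : ∀ {P : Set} → ¬ ¬ (P ⊎ ¬ P)
excluded-middle h = h (inj₂ (λ p → h (inj₁ p)))

-- `B` is an arbitrary predicate, so the dichotomy is available only under double negation, which
-- suffices for refuting reducibility. Each new element exceeds a bound of the earlier ones and so
-- is distinct from them.
enumerates-or-bounded : ∀ B M → ¬ ¬ (Enumerates B M ⊎ BoundedSet B)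
enumerates-or-bounded B zero    h = h (inj₁ ((λ ()) , (λ ()) , (λ ()) , 0 , λ ()))
enumerates-or-bounded B (suc M) h = enumerates-or-bounded B M λ
  { (inj₂ bd) → h (inj₂ bd)
  ; (inj₁ (f , f∈ , inj , β , f≤)) → excluded-middle {Σ ℕ λ b → B b × β < b} λ
    { (inj₂ none) → h (inj₂ (β , λ b Bb → ≮⇒≥ (λ β<b → none (b , Bb , β<b))))
    ; (inj₁ (b , Bb , β<b)) → h (inj₁ (extend f b , extend-∈ f f∈ Bb , extend-inj f inj f≤ β<b , b , extend-≤ f f≤ β<b)) } }
  where
  extend : (Fin M → ℕ) → ℕ → Fin (suc M) → ℕ
  extend f b zero    = b
  extend f b (suc t) = f t
  extend-∈ : ∀ f {b} → (∀ t → B (f t)) → B b → ∀ t → B (extend f b t)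
  extend-∈ f f∈ Bb zero    = Bb
  extend-∈ f f∈ Bb (suc t) = f∈ t
  extend-≤ : ∀ f {b β} → (∀ t → f t ≤ β) → β < b → ∀ t → extend f b t ≤ b
  extend-≤ f f≤ β<b zero    = ≤-refl
  extend-≤ f f≤ β<b (suc t) = ≤-trans (f≤ t) (<⇒≤ β<b)
  extend-inj : ∀ f {b β} → (∀ t t′ → f t ≡ f t′ → t ≡ t′) → (∀ t → f t ≤ β) → β < b →
    ∀ t t′ → extend f b t ≡ extend f b t′ → t ≡ t′
  extend-inj f inj f≤ β<b zero    zero     e = refl
  extend-inj f inj f≤ β<b zero    (suc t′) e = contradiction e (>⇒≢ (≤-<-trans (f≤ t′) β<b))
  extend-inj f inj f≤ β<b (suc t) zero     e = contradiction e (<⇒≢ (≤-<-trans (f≤ t) β<b))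
  extend-inj f inj f≤ β<b (suc t) (suc t′) e = cong suc (inj t t′ e)

-- Both sets of the theorem have this form, with Λ = {k} and Λ = {1, ..., k}.
Hof : List ℕ → (ℕ → Set) → SetN
Hof Γ Λ a = Σ ℕ λ l → Λ l × H Γ l a

module Factors (K : ℕ) (A B C : SetN) (B>0 : Positive B) (C>0 : Positive C)
  (factor : ∀ a → K ≤ a → A a → (B · C) a) (member : ∀ b c → B b → C c → K ≤ b * c → A (b * c)) where

  open ≤-Reasoning

  large-left : ∀ {c} t → K ≤ c → 1 ≤ t → K ≤ t * c
  large-left {c} t K≤c 1≤t = ≤-trans K≤c (m≤n*m c t {{>-nonZero 1≤t}})

  -- A cofactor of at least `K` keeps all its products with elements of `B` in the range where
  -- membership in `A` is known.
  K≤cofactor : ∀ {a b c β} → b ≤ β → β * K + K < a → a ≡ b * c → K ≤ c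
  K≤cofactor {a} {b} {c} {β} b≤β h e with K ≤? c
  ... | yes p = p
  ... | no p = contradiction (begin-strict
      a              ≡⟨ e ⟩
      b * c          ≤⟨ *-mono-≤ b≤β (<⇒≤ (≰⇒> p)) ⟩
      β * K          ≤⟨ m≤m+n (β * K) K ⟩
      β * K + K      <⟨ h ⟩
      a              ∎) (<-irrefl refl)

  cofactor : ∀ {β a} → (∀ b → B b → b ≤ β) → β * K + K < a → A a →
    Σ ℕ λ b → Σ ℕ λ c → B b × a ≡ b * c × (∀ b′ → B b′ → A (b′ * c))
  cofactor {β} {a} B≤ h Aa with factor a (≤-trans (m≤n+m K (β * K)) (<⇒≤ h)) Aa
  ... | b , c , Bb , Cc , e = b , c , Bb , e , λ b′ Bb′ →
    member b′ c Bb′ Cc (large-left b′ (K≤cofactor (B≤ b Bb) h e) (B>0 b′ Bb′))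

  module _ {s′} (n : Fin (suc s′) → ℕ) (k m : ℕ) (rep : ∀ {a} → A a → RepIn n k m a) where

    not-both-enumerated : ∀ {M} → NoLargeFactors n k m M → (∀ z → A (pw n z + 1 + m)) →
      Enumerates B M → Enumerates C M → ⊥
    not-both-enumerated {M} no-large-factors inA (f , f∈ , f-inj , β , f≤) (f′ , f′∈ , f′-inj , β′ , f′≤) =
      no-large-factors (β + β′) (K * K + K) g g>0 g≤ g-inj fac
      where
      g : Fin 2 → Fin M → ℕ
      g zero       = f
      g (suc zero) = f′
      g>0 : ∀ σ t → 0 < g σ t
      g>0 zero       t = B>0 _ (f∈ t)
      g>0 (suc zero) t = C>0 _ (f′∈ t)
      g≤ : ∀ σ t → g σ t ≤ β + β′
      g≤ zero       t = ≤-trans (f≤ t) (m≤m+n β β′)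
      g≤ (suc zero) t = ≤-trans (f′≤ t) (m≤n+m β′ β)
      g-inj : ∀ σ t t′ → g σ t ≡ g σ t′ → t ≡ t′
      g-inj zero       = f-inj
      g-inj (suc zero) = f′-inj
      K≤max : ∀ z {b c} → K * K + K ≤ pw n z → b ≤ c → b * c ≡ pw n z + suc m → K ≤ c
      K≤max z {b} {c} K≤ b≤c e with K ≤? c
      ... | yes p = p
      ... | no p = contradiction (begin-strict
          b * c              ≤⟨ *-monoˡ-≤ c b≤c ⟩
          c * c              ≤⟨ *-mono-≤ (<⇒≤ (≰⇒> p)) (<⇒≤ (≰⇒> p)) ⟩
          K * K              ≤⟨ m≤m+n (K * K) K ⟩
          K * K + K          ≤⟨ K≤ ⟩
          pw n z             <⟨ m<m+n (pw n z) (s≤s z≤n) ⟩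
          pw n z + suc m     ≡⟨ sym e ⟩
          b * c              ∎) (<-irrefl refl)
      fac : ∀ z → K * K + K ≤ pw n z → LargeFactor n k m M g z
      fac z K≤ with factor (pw n z + 1 + m) (≤-trans (m≤n+m K (K * K)) (≤-trans K≤ (≤-trans (m≤m+n (pw n z) 1) (m≤m+n _ m)))) (inA z)
      ... | b , c , Bb , Cc , e with ≤-total b c
      ...   | inj₁ b≤c = record { side = zero ; c = c ; d = b ; d≤c = b≤c ; dc = dc
                ; mult = λ t → rep (member (f t) c (f∈ t) Cc (large-left (f t) (K≤max z K≤ b≤c dc) (g>0 zero t))) }
        where
        dc : b * c ≡ pw n z + suc m
        dc = trans (sym e) (+-assoc (pw n z) 1 m)
      ...   | inj₂ c≤b = record { side = suc zero ; c = b ; d = c ; d≤c = c≤b ; dc = dc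
                ; mult = λ t → rep (subst A (*-comm b (f′ t)) (member b (f′ t) Bb (f′∈ t)
                    (subst (K ≤_) (*-comm (f′ t) b) (large-left (f′ t) (K≤max z K≤ c≤b dc) (g>0 (suc zero) t))))) }
        where
        dc : c * b ≡ pw n z + suc m
        dc = trans (*-comm c b) (trans (sym e) (+-assoc (pw n z) 1 m))

  not-bounded : ∀ {s″} (n : Fin (suc (suc s″)) → ℕ) (1<n : ∀ i → 1 < n i)
    (cop : ∀ i j → i ≢ j → Coprime (n i) (n j)) k m → m ≤ k → (∀ {a} → A a → RepIn n k m a) →
    (∀ x → A (n zero ^ x zero + pwTail n x + m)) → AtLeastTwo B → ¬ BoundedSet B
  not-bounded n 1<n cop k m m≤k rep inA (b₁ , b₂ , b₁≢b₂ , Bb₁ , Bb₂) (β , B≤) =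
    Bounded.no-small-factors n 1<n cop k m β (suc (β * K + K)) m≤k fac
    where
    fac : ∀ x → suc (β * K + K) ≤ n zero ^ x zero →
      SmallFactor k m β (n zero ^ x zero + pwTail n x + m) n
    fac x K≤ with cofactor B≤ (≤-trans K≤ (≤-trans (m≤m+n (n zero ^ x zero) (pwTail n x)) (m≤m+n _ m))) (inA x)
    -- Of the two distinct elements of `B`, at least one differs from `b`; it serves as `b′`.
    ... | b , c , Bb , e , mult with b ≟ b₁
    ...   | yes refl = record { 0<b = B>0 b Bb ; 0<b′ = B>0 b₂ Bb₂ ; b≤β = B≤ b Bb ; b′≤β = B≤ b₂ Bb₂
              ; b≢b′ = b₁≢b₂ ; bc = sym e ; mult = rep (mult b₂ Bb₂) }
    ...   | no ne = record { 0<b = B>0 b Bb ; 0<b′ = B>0 b₁ Bb₁ ; b≤β = B≤ b Bb ; b′≤β = B≤ b₁ Bb₁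
              ; b≢b′ = ne ; bc = sym e ; mult = rep (mult b₁ Bb₁) }

-- One generator: divisibility relations

-- Comparing modulo a high power of n separates the power of n from the constant.
module SingleGenerator (n : Fin 1 → ℕ) (1<g : 1 < n zero) where

  open ≤-Reasoning
  private
    g = n zero
    instance
      g≢0 : NonZero g
      g≢0 = >-nonZero (<⇒≤ 1<g)

  rep-value : ∀ {l a} → (r : Rep {1} n l a) → a ≡ g ^ Rep.y r zero + (l ∸ 1)
  rep-value {suc l} {a} r = +-cancelʳ-≡ 1 _ _ (begin-equality
      a + 1                            ≡⟨ cong (_+ 1) (sym eq) ⟩
      S (suc l) (V n T y) + 1  ≡⟨ S-off₁ (suc l) (T<l zero) off ⟩
      S (suc l) (λ _ → 1) + V n T y (T zero) ≡⟨ cong₂ _+_ (S-1 (suc l)) (trans (*-identityʳ _) (sel-≡ {T zero} (g ^ y zero) refl)) ⟩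
      suc l + g ^ y zero               ≡⟨ lem l (g ^ y zero) ⟩
      g ^ y zero + l + 1               ∎)
    where
    open Rep r
    lem : ∀ l a → suc l + a ≡ a + l + 1
    lem = solve-∀
    off : ∀ j → j < suc l → j ≢ T zero → V n T y j ≡ 1
    off j _ j≢ = trans (*-identityʳ _) (sel-≢ (g ^ y zero) (j≢ ∘ sym))
  rep-value {zero} r with () ← Rep.T<l r zero

  -- `big` keeps `y` from falling below `θ = β k`. Modulo `g ^ θ` only the constants survive, and
  -- both are at most `β k < g ^ (β k)`.
  separate : ∀ {β k b b′ κ κ′ x y} → 0 < b′ → b ≤ β → b′ ≤ β → κ ≤ k → κ′ ≤ k →
    β * k ≤ x → β * (g ^ (β * k) + k) < g ^ x → b′ * (g ^ x + κ) ≡ b * (g ^ y + κ′) →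
    b′ * κ ≡ b * κ′ × b′ * g ^ x ≡ b * g ^ y
  separate {β} {k} {b} {b′} {κ} {κ′} {x} {y} 0<b′ b≤β b′≤β κ≤k κ′≤k θ≤x big e = constants ,
      +-cancelʳ-≡ (b′ * κ) _ _ (trans e′ (cong (b * g ^ y +_) (sym constants)))
    where
    θ = β * k
    e′ : b′ * g ^ x + b′ * κ ≡ b * g ^ y + b * κ′
    e′ = trans (sym (*-distribˡ-+ b′ (g ^ x) κ)) (trans e (*-distribˡ-+ b (g ^ y) κ′))
    θ≤y : θ ≤ y
    θ≤y with θ ≤? y
    ... | yes p = p
    ... | no p = contradiction big (≤⇒≯ (begin
        g ^ x                    ≤⟨ m≤n*m (g ^ x) b′ {{>-nonZero 0<b′}} ⟩
        b′ * g ^ x               ≤⟨ *-monoʳ-≤ b′ (m≤m+n (g ^ x) κ) ⟩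
        b′ * (g ^ x + κ)         ≡⟨ e ⟩
        b * (g ^ y + κ′)         ≤⟨ *-mono-≤ b≤β (+-mono-≤ (^-monoʳ-≤ g (<⇒≤ (≰⇒> p))) κ′≤k) ⟩
        β * (g ^ θ + k)          ∎))
    θ< : θ < g ^ θ
    θ< = ≤-trans (n<2^n θ) (2^≤ θ 1<g)
    constants : b′ * κ ≡ b * κ′
    constants = mod-cancel (∣n⇒∣m*n b′ (^-monoʳ-∣ g θ≤x)) (∣n⇒∣m*n b (^-monoʳ-∣ g θ≤y)) e′
      (≤-<-trans (*-mono-≤ b′≤β κ≤k) θ<) (≤-<-trans (*-mono-≤ b≤β κ′≤k) θ<)

-- Here `k = 3 + i`, and `b₀`, `b₀ q`, `b₀ e` are the elements of `B` arising for the constants `1`,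
-- `k - 1`, `k - 2`. From `q ∣ k - 1`, `e ∣ k - 2` and `q (k - 2) = e t` with `t ≤ k - 1` follow
-- `q = k - 1` and `e = k - 2`. Their ratio is a positive power of `g`, so it must be `2 / 1`.
single-generator-multiples : ∀ {i b₀ q e t r r′ g x y} → 0 < b₀ → 1 < g → q ≢ 1 → e ≤ q → q ≤ 2 + i → t ≤ 2 + i →
  b₀ * (2 + i) ≡ b₀ * q * r → b₀ * (1 + i) ≡ b₀ * e * r′ →
  b₀ * q * (1 + i) ≡ b₀ * e * t → b₀ * q * g ^ x ≡ b₀ * e * g ^ y → g ≡ 2 × i ≡ 0
single-generator-multiples {i} {b₀} {q} {e} {t} {r} {r′} {g} {x} {y} 0<b₀ 1<g q≢1 e≤q q≤ t≤ α β γ powers =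
  g≡2 , i≡0
  where
  open ≤-Reasoning
  instance
    _ = >-nonZero 0<b₀
    _ = >-nonZero (<⇒≤ 1<g)
  cancel : ∀ {a b c d} → b₀ * a * c ≡ b₀ * b * d → a * c ≡ b * d
  cancel {a} {b} {c} {d} h = *-cancelˡ-≡ _ _ b₀ (trans (sym (*-assoc b₀ a c)) (trans h (*-assoc b₀ b d)))
  α′ : 2 + i ≡ q * r
  α′ = *-cancelˡ-≡ _ _ b₀ (trans α (*-assoc b₀ q r))
  β′ : 1 + i ≡ e * r′
  β′ = *-cancelˡ-≡ _ _ b₀ (trans β (*-assoc b₀ e r′))
  e<q : e < q
  -- Equality would make `q` a common divisor of the consecutive numbers `1 + i` and `2 + i`.
  e<q = ≤∧≢⇒< e≤q λ { refl → q≢1 (∣1⇒≡1 (∣m+n∣m⇒∣n {e} {1 + i} {1}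
    (subst (e ∣_) (trans (sym α′) (+-comm 1 (1 + i))) (m∣m*n r)) (subst (e ∣_) (sym β′) (m∣m*n r′)))) }
  1+i≤e : 1 + i ≤ e
  1+i≤e = +-cancelˡ-≤ (e * (1 + i)) _ _ (begin
    e * (1 + i) + (1 + i)   ≡⟨ +-comm (e * (1 + i)) (1 + i) ⟩
    suc e * (1 + i)         ≤⟨ *-monoˡ-≤ (1 + i) e<q ⟩
    q * (1 + i)             ≡⟨ cancel {q} {e} γ ⟩
    e * t                   ≤⟨ *-monoʳ-≤ e t≤ ⟩
    e * (2 + i)             ≡⟨ lem e i ⟩
    e * (1 + i) + e         ∎)
    where
    lem : ∀ e i → e * (2 + i) ≡ e * (1 + i) + e
    lem = solve-∀
  e≤1+i : e ≤ 1 + i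
  e≤1+i = ∣⇒≤ (subst (e ∣_) (sym β′) (m∣m*n r′))
  e≡ : e ≡ 1 + i
  e≡ = ≤-antisym e≤1+i 1+i≤e
  q≡ : q ≡ 2 + i
  q≡ = ≤-antisym q≤ (≤-trans (s≤s 1+i≤e) e<q)
  powers′ : (2 + i) * g ^ x ≡ (1 + i) * g ^ y
  powers′ = subst₂ (λ q e → q * g ^ x ≡ e * g ^ y) q≡ e≡ (cancel {q} {e} powers)
  x<y : x < y
  x<y with x <? y
  ... | yes p = p
  ... | no p = contradiction powers′ (>⇒≢ (begin-strict
      (1 + i) * g ^ y   ≤⟨ *-monoʳ-≤ (1 + i) (^-monoʳ-≤ g (≮⇒≥ p)) ⟩
      (1 + i) * g ^ x   <⟨ *-monoˡ-< (g ^ x) {{m^n≢0 g x}} (n<1+n (1 + i)) ⟩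
      (2 + i) * g ^ x   ∎))
  small : (1 + i) * g ≤ 2 + i
  small = *-cancelʳ-≤ _ _ (g ^ x) {{m^n≢0 g x}} (begin
    (1 + i) * g * g ^ x     ≡⟨ *-assoc (1 + i) g (g ^ x) ⟩
    (1 + i) * g ^ suc x     ≤⟨ *-monoʳ-≤ (1 + i) (^-monoʳ-≤ g x<y) ⟩
    (1 + i) * g ^ y         ≡⟨ sym powers′ ⟩
    (2 + i) * g ^ x         ∎)
  i≡0 : i ≡ 0
  i≡0 = n≤0⇒n≡0 (+-cancelˡ-≤ (2 + i) i 0 (begin
    2 + i + i       ≡⟨ lem i ⟩
    (1 + i) * 2     ≤⟨ *-monoʳ-≤ (1 + i) 1<g ⟩
    (1 + i) * g     ≤⟨ small ⟩
    2 + i           ≡⟨ sym (+-identityʳ (2 + i)) ⟩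
    2 + i + 0       ∎))
    where
    lem : ∀ i → 2 + i + i ≡ (1 + i) * 2
    lem = solve-∀
  g≡2 : g ≡ 2
  g≡2 = ≤-antisym (subst (_≤ 2) (*-identityˡ g) (subst (λ i → (1 + i) * g ≤ 2 + i) i≡0 small)) 1<g

-- Reduction to the refutation of bounded factors

module Main (g : ℕ) (Γ′ : List ℕ) (1<Γ : All (1 <_) (g ∷ Γ′)) (coprime : AllPairs Coprime (g ∷ Γ′)) (k : ℕ)
  (Λ : ℕ → Set) (Λ-range : ∀ {l} → Λ l → 1 ≤ l × l ≤ k) (m : ℕ) (Λm : Λ (2 + m)) (Λ1 : Λ 1 → m ≡ 0) where

  Γ : List ℕ
  Γ = g ∷ Γ′

  n : Fin (length Γ) → ℕ
  n = List.lookup Γ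

  1<n : ∀ i → 1 < n i
  1<n i = All.lookup 1<Γ (∈-lookup i)

  cop : ∀ i j → i ≢ j → Coprime (n i) (n j)
  cop = AllPairs-lookup coprime

  open Powers n 1<n cop

  A : SetN
  A = Hof Γ Λ

  rep : ∀ {a} → A a → RepIn n k m a
  rep (l , Λl , h) = record
    { l = l ; 1≤l = proj₁ (Λ-range Λl) ; l≤k = proj₂ (Λ-range Λl)
    ; l≡1 = λ { refl → Λ1 Λl } ; rep = H⇒Rep Γ 1<n cop h }

  in-A : ∀ z → A (pw n z + 1 + m)
  in-A z = 2 + m , Λm , two-term Γ 1<n cop m (SG-∏ Γ 1<n cop (λ i → SG-^ Γ 1<n cop i (z i))) sg-one (coprime-1ʳ _)

  infinite : Infinite A
  infinite a = _ , ≤-trans (<⇒≤ (≤-trans (n<2^n a) (≤-trans (2^≤ a (1<n zero))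
    (∣⇒≤ {{>-nonZero (pw>0 (λ _ → a))}} (∣-∏ (λ i → n i ^ a) zero))))) (≤-trans (m≤m+n _ 1) (m≤m+n _ m)) , in-A (λ _ → a)

  -- Quantified over the factors because it is applied to `B` and, with the roles exchanged, to `C`.
  -- It is a hypothesis because its proof depends on the number of generators.
  NotBounded : Set₁
  NotBounded = ∀ K B C → Positive B → Positive C → AtLeastTwo B →
    (∀ a → K ≤ a → A a → (B · C) a) → (∀ b c → B b → C c → K ≤ b * c → A (b * c)) → ¬ BoundedSet B

  m-primitive : NotBounded → ∀ {M} → NoLargeFactors n k m M → ∀ A′ → A′ ∼ A → MPrimitive A′
  m-primitive not-bounded {M} no-large A′ (K , iff) (B , C , B>0 , C>0 , B2 , C2 , A′≐BC) =
    enumerates-or-bounded B M λ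
      { (inj₂ bd) → not-bounded K B C B>0 C>0 B2 factor member bd
      ; (inj₁ eB) → enumerates-or-bounded C M λ
        { (inj₂ bd) → not-bounded K C B C>0 B>0 C2 factor′ member′ bd
        ; (inj₁ eC) → Factors.not-both-enumerated K A B C B>0 C>0 factor member n k m rep no-large in-A eB eC } }
    where
    factor : ∀ a → K ≤ a → A a → (B · C) a
    factor a K≤a Aa = Equivalence.to (A′≐BC a) (Equivalence.from (iff a K≤a) Aa)
    member : ∀ b c → B b → C c → K ≤ b * c → A (b * c)
    member b c Bb Cc K≤ = Equivalence.to (iff _ K≤) (Equivalence.from (A′≐BC _) (b , c , Bb , Cc , refl))
    factor′ : ∀ a → K ≤ a → A a → (C · B) a
    factor′ a K≤a Aa = let b , c , Bb , Cc , e = factor a K≤a Aa in c , b , Cc , Bb , trans e (*-comm b c)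
    member′ : ∀ c b → C c → B b → K ≤ c * b → A (c * b)
    member′ c b Cc Bb K≤ = subst A (*-comm b c) (member b c Bb Cc (subst (K ≤_) (*-comm c b) K≤))

  totally-primitive : NotBounded → TotallyMPrimitive A
  totally-primitive not-bounded = infinite , λ A′ _ → m-primitive not-bounded {Unbounded.M n 1<n cop k m} (Unbounded.no-large-factors n 1<n cop k m) A′

totally-primitive-≥2 : ∀ g h Γ″ → All (1 <_) (g ∷ h ∷ Γ″) → AllPairs Coprime (g ∷ h ∷ Γ″) → ∀ k
  (Λ : ℕ → Set) → (∀ {l} → Λ l → 1 ≤ l × l ≤ k) → ∀ m → Λ (2 + m) → (Λ 1 → m ≡ 0) →
  TotallyMPrimitive (Hof (g ∷ h ∷ Γ″) Λ)
totally-primitive-≥2 g h Γ″ 1<Γ coprime k Λ Λ-range m Λm Λ1 =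
  totally-primitive λ K B C B>0 C>0 B2 factor member →
    Factors.not-bounded K A B C B>0 C>0 factor member n 1<n cop k m
      (≤-trans (m≤n+m m 2) (proj₂ (Λ-range Λm))) rep in-A₂ B2
  where
  open Main g (h ∷ Γ″) 1<Γ coprime k Λ Λ-range m Λm Λ1
  in-A₂ : ∀ x → A (n zero ^ x zero + pwTail n x + m)
  in-A₂ x = 2 + m , Λm , two-term Γ 1<n cop m (SG-^ Γ 1<n cop zero (x zero))
    (SG-∏ Γ 1<n cop (λ i → SG-^ Γ 1<n cop (suc i) (x (suc i))))
    (coprime-∏ (λ i → coprime-^ (x zero) (x (suc i)) (cop zero (suc i) λ ())))

-- One generator: bounded factors

module OneGenerator (g : ℕ) (1<g : 1 < g) (k : ℕ) (Λ : ℕ → Set) (Λ-range : ∀ {l} → Λ l → 1 ≤ l × l ≤ k)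
  (K : ℕ) (B C : SetN) (B>0 : Positive B) (C>0 : Positive C)
  (factor : ∀ a → K ≤ a → Hof (g ∷ []) Λ a → (B · C) a)
  (member : ∀ b c → B b → C c → K ≤ b * c → Hof (g ∷ []) Λ (b * c)) (β : ℕ) (B≤ : ∀ b → B b → b ≤ β) where

  private
    Γ : List ℕ
    Γ = g ∷ []
    A : SetN
    A = Hof Γ Λ
    1<n : ∀ i → 1 < List.lookup Γ i
    1<n zero = 1<g
    cop : ∀ i j → i ≢ j → Coprime (List.lookup Γ i) (List.lookup Γ j)
    cop zero zero ne = contradiction refl ne

  open SingleGenerator (List.lookup Γ) 1<g
  open ≤-Reasoning

  multiples : ∀ m → Λ (2 + m) → Σ ℕ λ b → B b × ∀ b′ → B b′ →
    Σ ℕ λ l → Λ l × b′ * suc m ≡ b * (l ∸ 1) × Σ ℕ λ x → Σ ℕ λ y → b′ * g ^ x ≡ b * g ^ y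
  multiples m Λm with Factors.cofactor K A B C B>0 C>0 factor member B≤ a-large a∈A
    where
    -- The sum of three thresholds: divisibility by `g ^ (β k)`, the hypothesis `big` of `separate`,
    -- and the size required by `cofactor`.
    x₀ = β * k + (β * (g ^ (β * k) + k) + (β * K + K))
    a-large : β * K + K < g ^ x₀ + 1 + m
    a-large = ≤-trans (≤-trans (s≤s (≤-trans (m≤n+m _ (β * (g ^ (β * k) + k))) (m≤n+m _ (β * k))))
      (≤-trans (n<2^n x₀) (2^≤ x₀ 1<g))) (≤-trans (m≤m+n (g ^ x₀) 1) (m≤m+n _ m))
    a∈A : A (g ^ x₀ + 1 + m)
    a∈A = 2 + m , Λm , two-term Γ 1<n cop m (SG-^ Γ 1<n cop zero x₀) sg-one (coprime-1ʳ _)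
  ... | b , c , Bb , e , mult = b , Bb , λ b′ Bb′ → go b′ Bb′ (mult b′ Bb′)
    where
    x = β * k + (β * (g ^ (β * k) + k) + (β * K + K))
    go : ∀ b′ → B b′ → A (b′ * c) →
      Σ ℕ λ l → Λ l × b′ * suc m ≡ b * (l ∸ 1) × Σ ℕ λ x → Σ ℕ λ y → b′ * g ^ x ≡ b * g ^ y
    go b′ Bb′ (l , Λl , h) = l , Λl , proj₁ sep , x , y , proj₂ sep
      where
      r = H⇒Rep Γ 1<n cop h
      y = Rep.y r zero
      lem : ∀ a b c → a * (b * c) ≡ b * (a * c)
      lem = solve-∀
      equation : b′ * (g ^ x + suc m) ≡ b * (g ^ y + (l ∸ 1))
      equation = begin-equality
        b′ * (g ^ x + suc m)      ≡⟨ cong (b′ *_) (trans (sym (+-assoc (g ^ x) 1 m)) e) ⟩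
        b′ * (b * c)              ≡⟨ lem b′ b c ⟩
        b * (b′ * c)              ≡⟨ cong (b *_) (rep-value r) ⟩
        b * (g ^ y + (l ∸ 1))     ∎
      sep = separate {β} {k} {b} {b′} {suc m} {l ∸ 1} {x} {y} (B>0 b′ Bb′) (B≤ b Bb) (B≤ b′ Bb′)
        (≤-trans (n≤1+n _) (proj₂ (Λ-range Λm))) (≤-trans (m∸n≤m l 1) (proj₂ (Λ-range Λl)))
        (m≤m+n (β * k) _)
        (≤-trans (s≤s (≤-trans (m≤m+n _ (β * K + K)) (m≤n+m _ (β * k)))) (≤-trans (n<2^n x) (2^≤ x 1<g)))
        equation

  at-most-one : ∀ {b₀} → (∀ b → B b → b ≡ b₀) → ¬ AtLeastTwo B
  at-most-one h (b₁ , b₂ , b₁≢b₂ , Bb₁ , Bb₂) = b₁≢b₂ (trans (h b₁ Bb₁) (sym (h b₂ Bb₂)))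

≤⇒2+ : ∀ {k} → 2 ≤ k → Σ ℕ λ m → k ≡ 2 + m
≤⇒2+ {k} 2≤k = k ∸ 2 , sym (m+[n∸m]≡n 2≤k)

Exactly Upto : ℕ → ℕ → Set
Exactly k l = l ≡ k
Upto    k l = 1 ≤ l × l ≤ k

exactly-range : ∀ m {l} → Exactly (2 + m) l → 1 ≤ l × l ≤ 2 + m
exactly-range m refl = s≤s z≤n , ≤-refl

-- With exactly `k` summands on both sides the constants are both `k - 1`, so
-- `b′ (k - 1) = b (k - 1)`.
totally-primitive-H₁ : ∀ g → 1 < g → ∀ m → TotallyMPrimitive (Hof (g ∷ []) (Exactly (2 + m)))
totally-primitive-H₁ g 1<g m = Main.totally-primitive g [] (1<g ∷ []) ([] ∷ []) (2 + m) (Exactly (2 + m))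
  (exactly-range m) m refl (λ ()) not-bounded
  where
  not-bounded : Main.NotBounded g [] (1<g ∷ []) ([] ∷ []) (2 + m) (Exactly (2 + m)) (exactly-range m) m refl (λ ())
  not-bounded K B C B>0 C>0 B2 factor member (β , B≤) =
    let open OneGenerator g 1<g (2 + m) (Exactly (2 + m)) (exactly-range m) K B C B>0 C>0 factor member β B≤
        b , Bb , mult = multiples m refl
    in at-most-one (λ b′ Bb′ → same b b′ (mult b′ Bb′)) B2
    where
    same : ∀ b b′ → (Σ ℕ λ l → l ≡ 2 + m × b′ * suc m ≡ b * (l ∸ 1) × Σ ℕ λ x → Σ ℕ λ y → b′ * g ^ x ≡ b * g ^ y) → b′ ≡ b
    same b b′ (.(2 + m) , refl , e , _) = *-cancelʳ-≡ b′ b (suc m) e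

-- Multiple g m κ b b′: what is known of b and b′ when b′ (g ^ x + κ) = b (g ^ y + κ′) with κ′ ≤ k - 1 = suc m.
Multiple : ℕ → ℕ → ℕ → ℕ → ℕ → Set
Multiple g m κ b b′ = Σ ℕ λ l → Upto (2 + m) l × b′ * κ ≡ b * (l ∸ 1) × Σ ℕ λ x → Σ ℕ λ y → b′ * g ^ x ≡ b * g ^ y

Realised : ℕ → ℕ → SetN → ℕ → Set
Realised g m B κ = Σ ℕ λ b → B b × ∀ b′ → B b′ → Multiple g m κ b b′

ratio≤ : ∀ {m l} → Upto (2 + m) l → l ∸ 1 ≤ suc m
ratio≤ {l = suc l} (_ , s≤s p) = p

multiple-of-smallest : ∀ {g m b₀ b} → 0 < b → Multiple g m 1 b₀ b → Σ ℕ λ q → 0 < q × q ≤ suc m × b ≡ b₀ * q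
multiple-of-smallest {g} {m} {b₀} {b} 0<b (l , Λl , e , _) = l ∸ 1 , q>0 (l ∸ 1) b≡ , ratio≤ Λl , b≡
  where
  b≡ : b ≡ b₀ * (l ∸ 1)
  b≡ = trans (sym (*-identityʳ b)) e
  q>0 : ∀ q → b ≡ b₀ * q → 0 < q
  q>0 zero    b≡0 = contradiction (trans b≡0 (*-zeroʳ b₀)) (>⇒≢ 0<b)
  q>0 (suc _) _   = s≤s z≤n

-- No representation has a constant above `k - 1`, so the element realising `k - 1` is the largest.
below-largest : ∀ {g m b̂ b} → Multiple g m (suc m) b̂ b → b ≤ b̂
below-largest {g} {m} {b̂} {b} (l , Λl , e , _) =
  *-cancelʳ-≤ b b̂ (suc m) (≤-trans (≤-reflexive e) (*-monoʳ-≤ b̂ (ratio≤ Λl)))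

exceptional-multiples : ∀ {g i B} → 1 < g → Positive B → AtLeastTwo B →
  Realised g (suc i) B 1 → Realised g (suc i) B (2 + i) → Realised g (suc i) B (1 + i) → g ≡ 2 × i ≡ 0
exceptional-multiples {g} {i} {B} 1<g B>0 (b₁ , b₂ , b₁≢b₂ , Bb₁ , Bb₂) (b₀ , Bb₀ , mul₀) (b̂ , Bb̂ , mul̂) (b̃ , Bb̃ , mul̃) =
  conclude (multiple-of-smallest {g} {suc i} {b₀} (B>0 b̂ Bb̂) (mul₀ b̂ Bb̂)) (multiple-of-smallest {g} {suc i} {b₀} (B>0 b̃ Bb̃) (mul₀ b̃ Bb̃))
    (mul̂ b₀ Bb₀) (mul̃ b₀ Bb₀) (mul̃ b̂ Bb̂)
  where
  b₀≤ : ∀ b → B b → b₀ ≤ b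
  b₀≤ b Bb = let q , q>0 , _ , b≡ = multiple-of-smallest {g} {suc i} {b₀} (B>0 b Bb) (mul₀ b Bb)
    in subst (b₀ ≤_) (sym b≡) (m≤m*n b₀ q {{>-nonZero q>0}})
  conclude : (Σ ℕ λ q → 0 < q × q ≤ 2 + i × b̂ ≡ b₀ * q) → (Σ ℕ λ e → 0 < e × e ≤ 2 + i × b̃ ≡ b₀ * e) →
    Multiple g (suc i) (2 + i) b̂ b₀ → Multiple g (suc i) (1 + i) b̃ b₀ → Multiple g (suc i) (1 + i) b̃ b̂ → g ≡ 2 × i ≡ 0
  conclude (q , _ , q≤ , b̂≡) (e , _ , _ , b̃≡) (r , _ , α , _) (r′ , _ , β , _) (t , Λt , γ , x , y , powers) =
    single-generator-multiples {i} {b₀} {q} {e} {t ∸ 1} {r ∸ 1} {r′ ∸ 1} {g} {x} {y} (B>0 b₀ Bb₀) 1<g q≢1 e≤q q≤ (ratio≤ Λt)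
      (trans α (cong (_* (r ∸ 1)) b̂≡)) (trans β (cong (_* (r′ ∸ 1)) b̃≡))
      (subst₂ (λ u v → u * suc i ≡ v * (t ∸ 1)) b̂≡ b̃≡ γ)
      (subst₂ (λ u v → u * g ^ x ≡ v * g ^ y) b̂≡ b̃≡ powers)
    where
    e≤q : e ≤ q
    e≤q = *-cancelˡ-≤ b₀ {{>-nonZero (B>0 b₀ Bb₀)}} (subst₂ _≤_ b̃≡ b̂≡ (below-largest {g} (mul̂ b̃ Bb̃)))
    -- For `q = 1` the least element `b₀` and the greatest element `b̂` would coincide.
    q≢1 : q ≢ 1
    q≢1 refl = b₁≢b₂ (trans (only b₁ Bb₁) (sym (only b₂ Bb₂)))
      where
      only : ∀ b → B b → b ≡ b₀
      only b Bb = ≤-antisym (subst (b ≤_) (trans b̂≡ (*-identityʳ b₀)) (below-largest {g} (mul̂ b Bb))) (b₀≤ b Bb)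

no-multiples-k≡2 : ∀ {g B} → Positive B → AtLeastTwo B → ¬ Realised g 0 B 1
no-multiples-k≡2 {g} {B} B>0 (b₁ , b₂ , b₁≢b₂ , Bb₁ , Bb₂) (b₀ , Bb₀ , mul₀) =
  b₁≢b₂ (trans (only b₁ Bb₁) (sym (only b₂ Bb₂)))
  where
  only : ∀ b → B b → b ≡ b₀
  only b Bb = let q , q>0 , q≤1 , b≡ = multiple-of-smallest {g} {0} {b₀} (B>0 b Bb) (mul₀ b Bb)
    in trans b≡ (trans (cong (b₀ *_) (≤-antisym q≤1 q>0)) (*-identityʳ b₀))

totally-primitive-Hle₁ : ∀ g → 1 < g → ∀ m → ¬ (g ≡ 2 × m ≡ 1) → TotallyMPrimitive (Hof (g ∷ []) (Upto (2 + m)))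
totally-primitive-Hle₁ g 1<g m exc = Main.totally-primitive g [] (1<g ∷ []) ([] ∷ []) (2 + m) (Upto (2 + m))
  (λ p → p) 0 (s≤s z≤n , s≤s (s≤s z≤n)) (λ _ → refl)
  λ K B C B>0 C>0 B2 factor member (β , B≤) → absurd m exc B B>0 B2
    (λ j → OneGenerator.multiples g 1<g (2 + m) (Upto (2 + m)) (λ p → p) K B C B>0 C>0 factor member β B≤ j)
  where
  absurd : ∀ m → ¬ (g ≡ 2 × m ≡ 1) → ∀ B → Positive B → AtLeastTwo B →
    (∀ j → Upto (2 + m) (2 + j) → Realised g m B (suc j)) → ⊥
  absurd zero    exc B B>0 B2 real = no-multiples-k≡2 B>0 B2 (real 0 (s≤s z≤n , ≤-refl))
  absurd (suc i) exc B B>0 B2 real =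
    let g≡2 , i≡0 = exceptional-multiples 1<g B>0 B2 (real 0 (s≤s z≤n , s≤s (s≤s z≤n)))
                      (real (suc i) (s≤s z≤n , ≤-refl)) (real i (s≤s z≤n , n≤1+n _))
    in exc (g≡2 , cong suc i≡0)

-- Transfer to the sets of the theorem, and the exceptional factorisation

totally-primitive-cong : ∀ {A B} → A ≐ B → TotallyMPrimitive A → TotallyMPrimitive B
totally-primitive-cong A≐B (inf , prim) =
  (λ m → let a , m≤a , Aa = inf m in a , m≤a , Equivalence.to (A≐B a) Aa) ,
  λ A′ A′>0 (K , iff) → prim A′ A′>0 (K , λ a K≤a → mk⇔
    (λ A′a → Equivalence.from (A≐B a) (Equivalence.to (iff a K≤a) A′a))
    (λ Aa → Equivalence.from (iff a K≤a) (Equivalence.to (A≐B a) Aa)))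

Hof-exactly : ∀ Γ k → Hof Γ (Exactly k) ≐ H Γ k
Hof-exactly Γ k a = mk⇔ (λ { (.k , refl , h) → h }) (λ h → k , refl , h)

Hof-upto : ∀ Γ k → Hof Γ (Upto k) ≐ Hle Γ k
Hof-upto Γ k a = mk⇔ (λ (l , (p , q) , h) → l , p , q , h) (λ (l , p , q , h) → l , (p , q) , h)

exceptional : Hle (2 ∷ []) 3 ≐ (OneTwo · PowOrPowPlusOne)
exceptional a = mk⇔ to from
  where
  Γ : List ℕ
  Γ = 2 ∷ []
  1<2 : 1 < 2
  1<2 = s≤s (s≤s z≤n)
  1<n : ∀ i → 1 < List.lookup Γ i
  1<n zero = 1<2
  cop : ∀ i j → i ≢ j → Coprime (List.lookup Γ i) (List.lookup Γ j)
  cop zero zero ne = contradiction refl ne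
  sum-of : ∀ {l a} → H Γ l a → Σ ℕ λ y → a ≡ 2 ^ y + (l ∸ 1)
  sum-of h = Rep.y (H⇒Rep Γ 1<n cop h) zero , SingleGenerator.rep-value (List.lookup Γ) 1<2 (H⇒Rep Γ 1<n cop h)
  pow : ∀ e → SG Γ (2 ^ e)
  pow e = SG-^ Γ 1<n cop zero e
  double : ∀ p → 2 * p + 2 ≡ 2 * (p + 1)
  double = solve-∀
  classify : ∀ l {y} → l ≤ 3 → 1 ≤ l → a ≡ 2 ^ y + (l ∸ 1) → (OneTwo · PowOrPowPlusOne) a
  classify 1 {y} _ _ e = 1 , 2 ^ y , inj₁ refl , (y , inj₁ refl) , trans e (trans (+-identityʳ _) (sym (*-identityˡ _)))
  classify 2 {y} _ _ e = 1 , 2 ^ y + 1 , inj₁ refl , (y , inj₂ refl) , trans e (sym (*-identityˡ _))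
  -- `2 ^ 0 + 2` is odd, but equals `2 ^ 1 + 1`; for larger exponents a factor 2 splits off.
  classify 3 {zero}  _ _ e = 1 , 3 , inj₁ refl , (1 , inj₂ refl) , e
  classify 3 {suc y} _ _ e = 2 , 2 ^ y + 1 , inj₂ refl , (y , inj₂ refl) , trans e (double (2 ^ y))
  classify (suc (suc (suc (suc _)))) (s≤s (s≤s (s≤s ()))) _ _
  to : Hle Γ 3 a → (OneTwo · PowOrPowPlusOne) a
  to (l , 1≤l , l≤3 , h) = let y , e = sum-of {l} h in classify l {y} l≤3 1≤l e
  from : (OneTwo · PowOrPowPlusOne) a → Hle Γ 3 a
  from (.1 , .(2 ^ β) , inj₁ refl , (β , inj₁ refl) , e) =
    1 , s≤s z≤n , s≤s z≤n , subst (SG Γ) (sym (trans e (*-identityˡ _))) (pow β)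
  from (.1 , .(2 ^ β + 1) , inj₁ refl , (β , inj₂ refl) , e) =
    2 , s≤s z≤n , s≤s (s≤s z≤n) , subst (H Γ 2) (sym (trans e (trans (*-identityˡ _) (sym (+-identityʳ _)))))
      (two-term Γ 1<n cop 0 (pow β) sg-one (coprime-1ʳ _))
  from (.2 , .(2 ^ β) , inj₂ refl , (β , inj₁ refl) , e) =
    1 , s≤s z≤n , s≤s z≤n , subst (SG Γ) (sym e) (pow (suc β))
  from (.2 , .(2 ^ β + 1) , inj₂ refl , (β , inj₂ refl) , e) =
    3 , s≤s z≤n , ≤-refl , subst (H Γ 3) (sym (trans e (trans (sym (double (2 ^ β))) (sym (+-assoc (2 ^ suc β) 1 1)))))
      (two-term Γ 1<n cop 1 (pow (suc β)) sg-one (coprime-1ʳ _))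

H-totally-primitive : ∀ Γ → Γ ≢ [] → All (1 <_) Γ → AllPairs Coprime Γ → ∀ m → TotallyMPrimitive (H Γ (2 + m))
H-totally-primitive [] Γ≢[] _ _ _ = contradiction refl Γ≢[]
H-totally-primitive (g ∷ []) _ (1<g ∷ _) _ m =
  totally-primitive-cong (Hof-exactly (g ∷ []) (2 + m)) (totally-primitive-H₁ g 1<g m)
H-totally-primitive (g ∷ h ∷ Γ″) _ 1<Γ coprime m =
  totally-primitive-cong (Hof-exactly (g ∷ h ∷ Γ″) (2 + m))
    (totally-primitive-≥2 g h Γ″ 1<Γ coprime (2 + m) (Exactly (2 + m)) (exactly-range m) m refl (λ ()))

Hle-totally-primitive : ∀ Γ → Γ ≢ [] → All (1 <_) Γ → AllPairs Coprime Γ → ∀ m →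
  ¬ (Γ ≡ 2 ∷ [] × 2 + m ≡ 3) → TotallyMPrimitive (Hle Γ (2 + m))
Hle-totally-primitive [] Γ≢[] _ _ _ _ = contradiction refl Γ≢[]
Hle-totally-primitive (g ∷ []) _ (1<g ∷ _) _ m exc =
  totally-primitive-cong (Hof-upto (g ∷ []) (2 + m))
    (totally-primitive-Hle₁ g 1<g m λ { (refl , refl) → exc (refl , refl) })
Hle-totally-primitive (g ∷ h ∷ Γ″) _ 1<Γ coprime m _ =
  totally-primitive-cong (Hof-upto (g ∷ h ∷ Γ″) (2 + m))
    (totally-primitive-≥2 g h Γ″ 1<Γ coprime (2 + m) (Upto (2 + m)) (λ p → p) 0
      (s≤s z≤n , s≤s (s≤s z≤n)) (λ _ → refl))

theorem4 : (Γ : List ℕ) → Γ ≢ [] → All (1 <_) Γ → AllPairs Coprime Γ →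
    (k : ℕ) → 2 ≤ k →
    TotallyMPrimitive (H Γ k) ×
    (¬ (Γ ≡ 2 ∷ [] × k ≡ 3) → TotallyMPrimitive (Hle Γ k)) ×
    (Γ ≡ 2 ∷ [] → k ≡ 3 → Hle Γ k ≐ (OneTwo · PowOrPowPlusOne))
theorem4 Γ Γ≢[] 1<Γ coprime k 2≤k with m , refl ← ≤⇒2+ 2≤k =
  H-totally-primitive Γ Γ≢[] 1<Γ coprime m ,
  Hle-totally-primitive Γ Γ≢[] 1<Γ coprime m ,
  λ { refl refl → exceptional }
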